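{- There exists a family of centrally symmetric PL $i$-spheres $S_0\subset S_1\subset S_2\subset\cdots$ (with the involution of each $S_{i+1}$ restricting to that of $S_i$) such that each $S_i$ satisfies Property $\mathrm{P}_i$ with respect to some $(B_i,D_i,v_i)$ with $\partial B_i=S_{i-1}$, and each $S_i$ has no induced centrally symmetric $4$-cycle. Furthermore $f_0(S_{i+1})=f_0(S_i)+f_0(S_{i-1})+4$ for all $i\geq 1$.
   Context: A simplicial complex is centrally symmetric (cs) if its vertex set carries a free involution $\sigma$ mapping faces to faces and inducing a free involution on non-empty faces. An induced cs $4$-cycle is an induced subcomplex $C$ (containing every face whose vertices lie in $C$) isomorphic to a $4$-cycle with $\sigma(C)=C$. $f_0$ is the number of vertices. $\mathrm{st}_\Delta(F)=\{G\in\Delta:G\cup F\in\Delta\}$; $\Delta\setminus\Gamma$ is the induced subcomplex on $V(\Delta)\setminus V(\Gamma)$. PL balls/spheres: complexes PL homeomorphic to a simplex/boundary of a simplex. Property $\mathrm{P}_k$: a cs PL $k$-sphere $S$ with free involution $\sigma$ satisfies $\mathrm{P}_k$ if there are subcomplexes $S_0\subset\cdots\subset S_k=S$, each $S_i$ a PL $i$-sphere invariant under $\sigma$, and for each $1\leq i\leq k$ PL $i$-balls $B_i,D_i\subseteq S_i$ and a vertex $v_i\in D_i$ with: (i) $S_i=B_i\cup\sigma(B_i)$, $B_i\cap\sigma(B_i)=\partial B_i=S_{i-1}$; (ii) $S_i\setminus S_{i-1}$ is the union of $D_i$ and $\sigma(D_i)$ on disjoint vertex sets; (iii) $V(\mathrm{st}_{S_i}(v_i))\cup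 V(\mathrm{st}_{S_i}(\sigma(v_i)))=V(S_i)$; for $i=0$, $D_0=\{v_0\}$ for a vertex $v_0$ of the $0$-sphere $S_0$. -}

module Defs where

open import Data.Nat using (ℕ; zero; suc; _+_)
open import Data.Nat.Properties using (_≟_)
open import Data.List using (List; []; _∷_; _++_; map; filter; upTo; length; concat; deduplicate)
open import Data.List.Membership.Propositional using (_∈_; _∉_)
open import Data.List.Relation.Binary.Subset.Propositional using (_⊆_)
open import Data.List.Relation.Unary.Unique.Propositional using (Unique)
open import Data.Product using (Σ; ∃; _×_; _,_)
open import Data.Sum using (_⊎_)
open import Relation.Nullary using (¬_)
open import Relation.Nullary.Decidable using (¬?)
open import Relation.Binary.PropositionalEquality using (_≡_; _≢_)
open import Relation.Binary.Construct.Closure.Equivalence using (EqClosure)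

-- Finite sets of vertices are lists of naturals, compared as sets.

_≈ˢ_ : List ℕ → List ℕ → Set
X ≈ˢ Y = (X ⊆ Y) × (Y ⊆ X)

_⇔ₚ_ : Set → Set → Set
A ⇔ₚ B = (A → B) × (B → A)

NonEmptyˢ : List ℕ → Set
NonEmptyˢ X = Σ ℕ λ x → x ∈ X

-- A finite abstract simplicial complex on vertex labels ℕ, given by a
-- list of generating faces; its faces are all subsets of generators
-- (so it is automatically closed under taking subsets).

Complex : Set
Complex = List (List ℕ)

Face : Complex → List ℕ → Set
Face Δ X = Σ (List ℕ) λ F → (F ∈ Δ) × (X ⊆ F)

_∈V_ : ℕ → Complex → Set
x ∈V Δ = Face Δ (x ∷ [])

f₀ : Complex → ℕ
f₀ Δ = length (deduplicate _≟_ (concat Δ))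

_≅_ : Complex → Complex → Set
Δ ≅ Γ = ∀ X → Face Δ X ⇔ₚ Face Γ X

_⊑_ : Complex → Complex → Set
Γ ⊑ Δ = ∀ X → Face Γ X → Face Δ X

-- PL homeomorphism (combinatorial definition, Alexander–Newman):
-- the equivalence relation generated by stellar subdivisions.
-- Δ' is the stellar subdivision of Δ at a non-empty face A with a new
-- vertex a:  Δ' = (Δ minus faces containing A) ∪ a * ∂A * lk_Δ(A).

StellarSubdivision : Complex → Complex → Set
StellarSubdivision Δ Δ' =
  Σ (List ℕ) λ A → Σ ℕ λ a →
    Face Δ A × NonEmptyˢ A × ¬ (a ∈V Δ) ×
    (∀ X → Face Δ' X ⇔ₚ
       ((Face Δ X × ¬ (A ⊆ X)) ⊎
        (Σ (List ℕ) λ Y → (X ≈ˢ (a ∷ Y)) × Face Δ (Y ++ A) × ¬ (A ⊆ Y))))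

PLHomeomorphic : Complex → Complex → Set
PLHomeomorphic = EqClosure StellarSubdivision

simplex : ℕ → Complex
simplex d = upTo (suc d) ∷ []

∂simplex : ℕ → Complex
∂simplex d = map (λ j → filter (λ x → ¬? (x ≟ j)) (upTo (suc d))) (upTo (suc d))

IsPLBall : ℕ → Complex → Set
IsPLBall d Δ = PLHomeomorphic Δ (simplex d)

IsPLSphere : ℕ → Complex → Set
IsPLSphere d Δ = PLHomeomorphic Δ (∂simplex (suc d))

HasCard : List ℕ → ℕ → Set
HasCard X n = Unique X × length X ≡ n

BoundaryFace : ℕ → Complex → List ℕ → Set
BoundaryFace d Δ X =
  Σ (List ℕ) λ R → (X ⊆ R) × Face Δ R × HasCard R d ×
    (Σ (List ℕ) λ F → Face Δ F × HasCard F (suc d) × R ⊆ F ×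
       (∀ F' → Face Δ F' → HasCard F' (suc d) → R ⊆ F' → F' ≈ˢ F))

IsCS : (ℕ → ℕ) → Complex → Set
IsCS σ Δ =
  (∀ x → x ∈V Δ → σ (σ x) ≡ x) ×
  (∀ X → Face Δ X → Face Δ (map σ X)) ×
  (∀ X → Face Δ X → NonEmptyˢ X → ¬ (map σ X ≈ˢ X))

σFace : (ℕ → ℕ) → Complex → List ℕ → Set
σFace σ Γ X = Σ (List ℕ) λ Y → Face Γ Y × (X ≈ˢ map σ Y)

MinusFace : Complex → Complex → List ℕ → Set
MinusFace Δ Γ X = Face Δ X × (∀ x → x ∈ X → ¬ (x ∈V Γ))

HasInducedCS4Cycle : (ℕ → ℕ) → Complex → Set
HasInducedCS4Cycle σ Δ =
  Σ ℕ λ a → Σ ℕ λ b → Σ ℕ λ c → Σ ℕ λ d →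
    let C = a ∷ b ∷ c ∷ d ∷ [] in
    Unique C ×
    Face Δ (a ∷ b ∷ []) × Face Δ (b ∷ c ∷ []) ×
    Face Δ (c ∷ d ∷ []) × Face Δ (d ∷ a ∷ []) ×
    ¬ Face Δ (a ∷ c ∷ []) × ¬ Face Δ (b ∷ d ∷ []) ×
    (∀ x → x ∈ C → σ x ∈ C)

-- Property P, step i ≥ 1 (dimension d = i): S is the PL d-sphere S_i,
-- S⁻ = S_{i-1}, with ball B = B_i, ball D = D_i and vertex v = v_i.

PStep : (ℕ → ℕ) → ℕ → Complex → Complex → Complex → Complex → ℕ → Set
PStep σ d S⁻ S B D v =
  IsPLBall d B × B ⊑ S × IsPLBall d D × D ⊑ S × v ∈V D ×
  (∀ X → Face S X ⇔ₚ (Face B X ⊎ σFace σ B X)) ×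
  (∀ X → (Face B X × σFace σ B X) ⇔ₚ BoundaryFace d B X) ×
  (∀ X → BoundaryFace d B X ⇔ₚ Face S⁻ X) ×
  (∀ X → MinusFace S S⁻ X ⇔ₚ (Face D X ⊎ σFace σ D X)) ×
  (∀ x → x ∈V D → ¬ σFace σ D (x ∷ [])) ×
  -- (iii) V(st(v_i)) ∪ V(st(σ v_i)) = V(S_i)
  (∀ w → w ∈V S → Face S (v ∷ w ∷ []) ⊎ Face S (σ v ∷ w ∷ []))

{-# OPTIONS --safe #-}
module Submission where

-- Let the positive vertices of S be one half of each antipodal pair. From S_{i-1} ⊂ S_i = B_i ∪ σ B_i
-- form the cone with apex v over S_i, subdivide its edge from v to each negative vertex h of
-- S_{i-1} by a vertex x_h, and move the part of the link of v lying over σ B_i to a further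
-- apex y. With a prime for replacing each h by x_h, the resulting ball is
--   B_{i+1} = collar ∪ v * B_i′ ∪ v * y * S_{i-1}′ ∪ y * (σ B_i)′,
-- and it has boundary S_i. Then v is adjacent to exactly the positive vertices, y to vertices
-- of one sign on each antipodal pair, and x_h only to neighbours of h, so that
-- no vertex is adjacent to a and σ a. The new vertices induce v * y * K, where K is a
-- relabelled star of v_{i-1} in S_{i-1}, hence a ball.
--
-- Replacing the apex v by two apices v and y is a sequence of stellar moves fixing the base
-- of the cone, found by induction on i. It shows that B_{i+1} is equivalent
-- to the cone over S_i relative to S_i, so S_{i+1} is equivalent to the suspension of S_i.
-- Modulo equality of faces, complexes form a commutative semiring under union and join, in
-- which the bookkeeping of the moves is a semiring identity.

-- One apex is not enough because the interior vertices of σ B_i are negative: once the edges to the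
-- negative vertices of S_{i-1} are subdivided, v would still be adjacent to both vertices of every
-- later pair. Subdividing those edges as well would spend a new vertex on each of them. With two
-- apices, v sees the interior of B_i and y that of σ B_i. A half then has one new vertex per pair
-- of S_{i-1} and the two apices, so both halves together contribute f₀(S_{i-1}) + 4. Stellar
-- equivalence is not evidently preserved by unions and joins, since the new vertex of a subdivision
-- may already occur in the context. Instead of gluing theorems for PL balls, equivalences are
-- therefore stated inside `Γ ++ B ⋆ L` for arbitrary `Γ` and `L`, subject to freshness conditions.
-- The inductions exploit this freedom: suspension points, or the end points of an edge, are moved
-- into `L` before a hypothesis is applied.

open import Defs
open import Algebra.Bundles using (CommutativeSemiring)
import Algebra.Solver.Ring.NaturalCoefficients.Default as SemiringSolver
open import Algebra.Structures.Biased using (isCommutativeSemiringˡ)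
open import Data.Empty using (⊥; ⊥-elim)
open import Data.List using (List; []; _∷_; _++_; map; filter; upTo; length; concat; deduplicate; cartesianProductWith)
open import Data.List.Membership.Propositional using (_∈_; _∉_; lose)
open import Data.List.Membership.Propositional.Properties
open import Data.List.Properties using (map-++; map-∘; map-id-local; map-cong; map-id; ++-assoc; length-map; length-upTo; filter-accept; filter-reject; filter-notAll)
open import Data.List.Relation.Binary.Subset.Propositional using (_⊆_)
import Data.List.Relation.Binary.Subset.Propositional.Properties as Sub
open import Data.List.Relation.Unary.All as All using ([]; _∷_)
open import Data.List.Relation.Unary.AllPairs using ([]; _∷_)
open import Data.List.Relation.Unary.Any using (here; there)
open import Data.List.Relation.Unary.Unique.Propositional using (Unique)
import Data.List.Relation.Unary.Unique.Propositional.Properties as Unique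
open import Data.Nat using (ℕ; zero; suc; _+_; _≤_; _<_; s≤s; z≤n; s<s⁻¹)
open import Data.Nat.ListAction using (sum)
open import Data.Nat.Properties using (_≟_; ≤-refl; ≤-trans; m≤m+n; m≤n+m; <-irrefl; m≤n⇒m≤1+n; <⇒≢; m≤n⇒m<n∨m≡n; m≤n⇒m≤o+n; <⇒≤; n<1+n; +-cancelˡ-≡; suc-injective; _<?_; ≮⇒≥; <⇒≱; +-monoʳ-<; m≤n⇒∃[o]m+o≡n; +-identityʳ; +-suc; +-cancelˡ-<; _≤?_; ≤-antisym; +-comm)
open import Data.List.Membership.DecPropositional _≟_ using (_∈?_)
open import Data.List.Relation.Unary.Unique.DecPropositional.Properties _≟_ using (deduplicate-!)
open import Data.Product using (Σ; ∃; _×_; _,_; proj₁; proj₂)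
open import Data.Sum using (_⊎_; inj₁; inj₂; [_,_]′)
open import Function using (_∘_; id)
open import Relation.Binary.Construct.Closure.Equivalence as Eq using (EqClosure)
open import Relation.Binary.Construct.Closure.ReflexiveTransitive using (ε; _◅_; _◅◅_)
open import Relation.Binary.Construct.Closure.Symmetric using (fwd; bwd)
open import Relation.Binary.PropositionalEquality using (_≡_; _≢_; refl; sym; trans; cong; cong₂; subst; subst₂)
import Relation.Binary.Reasoning.Setoid as SetoidReasoning
open import Relation.Binary.Structures using (IsEquivalence)
open import Relation.Nullary using (¬_; Dec; yes; no)
open import Relation.Nullary.Decidable using (¬?)

-- Complexes up to equality of faces

opaque
  infixr 7 _⋆_
  _⋆_ : Complex → Complex → Complex
  Δ ⋆ Γ = cartesianProductWith _++_ Δ Γ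

  ∈-⋆⁺ : ∀ {Δ Γ F G} → F ∈ Δ → G ∈ Γ → F ++ G ∈ Δ ⋆ Γ
  ∈-⋆⁺ = ∈-cartesianProductWith⁺ _++_

  ∈-⋆⁻ : ∀ {Δ Γ H} → H ∈ Δ ⋆ Γ → ∃ λ F → ∃ λ G → F ∈ Δ × G ∈ Γ × H ≡ F ++ G
  ∈-⋆⁻ {Δ} {Γ} = ∈-cartesianProductWith⁻ _++_ Δ Γ

  map-map-⋆ : ∀ g Δ Γ → map (map g) (Δ ⋆ Γ) ≡ map (map g) Δ ⋆ map (map g) Γ
  map-map-⋆ g [] Γ = refl
  map-map-⋆ g (F ∷ Δ) Γ = trans (map-++ (map g) (map (F ++_) Γ) _)
    (cong₂ _++_ (trans (sym (map-∘ Γ)) (trans (map-cong (map-++ g F) Γ) (map-∘ Γ))) (map-map-⋆ g Δ Γ))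

⟪_⟫ : List ℕ → Complex
⟪ A ⟫ = A ∷ []

⟨_⟩ : ℕ → Complex
⟨ v ⟩ = ⟪ v ∷ [] ⟫

∈-⟨⟩⋆⁺ : ∀ {v Δ F} → F ∈ Δ → (v ∷ F) ∈ ⟨ v ⟩ ⋆ Δ
∈-⟨⟩⋆⁺ = ∈-⋆⁺ (here refl)

∈-⟨⟩⋆⁻ : ∀ {v Δ H} → H ∈ ⟨ v ⟩ ⋆ Δ → ∃ λ F → F ∈ Δ × H ≡ v ∷ F
∈-⟨⟩⋆⁻ p with ∈-⋆⁻ p
... | _ , G , here refl , G∈ , refl = G , G∈ , refl

_≼_ : Complex → Complex → Set
Δ ≼ Γ = ∀ {F} → F ∈ Δ → Face Γ F

≼-≅ : ∀ {Δ Γ} → Δ ≼ Γ → Γ ≼ Δ → Δ ≅ Γ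
≼-≅ p q X = go p , go q
  where
  go : ∀ {Δ Γ} → Δ ≼ Γ → Face Δ X → Face Γ X
  go p (F , F∈ , X⊆F) with p F∈
  ... | G , G∈ , F⊆G = G , G∈ , F⊆G ∘ X⊆F

gen : ∀ {Δ F} → F ∈ Δ → Face Δ F
gen {F = F} F∈ = F , F∈ , id

≅-refl : ∀ {Δ} → Δ ≅ Δ
≅-refl X = id , id

≅-sym : ∀ {Δ Γ} → Δ ≅ Γ → Γ ≅ Δ
≅-sym p X = proj₂ (p X) , proj₁ (p X)

≅-trans : ∀ {Δ Γ Θ} → Δ ≅ Γ → Γ ≅ Θ → Δ ≅ Θ
≅-trans p q X = proj₁ (q X) ∘ proj₁ (p X) , proj₂ (p X) ∘ proj₂ (q X)

Face-++⁻ : ∀ Δ {Γ X} → Face (Δ ++ Γ) X → Face Δ X ⊎ Face Γ X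
Face-++⁻ Δ (F , F∈ , s) with ∈-++⁻ Δ F∈
... | inj₁ p = inj₁ (F , p , s)
... | inj₂ p = inj₂ (F , p , s)

Face-++ˡ : ∀ {Δ Γ X} → Face Δ X → Face (Δ ++ Γ) X
Face-++ˡ (F , F∈ , s) = F , ∈-++⁺ˡ F∈ , s

Face-++ʳ : ∀ Δ {Γ X} → Face Γ X → Face (Δ ++ Γ) X
Face-++ʳ Δ (F , F∈ , s) = F , ∈-++⁺ʳ Δ F∈ , s

Face-⋆ : ∀ {Δ Γ X Y} → Face Δ X → Face Γ Y → Face (Δ ⋆ Γ) (X ++ Y)
Face-⋆ (F , F∈ , s) (G , G∈ , t) = F ++ G , ∈-⋆⁺ F∈ G∈ , Sub.++⁺ s t

++-mono : ∀ {Δ Δ′ Γ Γ′} → Δ ≅ Δ′ → Γ ≅ Γ′ → (Δ ++ Γ) ≅ (Δ′ ++ Γ′)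
++-mono p q X = go p q , go (≅-sym p) (≅-sym q)
  where
  go : ∀ {Δ Δ′ Γ Γ′} → Δ ≅ Δ′ → Γ ≅ Γ′ → Face (Δ ++ Γ) X → Face (Δ′ ++ Γ′) X
  go {Δ} {Δ′} p q f = [ Face-++ˡ ∘ proj₁ (p X) , Face-++ʳ Δ′ ∘ proj₁ (q X) ]′ (Face-++⁻ Δ f)

⋆-mono : ∀ {Δ Δ′ Γ Γ′} → Δ ≅ Δ′ → Γ ≅ Γ′ → (Δ ⋆ Γ) ≅ (Δ′ ⋆ Γ′)
⋆-mono p q = ≼-≅ (go p q) (go (≅-sym p) (≅-sym q))
  where
  go : ∀ {Δ Δ′ Γ Γ′} → Δ ≅ Δ′ → Γ ≅ Γ′ → (Δ ⋆ Γ) ≼ (Δ′ ⋆ Γ′)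
  go p q h with ∈-⋆⁻ h
  ... | F , G , F∈ , G∈ , refl = Face-⋆ (proj₁ (p F) (gen F∈)) (proj₁ (q G) (gen G∈))

complexes : CommutativeSemiring _ _
complexes = record
  { Carrier = Complex ; _≈_ = _≅_ ; _+_ = _++_ ; _*_ = _⋆_ ; 0# = [] ; 1# = ⟪ [] ⟫
  ; isCommutativeSemiring = isCommutativeSemiringˡ record
    { +-isCommutativeMonoid = record
      { isMonoid = record
        { isSemigroup = record
          { isMagma = record { isEquivalence = equiv ; ∙-cong = ++-mono }
          ; assoc = λ A B C → ≼-≅ (λ {F} p → F , ++-assocʳ A B p , id) (λ {F} p → F , ++-assocˡ A B p , id) }
        ; identity = (λ A → ≅-refl) , (λ A → ≼-≅ (λ {F} p → F , [ id , (λ ()) ]′ (∈-++⁻ A p) , id)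
                                               (λ {F} p → F , ∈-++⁺ˡ p , id)) }
      ; comm = λ A B → ≼-≅ (λ {F} p → F , ++-swap A B p , id) (λ {F} p → F , ++-swap B A p , id) }
    ; *-isCommutativeMonoid = record
      { isMonoid = record
        { isSemigroup = record
          { isMagma = record { isEquivalence = equiv ; ∙-cong = ⋆-mono }
          ; assoc = λ A B C → ≼-≅ (assoc₁ A B C) (assoc₂ A B C) }
        ; identity = (λ A → ≼-≅ (idˡ A) (λ {F} p → F , ∈-⋆⁺ (here refl) p , id)) ,
                     (λ A → ≅-trans (≼-≅ (comm A _) (comm _ A)) (≼-≅ (idˡ A) (λ {F} p → F , ∈-⋆⁺ (here refl) p , id))) }
      ; comm = λ A B → ≼-≅ (comm A B) (comm B A) }
    ; distribʳ = λ A B C → ≼-≅ (dist₁ A B C) (dist₂ A B C)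
    ; zeroˡ = λ A → ≼-≅ (λ p → ⊥-elim (no-[] p)) (λ ())
    } }
  where
  equiv : IsEquivalence _≅_
  equiv = record { refl = ≅-refl ; sym = ≅-sym ; trans = ≅-trans }
  ++-assocʳ : ∀ {X : Set} (A B : List X) {C} → (A ++ B) ++ C ⊆ A ++ (B ++ C)
  ++-assocʳ A B p with ∈-++⁻ (A ++ B) p
  ... | inj₂ c = ∈-++⁺ʳ A (∈-++⁺ʳ B c)
  ... | inj₁ ab with ∈-++⁻ A ab
  ... | inj₁ a = ∈-++⁺ˡ a
  ... | inj₂ b = ∈-++⁺ʳ A (∈-++⁺ˡ b)
  ++-assocˡ : ∀ {X : Set} (A B : List X) {C} → A ++ (B ++ C) ⊆ (A ++ B) ++ C
  ++-assocˡ A B p with ∈-++⁻ A p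
  ... | inj₁ a = ∈-++⁺ˡ (∈-++⁺ˡ a)
  ... | inj₂ bc with ∈-++⁻ B bc
  ... | inj₁ b = ∈-++⁺ˡ (∈-++⁺ʳ A b)
  ... | inj₂ c = ∈-++⁺ʳ (A ++ B) c
  ++-swap : ∀ {X : Set} (A B : List X) → A ++ B ⊆ B ++ A
  ++-swap A B z = [ ∈-++⁺ʳ B , ∈-++⁺ˡ ]′ (∈-++⁻ A z)
  comm : ∀ A B → (A ⋆ B) ≼ (B ⋆ A)
  comm A B p with ∈-⋆⁻ p
  ... | F , G , F∈ , G∈ , refl = G ++ F , ∈-⋆⁺ G∈ F∈ , ++-swap F G
  assoc₁ : ∀ A B C → ((A ⋆ B) ⋆ C) ≼ (A ⋆ (B ⋆ C))
  assoc₁ A B C p with ∈-⋆⁻ p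
  ... | _ , H , q , H∈ , refl with ∈-⋆⁻ q
  ... | F , G , F∈ , G∈ , refl = F ++ (G ++ H) , ∈-⋆⁺ F∈ (∈-⋆⁺ G∈ H∈) , ++-assocʳ F G
  assoc₂ : ∀ A B C → (A ⋆ (B ⋆ C)) ≼ ((A ⋆ B) ⋆ C)
  assoc₂ A B C p with ∈-⋆⁻ p
  ... | F , _ , F∈ , q , refl with ∈-⋆⁻ q
  ... | G , H , G∈ , H∈ , refl = (F ++ G) ++ H , ∈-⋆⁺ (∈-⋆⁺ F∈ G∈) H∈ , ++-assocˡ F G
  idˡ : ∀ A → (⟪ [] ⟫ ⋆ A) ≼ A
  idˡ A p with ∈-⋆⁻ p
  ... | _ , G , here refl , G∈ , refl = G , G∈ , id
  no-[] : ∀ {A F} → F ∈ [] ⋆ A → ⊥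
  no-[] p with ∈-⋆⁻ p
  ... | _ , _ , () , _
  dist₁ : ∀ A B C → ((B ++ C) ⋆ A) ≼ ((B ⋆ A) ++ (C ⋆ A))
  dist₁ A B C p with ∈-⋆⁻ p
  ... | F , G , F∈ , G∈ , refl with ∈-++⁻ B F∈
  ... | inj₁ b = Face-++ˡ (F ++ G , ∈-⋆⁺ b G∈ , id)
  ... | inj₂ c = Face-++ʳ (B ⋆ A) (F ++ G , ∈-⋆⁺ c G∈ , id)
  dist₂ : ∀ A B C → ((B ⋆ A) ++ (C ⋆ A)) ≼ ((B ++ C) ⋆ A)
  dist₂ A B C p with ∈-++⁻ (B ⋆ A) p
  dist₂ A B C p | inj₁ q with ∈-⋆⁻ q
  ... | F , G , F∈ , G∈ , refl = F ++ G , ∈-⋆⁺ (∈-++⁺ˡ F∈) G∈ , id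
  dist₂ A B C p | inj₂ q with ∈-⋆⁻ q
  ... | F , G , F∈ , G∈ , refl = F ++ G , ∈-⋆⁺ (∈-++⁺ʳ B F∈) G∈ , id

open SemiringSolver complexes using (solve; _:=_; con) renaming (_:+_ to infixr 6 _:+_; _:*_ to infixr 7 _:*_)

-- Stellar equivalence

-- Equality of faces is added to the generating relation, because complexes
-- without vertices admit no stellar subdivision.
StellarOr≅ : Complex → Complex → Set
StellarOr≅ Δ Γ = Δ ≅ Γ ⊎ StellarSubdivision Δ Γ

infix 4 _∼_
_∼_ : Complex → Complex → Set
_∼_ = EqClosure StellarOr≅

∼-sym : ∀ {Δ Γ} → Δ ∼ Γ → Γ ∼ Δ
∼-sym = Eq.symmetric _

≅⇒∼ : ∀ {Δ Γ} → Δ ≅ Γ → Δ ∼ Γ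
≅⇒∼ p = fwd (inj₁ p) ◅ ε

module ∼-Reasoning where
  open SetoidReasoning (Eq.setoid StellarOr≅) public using (begin_; step-≈-⟩; step-≈-⟨; _∎)

infix 4 _#_
_#_ : ℕ → Complex → Set
q # Δ = ∀ {F} → F ∈ Δ → q ∉ F

NoFace : List ℕ → Complex → Set
NoFace A Δ = ∀ {F} → F ∈ Δ → ¬ (A ⊆ F)

infixr 5 _⊕_
infixr 7 _⊗_

_⊕_ : ∀ {q Δ Γ} → q # Δ → q # Γ → q # (Δ ++ Γ)
_⊕_ {Δ = Δ} p r F∈ = [ p , r ]′ (∈-++⁻ Δ F∈)

_⊗_ : ∀ {q Δ Γ} → q # Δ → q # Γ → q # (Δ ⋆ Γ)
_⊗_ p r H∈ z with ∈-⋆⁻ H∈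
... | F , G , F∈ , G∈ , refl = [ p F∈ , r G∈ ]′ (∈-++⁻ F z)

≢# : ∀ {q v} → q ≢ v → q # ⟨ v ⟩
≢# n (here refl) (here refl) = n refl

infixr 5 _⊞_
_⊞_ : ∀ {A Δ Γ} → NoFace A Δ → NoFace A Γ → NoFace A (Δ ++ Γ)
_⊞_ {Δ = Δ} p r F∈ = [ p , r ]′ (∈-++⁻ Δ F∈)

#⇒NoFaceˡ : ∀ {a b Δ} → a # Δ → NoFace (a ∷ b ∷ []) Δ
#⇒NoFaceˡ p F∈ s = p F∈ (s (here refl))

#⇒NoFaceʳ : ∀ {a b Δ} → b # Δ → NoFace (a ∷ b ∷ []) Δ
#⇒NoFaceʳ p F∈ s = p F∈ (s (there (here refl)))

rm : ℕ → List ℕ → List ℕ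
rm j A = filter (λ x → ¬? (x ≟ j)) A

bd : List ℕ → Complex
bd A = map (λ j → rm j A) A

∈-rm⁺ : ∀ {z j A} → z ∈ A → z ≢ j → z ∈ rm j A
∈-rm⁺ {j = j} = ∈-filter⁺ (λ x → ¬? (x ≟ j))

∈-rm⁻ : ∀ {z j A} → z ∈ rm j A → z ∈ A × z ≢ j
∈-rm⁻ {j = j} {A} = ∈-filter⁻ (λ x → ¬? (x ≟ j)) {xs = A}

⊈⇒∃ : ∀ A {X : List ℕ} → ¬ (A ⊆ X) → ∃ λ j → j ∈ A × j ∉ X
⊈⇒∃ [] n = ⊥-elim (n λ ())
⊈⇒∃ (a ∷ A) {X} n with a ∈? X
... | no a∉ = a , here refl , a∉
... | yes a∈ with ⊈⇒∃ A (λ s → n λ { (here refl) → a∈ ; (there z) → s z })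
... | j , j∈ , j∉ = j , there j∈ , j∉

∈-bd⁻ : ∀ {A F} → F ∈ bd A → ∃ λ j → j ∈ A × F ≡ rm j A
∈-bd⁻ {A} = ∈-map⁻ (λ j → rm j A)

∈-bd⁺ : ∀ {A j} → j ∈ A → rm j A ∈ bd A
∈-bd⁺ {A} = ∈-map⁺ (λ j → rm j A)

#-bd : ∀ {q A} → q ∉ A → q # bd A
#-bd n F∈ z with ∈-bd⁻ F∈
... | j , j∈ , refl = n (proj₁ (∈-rm⁻ z))

-- The hypotheses make `⟪ A ⟫ ⋆ L` the star of `A` and `L` its link: no generator in `Γ` contains
-- `A`, and no vertex of `A` occurs in `L`. The generator of `L` guarantees that `A` is a face.
stellarSubdivision : ∀ {Γ A L q} → NonEmptyˢ A → ∃ (_∈ L) → (∀ {z} → z ∈ A → z # L) → NoFace A Γ →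
  q # Γ → q # L → q ∉ A → StellarSubdivision (Γ ++ ⟪ A ⟫ ⋆ L) (Γ ++ (⟨ q ⟩ ⋆ bd A) ⋆ L)
stellarSubdivision {Γ} {A} {L} {q} nonempty (l , l∈) A#L A∉Γ q#Γ q#L q∉A =
  A , q , Face-++ʳ Γ (A ++ l , ∈-⋆⁺ (here refl) l∈ , ∈-++⁺ˡ) , nonempty ,
    fresh , λ X → to X , [ from₁ X , from₂ X ]′
  where
  Δ = Γ ++ ⟪ A ⟫ ⋆ L
  Δ′ = Γ ++ (⟨ q ⟩ ⋆ bd A) ⋆ L
  #⟪A⟫ : q # ⟪ A ⟫
  #⟪A⟫ (here refl) = q∉A
  fresh : ¬ (q ∈V Δ)
  fresh (F , F∈ , s) = (q#Γ ⊕ #⟪A⟫ ⊗ q#L) F∈ (s (here refl))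
  ∈Δ⁻ : ∀ {F} → F ∈ ⟪ A ⟫ ⋆ L → ∃ λ G → G ∈ L × F ≡ A ++ G
  ∈Δ⁻ p with ∈-⋆⁻ p
  ... | _ , G , here refl , G∈ , e = G , G∈ , e
  ∈Δ′⁻ : ∀ {F} → F ∈ (⟨ q ⟩ ⋆ bd A) ⋆ L → ∃ λ j → ∃ λ G → j ∈ A × G ∈ L × F ≡ (q ∷ rm j A) ++ G
  ∈Δ′⁻ p with ∈-⋆⁻ p
  ... | _ , G , F∈ , G∈ , e with ∈-⟨⟩⋆⁻ F∈
  ... | _ , K∈ , refl with ∈-bd⁻ K∈
  ... | j , j∈ , refl = j , G , j∈ , G∈ , e
  cofacet : ∀ {j G X} → j ∈ A → G ∈ L → (∀ {z} → z ∈ X → z ≢ q → z ∈ A ++ G × z ≢ j) → Face Δ′ X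
  cofacet {j} {G} {X} j∈ G∈ s = Face-++ʳ Γ (_ , ∈-⋆⁺ (∈-⟨⟩⋆⁺ (∈-bd⁺ j∈)) G∈ , sub)
    where
    sub : X ⊆ (q ∷ rm j A) ++ G
    sub {z} z∈ with z ≟ q
    ... | yes refl = here refl
    ... | no z≢q with s z∈ z≢q
    ... | z∈AG , z≢j = there ([ (λ a → ∈-++⁺ˡ (∈-rm⁺ a z≢j)) , ∈-++⁺ʳ (rm j A) ]′ (∈-++⁻ A z∈AG))
  ∉cofacet : ∀ {j G} → j ∈ A → G ∈ L → j ∉ (q ∷ rm j A) ++ G
  ∉cofacet j∈ G∈ (here refl) = q∉A j∈
  ∉cofacet {j} j∈ G∈ (there z) = [ (λ a → proj₂ (∈-rm⁻ {A = A} a) refl) , A#L j∈ G∈ ]′ (∈-++⁻ (rm j A) z)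
  cofacet⊆ : ∀ {j G z} → z ∈ (q ∷ rm j A) ++ G → z ≢ q → z ∈ A ++ G
  cofacet⊆ (here refl) n = ⊥-elim (n refl)
  cofacet⊆ {j} (there z) n = Sub.++⁺ {ws = rm j A} (proj₁ ∘ ∈-rm⁻) id z
  to : ∀ X → Face Δ′ X → (Face Δ X × ¬ (A ⊆ X)) ⊎
        (Σ (List ℕ) λ Y → (X ≈ˢ (q ∷ Y)) × Face Δ (Y ++ A) × ¬ (A ⊆ Y))
  to X (F , F∈ , s) with ∈-++⁻ Γ F∈
  ... | inj₁ p = inj₁ ((F , ∈-++⁺ˡ p , s) , λ t → A∉Γ p (s ∘ t))
  -- The new generator with index `j` omits the vertex `j` of `A`, so `j` witnesses that `A` is not
  -- contained in the face.
  ... | inj₂ p with ∈Δ′⁻ p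
  ... | j , G , j∈ , G∈ , refl with q ∈? X
  ... | no q∉ = inj₁ (Face-++ʳ Γ (A ++ G , ∈-⋆⁺ (here refl) G∈ ,
                        λ z → cofacet⊆ (s z) (λ { refl → q∉ z })) ,
                      λ t → ∉cofacet j∈ G∈ (s (t j∈)))
  ... | yes q∈ = inj₂ (rm q X ,
        ((λ {z} z∈ → split z∈ (z ≟ q)) , (λ { (here refl) → q∈ ; (there z) → proj₁ (∈-rm⁻ z) })) ,
        Face-++ʳ Γ (A ++ G , ∈-⋆⁺ (here refl) G∈ ,
          λ z → [ (λ y → let (y∈ , y≢) = ∈-rm⁻ {A = X} y in cofacet⊆ (s y∈) y≢) , ∈-++⁺ˡ ]′ (∈-++⁻ (rm q X) z)) ,
        λ t → ∉cofacet j∈ G∈ (s (proj₁ (∈-rm⁻ {A = X} (t j∈)))))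
    where
    split : ∀ {z} → z ∈ X → Dec (z ≡ q) → z ∈ q ∷ rm q X
    split z∈ (yes refl) = here refl
    split z∈ (no n) = there (∈-rm⁺ z∈ n)
  from₁ : ∀ X → Face Δ X × ¬ (A ⊆ X) → Face Δ′ X
  from₁ X ((F , F∈ , s) , n) with ∈-++⁻ Γ F∈
  ... | inj₁ p = F , ∈-++⁺ˡ p , s
  ... | inj₂ p with ∈Δ⁻ p | ⊈⇒∃ A n
  ... | G , G∈ , refl | j , j∈ , j∉ = cofacet j∈ G∈ λ z _ → s z , λ { refl → j∉ z }
  from₂ : ∀ X → (Σ (List ℕ) λ Y → (X ≈ˢ (q ∷ Y)) × Face Δ (Y ++ A) × ¬ (A ⊆ Y)) → Face Δ′ X
  from₂ X (Y , (X⊆ , _) , (F , F∈ , s) , n) with ∈-++⁻ Γ F∈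
  ... | inj₁ p = ⊥-elim (A∉Γ p (s ∘ ∈-++⁺ʳ Y))
  ... | inj₂ p with ∈Δ⁻ p | ⊈⇒∃ A n
  ... | G , G∈ , refl | j , j∈ , j∉ = cofacet j∈ G∈ λ z z≢q → inY (X⊆ z) z≢q
    where
    inY : ∀ {z} → z ∈ q ∷ Y → z ≢ q → z ∈ A ++ G × z ≢ j
    inY (here refl) n = ⊥-elim (n refl)
    inY (there y) _ = s (∈-++⁺ˡ y) , λ { refl → j∉ y }

-- If `L` has no generators, both joins are empty and the two sides agree. Hence the later moves
-- need no case distinction on whether a link is void.
subdivide : ∀ {Γ A L q} → NonEmptyˢ A → (∀ {z} → z ∈ A → z # L) → NoFace A Γ →
  q # Γ → q # L → q ∉ A → Γ ++ ⟪ A ⟫ ⋆ L ∼ Γ ++ (⟨ q ⟩ ⋆ bd A) ⋆ L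
subdivide {Γ} {A} {[]} {q} _ _ _ _ _ _ = ≅⇒∼ (++-mono {Γ} ≅-refl
  (≼-≅ (λ p → ⊥-elim (void p)) (λ p → ⊥-elim (void p))))
  where
  void : ∀ {B F} → F ∈ B ⋆ [] → ⊥
  void p with ∈-⋆⁻ p
  ... | _ , _ , _ , () , _
subdivide {L = l ∷ _} nonempty A#L A∉Γ q#Γ q#L q∉A =
  fwd (inj₂ (stellarSubdivision nonempty (l , here refl) A#L A∉Γ q#Γ q#L q∉A)) ◅ ε

bd-edge : ∀ {v w} → v ≢ w → bd (v ∷ w ∷ []) ≅ (⟨ v ⟩ ++ ⟨ w ⟩)
bd-edge {v} {w} v≢w = ≼-≅ to from
  where
  to : bd (v ∷ w ∷ []) ≼ (⟨ v ⟩ ++ ⟨ w ⟩)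
  to p with ∈-bd⁻ {v ∷ w ∷ []} p
  ... | .v , here refl , refl = _ , there (here refl) , λ z → sub (∈-rm⁻ {A = v ∷ w ∷ []} z)
    where
    sub : ∀ {z} → z ∈ v ∷ w ∷ [] × z ≢ v → z ∈ w ∷ []
    sub (here refl , n) = ⊥-elim (n refl)
    sub (there z , _) = z
  ... | .w , there (here refl) , refl = _ , here refl , λ z → sub (∈-rm⁻ {A = v ∷ w ∷ []} z)
    where
    sub : ∀ {z} → z ∈ v ∷ w ∷ [] × z ≢ w → z ∈ v ∷ []
    sub (here refl , n) = here refl
    sub (there (here refl) , n) = ⊥-elim (n refl)
  from : (⟨ v ⟩ ++ ⟨ w ⟩) ≼ bd (v ∷ w ∷ [])
  from (here refl) = _ , ∈-bd⁺ {v ∷ w ∷ []} (there (here refl)) , λ { (here refl) → ∈-rm⁺ {A = v ∷ w ∷ []} (here refl) v≢w }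
  from (there (here refl)) = _ , ∈-bd⁺ {v ∷ w ∷ []} (here refl) , λ { (here refl) → ∈-rm⁺ {A = v ∷ w ∷ []} (there (here refl)) (v≢w ∘ sym) }

edge≅ : ∀ {v w} → ⟪ v ∷ w ∷ [] ⟫ ≅ (⟨ v ⟩ ⋆ ⟨ w ⟩)
edge≅ {v} {w} = ≼-≅ (λ { (here refl) → Face-⋆ {X = v ∷ []} (gen (here refl)) (gen (here refl)) }) from
  where
  from : (⟨ v ⟩ ⋆ ⟨ w ⟩) ≼ ⟪ v ∷ w ∷ [] ⟫
  from p with ∈-⟨⟩⋆⁻ p
  ... | _ , here refl , refl = gen (here refl)

subdivideEdge : ∀ {Γ v w L q} → v ≢ w → v # L → w # L → NoFace (v ∷ w ∷ []) Γ →
  q # Γ → q # L → q ≢ v → q ≢ w →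
  Γ ++ (⟨ v ⟩ ⋆ ⟨ w ⟩) ⋆ L ∼ Γ ++ (⟨ q ⟩ ⋆ (⟨ v ⟩ ++ ⟨ w ⟩)) ⋆ L
subdivideEdge {Γ} {v} {w} {L} {q} v≢w v#L w#L nf q#Γ q#L q≢v q≢w = begin
  Γ ++ (⟨ v ⟩ ⋆ ⟨ w ⟩) ⋆ L ≈⟨ ≅⇒∼ (++-mono {Γ} ≅-refl (⋆-mono (≅-sym edge≅) ≅-refl)) ⟩
  Γ ++ ⟪ v ∷ w ∷ [] ⟫ ⋆ L ≈⟨ subdivide (v , here refl) (λ { (here refl) → v#L ; (there (here refl)) → w#L }) nf q#Γ q#L
                              (λ { (here e) → q≢v e ; (there (here e)) → q≢w e }) ⟩
  Γ ++ (⟨ q ⟩ ⋆ bd (v ∷ w ∷ [])) ⋆ L ≈⟨ ≅⇒∼ (++-mono {Γ} ≅-refl (⋆-mono {Γ = L} (⋆-mono {⟨ q ⟩} ≅-refl (bd-edge v≢w)) ≅-refl)) ⟩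
  Γ ++ (⟨ q ⟩ ⋆ (⟨ v ⟩ ++ ⟨ w ⟩)) ⋆ L ∎
  where open ∼-Reasoning

∈⇒≤sum : ∀ {x xs} → x ∈ xs → x ≤ sum xs
∈⇒≤sum {xs = y ∷ ys} (here refl) = m≤m+n y (sum ys)
∈⇒≤sum {xs = y ∷ ys} (there p) = ≤-trans (∈⇒≤sum p) (m≤n+m (sum ys) y)

fresh : ∀ Δ → ∃ λ b → b # Δ
fresh Δ = suc (sum (concat Δ)) , λ F∈ z → <-irrefl refl (∈⇒≤sum (∈-concat⁺′ z F∈))

#-++ˡ : ∀ {b Δ Γ} → b # (Δ ++ Γ) → b # Δ
#-++ˡ p F∈ = p (∈-++⁺ˡ F∈)

#-++ʳ : ∀ Δ {b Γ} → b # (Δ ++ Γ) → b # Γ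
#-++ʳ Δ p F∈ = p (∈-++⁺ʳ Δ F∈)

#⟨⟩⇒≢ : ∀ {b v} → b # ⟨ v ⟩ → b ≢ v
#⟨⟩⇒≢ p refl = p (here refl) (here refl)

NoFace-sym : ∀ {a b Δ} → NoFace (a ∷ b ∷ []) Δ → NoFace (b ∷ a ∷ []) Δ
NoFace-sym n F∈ s = n F∈ λ { (here refl) → s (there (here refl)) ; (there (here refl)) → s (here refl) }

in-ctx : ∀ Γ Δ Δ′ L → Δ ≅ Δ′ → Γ ++ Δ ⋆ L ∼ Γ ++ Δ′ ⋆ L
in-ctx Γ Δ Δ′ L p = ≅⇒∼ (++-mono {Γ} {Γ} {Δ ⋆ L} {Δ′ ⋆ L} ≅-refl (⋆-mono {Δ} {Δ′} {L} {L} p ≅-refl))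

-- Relabelling

ren : (ℕ → ℕ) → Complex → Complex
ren g = map (map g)

-- Restricting to involutions makes the renaming its own inverse, so faces are transported back by
-- the same map.
module Relabel (g : ℕ → ℕ) (inv : ∀ u → g (g u) ≡ u) where

  map-inv : ∀ X → map g (map g X) ≡ X
  map-inv X = trans (sym (map-∘ X)) (trans (map-cong inv X) (map-id X))

  ren-inv : ∀ Δ → ren g (ren g Δ) ≡ Δ
  ren-inv Δ = trans (sym (map-∘ Δ)) (trans (map-cong map-inv Δ) (map-id Δ))

  Face-ren : ∀ {Δ X} → Face Δ X → Face (ren g Δ) (map g X)
  Face-ren (F , F∈ , s) = map g F , ∈-map⁺ (map g) F∈ , Sub.map⁺ g s

  Face-ren⁻ : ∀ {Δ X} → Face (ren g Δ) X → Face Δ (map g X)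
  Face-ren⁻ {Δ} {X} f = subst (λ Δ → Face Δ (map g X)) (ren-inv Δ) (Face-ren f)

  #-ren : ∀ {u Δ} → g u # Δ → u # ren g Δ
  #-ren n F∈ z with ∈-map⁻ (map g) F∈
  ... | F , F∈′ , refl with ∈-map⁻ g z
  ... | z , z∈ , refl = n F∈′ (subst (_∈ F) (sym (inv z)) z∈)

  ⊆-map⇒ : ∀ {X Y} → X ⊆ map g Y → map g X ⊆ Y
  ⊆-map⇒ {Y = Y} s z with ∈-map⁻ g z
  ... | x , x∈ , refl with ∈-map⁻ g (s x∈)
  ... | y , y∈ , refl = subst (_∈ Y) (sym (inv y)) y∈

  ⊆-map⇐ : ∀ {X Y} → map g X ⊆ Y → X ⊆ map g Y
  ⊆-map⇐ {X} {Y} s = subst (_⊆ map g Y) (map-inv X) (⊆-map⇒ (subst (map g X ⊆_) (sym (map-inv Y)) s))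

  NoFace-ren : ∀ {a b Δ} → NoFace (g a ∷ g b ∷ []) Δ → NoFace (a ∷ b ∷ []) (ren g Δ)
  NoFace-ren n F∈ s with ∈-map⁻ (map g) F∈
  ... | F , F∈′ , refl = n F∈′ (⊆-map⇒ s)

  stellar-ren : ∀ {Δ Δ′} → StellarSubdivision Δ Δ′ → StellarSubdivision (ren g Δ) (ren g Δ′)
  stellar-ren {Δ} {Δ′} (A , a , A∈ , (z , z∈) , a∉ , eq) =
    map g A , g a , Face-ren A∈ , (g z , ∈-map⁺ g z∈) , (λ p → a∉ (subst (λ b → Face Δ (b ∷ [])) (inv a) (Face-ren⁻ p))) ,
    λ X → (λ f → to X (proj₁ (eq (map g X)) (Face-ren⁻ f))) ,
          (λ c → subst (Face (ren g Δ′)) (map-inv X) (Face-ren (proj₂ (eq (map g X)) (from X c))))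
    where
    to : ∀ X → (Face Δ (map g X) × ¬ (A ⊆ map g X)) ⊎
       (Σ (List ℕ) λ Y → (map g X ≈ˢ (a ∷ Y)) × Face Δ (Y ++ A) × ¬ (A ⊆ Y)) →
       (Face (ren g Δ) X × ¬ (map g A ⊆ X)) ⊎
       (Σ (List ℕ) λ Y → (X ≈ˢ (g a ∷ Y)) × Face (ren g Δ) (Y ++ map g A) × ¬ (map g A ⊆ Y))
    to X (inj₁ (f , n)) = inj₁ (subst (Face (ren g Δ)) (map-inv X) (Face-ren f) , n ∘ ⊆-map⇐)
    to X (inj₂ (Y , (p , q) , f , n)) = inj₂ (map g Y , (⊆-map⇐ {X} {a ∷ Y} p , ⊆-map⇒ {a ∷ Y} q) ,
      subst (Face (ren g Δ)) (map-++ g Y A) (Face-ren f) ,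
      λ s → n (subst (A ⊆_) (map-inv Y) (⊆-map⇐ s)))
    from : ∀ X → (Face (ren g Δ) X × ¬ (map g A ⊆ X)) ⊎
       (Σ (List ℕ) λ Y → (X ≈ˢ (g a ∷ Y)) × Face (ren g Δ) (Y ++ map g A) × ¬ (map g A ⊆ Y)) →
       (Face Δ (map g X) × ¬ (A ⊆ map g X)) ⊎
       (Σ (List ℕ) λ Y → (map g X ≈ˢ (a ∷ Y)) × Face Δ (Y ++ A) × ¬ (A ⊆ Y))
    from X (inj₁ (f , n)) = inj₁ (Face-ren⁻ f , n ∘ ⊆-map⇒)
    from X (inj₂ (Y , (p , q) , f , n)) = inj₂ (map g Y ,
      (subst (λ b → map g X ⊆ b ∷ map g Y) (inv a) (Sub.map⁺ g p) ,
       subst (λ b → b ∷ map g Y ⊆ map g X) (inv a) (Sub.map⁺ g q)) ,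
      subst (Face Δ) (trans (map-++ g Y (map g A)) (cong (map g Y ++_) (map-inv A))) (Face-ren⁻ f) ,
      λ s → n (⊆-map⇒ s))

  ≅-ren : ∀ {Δ Γ} → Δ ≅ Γ → ren g Δ ≅ ren g Γ
  ≅-ren {Δ} {Γ} p X = (λ f → go (proj₁ (p (map g X)) (Face-ren⁻ f))) , λ f → go (proj₂ (p (map g X)) (Face-ren⁻ f))
    where
    go : ∀ {Δ} → Face Δ (map g X) → Face (ren g Δ) X
    go {Δ} f = subst (Face (ren g Δ)) (map-inv X) (Face-ren f)

  ∼-ren : ∀ {Δ Γ} → Δ ∼ Γ → ren g Δ ∼ ren g Γ
  ∼-ren = Eq.gmap (ren g) λ { (inj₁ p) → inj₁ (≅-ren p) ; (inj₂ s) → inj₂ (stellar-ren s) }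

-- Splitting and coning off balls

-- In these definitions S plays the role of the boundary of the ball B, while V
-- and I contain its vertices and its interior vertices, respectively. Splitting
-- leaves the base B of the cone w * B in place, so that Γ may contain B.

Split : (B S : Complex) (V I : ℕ → Set) → Set
Split B S V I = ∀ {Γ L w q} → q # Γ → q # L → w # L → q ≢ w →
  (∀ {u} → V u → u ≢ w × u ≢ q × u # L) → (∀ {u} → I u → NoFace (w ∷ u ∷ []) Γ) →
  Γ ++ (⟨ w ⟩ ⋆ B) ⋆ L ∼ Γ ++ (⟨ q ⟩ ⋆ (⟨ w ⟩ ⋆ S ++ B)) ⋆ L

ConesOff : (B S : Complex) (c : ℕ) (V I : ℕ → Set) → Set
ConesOff B S c V I = ∀ {Γ L} → (∀ {u} → I u → u # Γ) → (∀ {u} → V u → u # L) →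
  Γ ++ B ⋆ L ∼ Γ ++ (⟨ c ⟩ ⋆ S) ⋆ L

module _ (g : ℕ → ℕ) (inv : ∀ u → g (g u) ≡ u) where
  open Relabel g inv

  -- The given splitting is applied in the context renamed by `g`, and the result is renamed once
  -- more, which returns the context to `Γ` and `L`.
  Split-ren : ∀ {B S V I} → Split B S V I → Split (ren g B) (ren g S) (V ∘ g) (I ∘ g)
  Split-ren {B} {S} {V} {I} split {Γ} {L} {w} {q} q#Γ q#L w#L q≢w v i =
    subst₂ _∼_ lhs rhs (∼-ren (split {ren g Γ} {ren g L} {g w} {g q}
      (shift q#Γ) (shift q#L) (shift w#L) (λ e → q≢w (g-inj e))
      (λ {u} p → let (a , b , c) = v {g u} (subst V (sym (inv u)) p) in
        (λ e → a (trans (cong g e) (inv w))) , (λ e → b (trans (cong g e) (inv q))) , #-ren c)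
      (λ {u} p → NoFace-ren (subst (λ z → NoFace (z ∷ g u ∷ []) Γ) (sym (inv w)) (i (subst I (sym (inv u)) p))))))
    where
    g-inj : ∀ {a b} → g a ≡ g b → a ≡ b
    g-inj {a} {b} e = trans (sym (inv a)) (trans (cong g e) (inv b))
    shift : ∀ {a Δ} → a # Δ → g a # ren g Δ
    shift {a} {Δ} p = #-ren (subst (_# Δ) (sym (inv a)) p)
    ctx : ∀ Δ Δ′ → ren g Δ ≡ Δ′ → ren g (ren g Γ ++ Δ ⋆ ren g L) ≡ Γ ++ Δ′ ⋆ L
    ctx Δ Δ′ e = trans (map-++ (map g) (ren g Γ) _) (cong₂ _++_ (ren-inv Γ)
      (trans (map-map-⋆ g Δ _) (cong₂ _⋆_ e (ren-inv L))))
    cone : ∀ a Δ → ren g (⟨ g a ⟩ ⋆ Δ) ≡ ⟨ a ⟩ ⋆ ren g Δ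
    cone a Δ = trans (map-map-⋆ g _ Δ) (cong (λ b → ⟨ b ⟩ ⋆ ren g Δ) (inv a))
    lhs = ctx (⟨ g w ⟩ ⋆ B) (⟨ w ⟩ ⋆ ren g B) (cone w B)
    rhs = ctx (⟨ g q ⟩ ⋆ (⟨ g w ⟩ ⋆ S ++ B)) (⟨ q ⟩ ⋆ (⟨ w ⟩ ⋆ ren g S ++ ren g B))
      (trans (cone q _) (cong (⟨ q ⟩ ⋆_) (trans (map-++ (map g) (⟨ g w ⟩ ⋆ S) B) (cong (_++ ren g B) (cone w S)))))

  ConesOff-ren : ∀ {B S c V I} → ConesOff B S c V I → ConesOff (ren g B) (ren g S) (g c) (V ∘ g) (I ∘ g)
  ConesOff-ren {B} {S} {c} {V} {I} off {Γ} {L} i v =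
    subst₂ _∼_ (ctx B (ren g B) refl) (ctx (⟨ c ⟩ ⋆ S) (⟨ g c ⟩ ⋆ ren g S) (map-map-⋆ g _ S))
      (∼-ren (off {ren g Γ} {ren g L}
        (λ {u} p → #-ren (i (subst I (sym (inv u)) p))) (λ {u} p → #-ren (v (subst V (sym (inv u)) p)))))
    where
    ctx : ∀ Δ Δ′ → ren g Δ ≡ Δ′ → ren g (ren g Γ ++ Δ ⋆ ren g L) ≡ Γ ++ Δ′ ⋆ L
    ctx Δ Δ′ e = trans (map-++ (map g) (ren g Γ) _) (cong₂ _++_ (ren-inv Γ)
      (trans (map-map-⋆ g Δ _) (cong₂ _⋆_ e (ren-inv L))))

-- Transpositions of labels

swap : ℕ → ℕ → ℕ → ℕ
swap h x u with u ≟ h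
... | yes _ = x
... | no _ with u ≟ x
... | yes _ = h
... | no _ = u

swap-h : ∀ h x → swap h x h ≡ x
swap-h h x with h ≟ h
... | yes _ = refl
... | no n = ⊥-elim (n refl)

swap-x : ∀ h x → swap h x x ≡ h
swap-x h x with x ≟ h
... | yes e = e
... | no n with x ≟ x
... | yes _ = refl
... | no k = ⊥-elim (k refl)

swap-other : ∀ {h x u} → u ≢ h → u ≢ x → swap h x u ≡ u
swap-other {h} {x} {u} a b with u ≟ h
... | yes e = ⊥-elim (a e)
... | no _ with u ≟ x
... | yes e = ⊥-elim (b e)
... | no _ = refl

swap-inv : ∀ h x u → swap h x (swap h x u) ≡ u
swap-inv h x u with u ≟ h
... | yes refl = swap-x h x
... | no a with u ≟ x
... | yes refl = swap-h h x
... | no b = swap-other a b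

-- Vertex labels

-- The i-th antipodal pair consists of the positive vertex e i and the negative vertex o i.
e o half σ : ℕ → ℕ
e zero = zero
e (suc i) = suc (suc (e i))
o i = suc (e i)
half zero = zero
half (suc zero) = zero
half (suc (suc u)) = suc (half u)
σ zero = suc zero
σ (suc zero) = zero
σ (suc (suc u)) = suc (suc (σ u))

half-e : ∀ i → half (e i) ≡ i
half-e zero = refl
half-e (suc i) = cong suc (half-e i)

half-o : ∀ i → half (o i) ≡ i
half-o zero = refl
half-o (suc i) = cong suc (half-o i)

σ-e : ∀ i → σ (e i) ≡ o i
σ-e zero = refl
σ-e (suc i) = cong (λ u → suc (suc u)) (σ-e i)

σ-o : ∀ i → σ (o i) ≡ e i
σ-o zero = refl
σ-o (suc i) = cong (λ u → suc (suc u)) (σ-o i)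

σ-inv : ∀ u → σ (σ u) ≡ u
σ-inv zero = refl
σ-inv (suc zero) = refl
σ-inv (suc (suc u)) = cong (λ u → suc (suc u)) (σ-inv u)

half-σ : ∀ u → half (σ u) ≡ half u
half-σ zero = refl
half-σ (suc zero) = refl
half-σ (suc (suc u)) = cong suc (half-σ u)

view : ∀ u → u ≡ e (half u) ⊎ u ≡ o (half u)
view zero = inj₁ refl
view (suc zero) = inj₂ refl
view (suc (suc u)) = [ inj₁ ∘ cong (λ u → suc (suc u)) , inj₂ ∘ cong (λ u → suc (suc u)) ]′ (view u)

e-inj : ∀ {i j} → e i ≡ e j → i ≡ j
e-inj {i} {j} p = trans (sym (half-e i)) (trans (cong half p) (half-e j))

o-inj : ∀ {i j} → o i ≡ o j → i ≡ j
o-inj {i} {j} p = trans (sym (half-o i)) (trans (cong half p) (half-o j))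

o≢e : ∀ {i j} → o i ≢ e j
o≢e {zero} {suc j} ()
o≢e {suc i} {suc j} p = o≢e (suc-injective (suc-injective p))

-- Stars, links and deletions of vertices

star : ℕ → Complex → Complex
star a S = filter (a ∈?_) S

deletion : ℕ → Complex → Complex
deletion a S = filter (λ F → ¬? (a ∈? F)) S

link : ℕ → Complex → Complex
link a S = map (rm a) (star a S)

∈-star⁻ : ∀ {a S F} → F ∈ star a S → F ∈ S × a ∈ F
∈-star⁻ {a} {S} = ∈-filter⁻ (a ∈?_) {xs = S}

∈-deletion⁻ : ∀ {a S F} → F ∈ deletion a S → F ∈ S × a ∉ F
∈-deletion⁻ {a} {S} = ∈-filter⁻ (λ F → ¬? (a ∈? F)) {xs = S}

∈-link⁻ : ∀ {a S F} → F ∈ link a S → ∃ λ G → G ∈ S × a ∈ G × F ≡ rm a G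
∈-link⁻ {a} {S} p with ∈-map⁻ (rm a) p
... | G , G∈ , e = G , proj₁ (∈-star⁻ G∈) , proj₂ (∈-star⁻ {a} {S} G∈) , e

#-star : ∀ {a b S} → b # S → b # star a S
#-star {a} {S = S} p F∈ = p (proj₁ (∈-star⁻ {a} {S} F∈))

#-deletion : ∀ {a b S} → b # S → b # deletion a S
#-deletion {a} {S = S} p F∈ = p (proj₁ (∈-deletion⁻ {a} {S} F∈))

#-deletion-self : ∀ {a} S → a # deletion a S
#-deletion-self {a} S F∈ = proj₂ (∈-deletion⁻ {a} {S} F∈)

#-link : ∀ {a b S} → b # S → b # link a S
#-link {a} {S = S} p F∈ z with ∈-link⁻ {a} {S} F∈
... | G , G∈ , _ , refl = p G∈ (proj₁ (∈-rm⁻ {A = G} z))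

#-link-self : ∀ {a} S → a # link a S
#-link-self {a} S F∈ z with ∈-link⁻ {a} {S} F∈
... | G , G∈ , _ , refl = proj₂ (∈-rm⁻ {A = G} z) refl

∷-rm : ∀ {a} F → F ⊆ a ∷ rm a F
∷-rm {a} F {z} z∈ with z ≟ a
... | yes refl = here refl
... | no n = there (∈-rm⁺ z∈ n)

star≅ : ∀ a S → star a S ≅ (⟨ a ⟩ ⋆ link a S)
star≅ a S = ≼-≅ (λ {F} F∈ → _ , ∈-⟨⟩⋆⁺ (∈-map⁺ (rm a) F∈) , ∷-rm F) from
  where
  from : (⟨ a ⟩ ⋆ link a S) ≼ star a S
  from p with ∈-⟨⟩⋆⁻ p
  ... | _ , q , refl with ∈-map⁻ (rm a) q
  ... | G , G∈ , refl = G , G∈ , λ { (here refl) → proj₂ (∈-star⁻ {a} {S} G∈) ; (there z) → proj₁ (∈-rm⁻ {A = G} z) }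

decompose : ∀ a S → S ≅ (deletion a S ++ ⟨ a ⟩ ⋆ link a S)
decompose a S = ≅-trans {S} {deletion a S ++ star a S} (≼-≅ to from)
  (++-mono {deletion a S} {_} {star a S} ≅-refl (star≅ a S))
  where
  to : S ≼ (deletion a S ++ star a S)
  to {F} F∈ with a ∈? F
  ... | yes a∈ = F , ∈-++⁺ʳ (deletion a S) (∈-filter⁺ (a ∈?_) F∈ a∈) , id
  ... | no a∉ = F , ∈-++⁺ˡ (∈-filter⁺ (λ F → ¬? (a ∈? F)) F∈ a∉) , id
  from : (deletion a S ++ star a S) ≼ S
  from {F} p = F , [ (λ q → proj₁ (∈-deletion⁻ {a} {S} q)) , (λ q → proj₁ (∈-star⁻ {a} {S} q)) ]′ (∈-++⁻ (deletion a S) p) , id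

decompose-swap : ∀ a b S → b # S → ren (swap a b) S ≅ (deletion a S ++ ⟨ b ⟩ ⋆ link a S)
decompose-swap a b S b# = ≼-≅ to from
  where
  other : ∀ {z F} → F ∈ S → z ∈ F → z ≢ a → swap a b z ≡ z
  other F∈ z∈ n = swap-other n λ { refl → b# F∈ z∈ }
  to : ren (swap a b) S ≼ (deletion a S ++ ⟨ b ⟩ ⋆ link a S)
  to p with ∈-map⁻ (map (swap a b)) p
  ... | F , F∈ , refl with a ∈? F
  ... | no n = F , ∈-++⁺ˡ (∈-filter⁺ (λ F → ¬? (a ∈? F)) F∈ n) , sub
    where
    sub : map (swap a b) F ⊆ F
    sub z with ∈-map⁻ (swap a b) z
    ... | u , u∈ , refl = subst (_∈ F) (sym (other F∈ u∈ λ { refl → n u∈ })) u∈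
  ... | yes y = _ , ∈-++⁺ʳ (deletion a S) (∈-⟨⟩⋆⁺ (∈-map⁺ (rm a) (∈-filter⁺ (a ∈?_) F∈ y))) , sub
    where
    sub : map (swap a b) F ⊆ b ∷ rm a F
    sub z with ∈-map⁻ (swap a b) z
    ... | u , u∈ , refl with u ≟ a
    ... | yes refl = here refl
    ... | no n with u ≟ b
    ... | yes refl = ⊥-elim (b# F∈ u∈)
    ... | no k = there (∈-rm⁺ u∈ n)
  from : (deletion a S ++ ⟨ b ⟩ ⋆ link a S) ≼ ren (swap a b) S
  from {F} p with ∈-++⁻ (deletion a S) p
  ... | inj₁ q = let (F∈ , n) = ∈-deletion⁻ {a} {S} q in
    map (swap a b) F , ∈-map⁺ (map (swap a b)) F∈ ,
    λ z → subst (_∈ map (swap a b) F) (other F∈ z λ { refl → n z }) (∈-map⁺ (swap a b) z)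
  ... | inj₂ q with ∈-⟨⟩⋆⁻ q
  ... | _ , r , refl with ∈-link⁻ {a} {S} r
  ... | G , G∈ , h∈ , refl = map (swap a b) G , ∈-map⁺ (map (swap a b)) G∈ , sub
    where
    sub : b ∷ rm a G ⊆ map (swap a b) G
    sub (here refl) = subst (_∈ map (swap a b) G) (swap-h a b) (∈-map⁺ (swap a b) h∈)
    sub (there z) = let (z∈ , n) = ∈-rm⁻ {A = G} z in
      subst (_∈ map (swap a b) G) (other G∈ z∈ n) (∈-map⁺ (swap a b) z∈)

-- The collar between a sphere and its relabelled copy

module Collar (m : ℕ) where

  -- The offset 2 leaves the labels `e m` and `e (suc m)` free for the two apices.
  x : ℕ → ℕ
  x j = e (suc (suc (m + j)))

  x-inj : ∀ {i j} → x i ≡ x j → i ≡ j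
  x-inj p = +-cancelˡ-≡ m _ _ (suc-injective (suc-injective (e-inj p)))

  sw : ℕ → ℕ → ℕ
  sw i = swap (o i) (x i)

  -- Written as a composite of transpositions, so that results on involutions apply factor by factor
  -- and the order of replacement matches the recursion of `collar`.
  ρ : ℕ → ℕ → ℕ
  ρ zero u = u
  ρ (suc i) u = ρ i (sw i u)

  ρ⁻¹ : ℕ → ℕ → ℕ
  ρ⁻¹ zero u = u
  ρ⁻¹ (suc i) u = sw i (ρ⁻¹ i u)

  ρρ⁻¹ : ∀ i u → ρ i (ρ⁻¹ i u) ≡ u
  ρρ⁻¹ zero u = refl
  ρρ⁻¹ (suc i) u = trans (cong (ρ i) (swap-inv (o i) (x i) (ρ⁻¹ i u))) (ρρ⁻¹ i u)

  ρ⁻¹ρ : ∀ i u → ρ⁻¹ i (ρ i u) ≡ u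
  ρ⁻¹ρ zero u = refl
  ρ⁻¹ρ (suc i) u = trans (cong (sw i) (ρ⁻¹ρ i (sw i u))) (swap-inv (o i) (x i) u)

  ρ-other : ∀ i {u} → (∀ {j} → j < i → u ≢ o j × u ≢ x j) → ρ i u ≡ u
  ρ-other zero n = refl
  ρ-other (suc i) {u} n = trans (cong (ρ i) (swap-other (proj₁ (n ≤-refl)) (proj₂ (n ≤-refl))))
                                (ρ-other i (λ l → n (m≤n⇒m≤1+n l)))

  ρ-h : ∀ i {j} → j < i → ρ i (o j) ≡ x j
  ρ-h (suc i) {j} (s≤s j≤i) with m≤n⇒m<n∨m≡n j≤i
  ... | inj₂ refl = trans (cong (ρ i) (swap-h (o i) (x i)))
    (ρ-other i λ l → (λ e → o≢e (sym e)) , λ e → <⇒≢ l (sym (x-inj e)))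
  ... | inj₁ j<i = trans (cong (ρ i) (swap-other (λ e → <⇒≢ j<i (o-inj e)) o≢e)) (ρ-h i j<i)

  ren-ρ-suc : ∀ i Δ → ren (ρ (suc i)) Δ ≡ ren (ρ i) (ren (sw i) Δ)
  ren-ρ-suc i Δ = trans (map-cong map-∘ Δ) (map-∘ Δ)

  ren-ρ-zero : ∀ Δ → ren (ρ zero) Δ ≡ Δ
  ren-ρ-zero Δ = trans (map-cong map-id Δ) (map-id Δ)

  ∼-ren-ρ : ∀ i {Δ Γ} → Δ ∼ Γ → ren (ρ i) Δ ∼ ren (ρ i) Γ
  ∼-ren-ρ zero {Δ} {Γ} p = subst₂ _∼_ (sym (ren-ρ-zero Δ)) (sym (ren-ρ-zero Γ)) p
  ∼-ren-ρ (suc i) {Δ} {Γ} p = subst₂ _∼_ (sym (ren-ρ-suc i Δ)) (sym (ren-ρ-suc i Γ))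
    (∼-ren-ρ i (Relabel.∼-ren (sw i) (swap-inv (o i) (x i)) p))

  Split-ren-ρ : ∀ i {B S V I} → Split B S V I →
    Split (ren (ρ i) B) (ren (ρ i) S) (V ∘ ρ⁻¹ i) (I ∘ ρ⁻¹ i)
  Split-ren-ρ zero {B} {S} {V} {I} p =
    subst₂ (λ B S → Split B S V I) (sym (ren-ρ-zero B)) (sym (ren-ρ-zero S)) p
  Split-ren-ρ (suc i) {B} {S} {V} {I} p =
    subst₂ (λ B S → Split B S (V ∘ ρ⁻¹ (suc i)) (I ∘ ρ⁻¹ (suc i))) (sym (ren-ρ-suc i B)) (sym (ren-ρ-suc i S))
      (Split-ren-ρ i (Split-ren (sw i) (swap-inv (o i) (x i)) p))

  -- The simplices x i₁ … x iᵣ o iᵣ … o iₛ of the prism over S, with i₁ > i₂ > ⋯ and joined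
  -- with the vertices of S that are not replaced.
  collar : Complex → ℕ → Complex
  collar S zero = []
  collar S (suc i) = ⟨ x i ⟩ ⋆ star (o i) S ++ collar (ren (sw i) S) i

  Fresh : ℕ → Complex → Set
  Fresh i S = ∀ {j} → j < i → x j # S

  #-sw : ∀ {i S u} → Fresh (suc i) S → u # S → u ≢ x i → u # ren (sw i) S
  #-sw {i} {S} {u} fr u# u≢x = Relabel.#-ren (sw i) (swap-inv (o i) (x i)) lemma
    where
    lemma : sw i u # S
    lemma with u ≟ o i
    ... | yes _ = fr ≤-refl
    ... | no n with u ≟ x i
    ... | yes e = ⊥-elim (u≢x e)
    ... | no _ = u#

  h#-sw : ∀ {i S} → Fresh (suc i) S → o i # ren (sw i) S
  h#-sw {i} {S} fr = Relabel.#-ren (sw i) (swap-inv (o i) (x i)) (subst (_# S) (sym (swap-h (o i) (x i))) (fr ≤-refl))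

  Fresh-sw : ∀ {i S} → Fresh (suc i) S → Fresh i (ren (sw i) S)
  Fresh-sw fr l = #-sw fr (fr (m≤n⇒m≤1+n l)) (λ e → <⇒≢ l (x-inj e))

  #-collar : ∀ i {S u} → Fresh i S → u # S → (∀ {j} → j < i → u ≢ x j) → u # collar S i
  #-collar (suc i) {S} fr u# n = (≢# (n ≤-refl) ⊗ #-star u#) ⊕
    #-collar i (Fresh-sw fr) (#-sw fr u# (n ≤-refl)) (λ l → n (m≤n⇒m≤1+n l))

  module _ {v : ℕ} {L : Complex} (v#L : v # L) where

    -- Each layer of the collar undoes one edge subdivision. With K the link of `o i`, subdividing
    -- the edge from `v` to `o i` by `x i` turns v * o i * K into x i * (o i + v) * K. The first
    -- summand is the layer at `x i`, the second belongs to the cone over the relabelled sphere.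
    coneOff-collar : ∀ i S {Γ} → Fresh i S →
      (∀ {j} → j < i → v ≢ x j × v ≢ o j × x j # L × o j # L × x j # Γ × NoFace (v ∷ o j ∷ []) Γ) → v # S →
      Γ ++ (collar S i ++ ⟨ v ⟩ ⋆ ren (ρ i) S) ⋆ L ∼ Γ ++ (⟨ v ⟩ ⋆ S) ⋆ L
    coneOff-collar zero S {Γ} fr c v#S rewrite ren-ρ-zero S = ε
    coneOff-collar (suc i) S {Γ} fr c v#S with c ≤-refl
    ... | v≢x , v≢h , x#L , h#L , x#Γ , nf rewrite ren-ρ-suc i S =
      ≅⇒∼ (solve 6 (λ Γ x st C vT L → Γ :+ ((x :* st :+ C) :+ vT) :* L := (Γ :+ (x :* st) :* L) :+ (C :+ vT) :* L)
        (λ _ → id , id) Γ ⟨ x i ⟩ st (collar T i) (⟨ v ⟩ ⋆ ren (ρ i) T) L)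
      -- The layer at `x i` waits in the context while the remaining layers collapse onto v * T.
      ◅◅ coneOff-collar i T {Γ ++ (⟨ x i ⟩ ⋆ st) ⋆ L} (Fresh-sw fr) c′ (#-sw fr v#S v≢x)
      ◅◅ in-ctx (Γ ++ (⟨ x i ⟩ ⋆ st) ⋆ L) (⟨ v ⟩ ⋆ T) (⟨ v ⟩ ⋆ (D ++ ⟨ x i ⟩ ⋆ K)) L
           (⋆-mono {⟨ v ⟩} {⟨ v ⟩} {T} ≅-refl (decompose-swap (o i) (x i) S (fr ≤-refl)))
      ◅◅ ≅⇒∼ (solve 7 (λ Γ x st v D K L → (Γ :+ (x :* st) :* L) :+ (v :* (D :+ x :* K)) :* L :=
                 (Γ :+ ((v :* D) :* L :+ (v :* (x :* K)) :* L)) :+ st :* (x :* L))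
           (λ _ → id , id) Γ ⟨ x i ⟩ st ⟨ v ⟩ D K L)
      ◅◅ in-ctx (Γ ++ ((⟨ v ⟩ ⋆ D) ⋆ L ++ (⟨ v ⟩ ⋆ (⟨ x i ⟩ ⋆ K)) ⋆ L)) st (⟨ o i ⟩ ⋆ K) (⟨ x i ⟩ ⋆ L) (star≅ (o i) S)
      ◅◅ ≅⇒∼ (solve 7 (λ Γ v D L x K h → (Γ :+ ((v :* D) :* L :+ (v :* (x :* K)) :* L)) :+ (h :* K) :* (x :* L) :=
                 (Γ :+ (v :* D) :* L) :+ (x :* (h :+ v)) :* (K :* L))
           (λ _ → id , id) Γ ⟨ v ⟩ D L ⟨ x i ⟩ K ⟨ o i ⟩)
      ◅◅ ∼-sym (subdivideEdge {Γ ++ (⟨ v ⟩ ⋆ D) ⋆ L} {o i} {v} {K ⋆ L} {x i} (v≢h ∘ sym) (#-link-self S ⊗ h#L) (#-link v#S ⊗ v#L)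
           (NoFace-sym nf ⊞ #⇒NoFaceˡ ((≢# (v≢h ∘ sym) ⊗ #-deletion-self S) ⊗ h#L))
           (x#Γ ⊕ (≢# (v≢x ∘ sym) ⊗ #-deletion (fr ≤-refl)) ⊗ x#L) (#-link (fr ≤-refl) ⊗ x#L) (o≢e ∘ sym) (v≢x ∘ sym))
      ◅◅ ≅⇒∼ (solve 6 (λ Γ v D L K h → (Γ :+ (v :* D) :* L) :+ (h :* v) :* (K :* L) := Γ :+ (D :+ h :* K) :* (v :* L))
           (λ _ → id , id) Γ ⟨ v ⟩ D L K ⟨ o i ⟩)
      ◅◅ in-ctx Γ (D ++ ⟨ o i ⟩ ⋆ K) S (⟨ v ⟩ ⋆ L) (≅-sym {S} (decompose (o i) S))
      ◅◅ ≅⇒∼ (solve 4 (λ Γ v S L → Γ :+ S :* (v :* L) := Γ :+ (v :* S) :* L) (λ _ → id , id) Γ ⟨ v ⟩ S L)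
      where
      T = ren (sw i) S
      st = star (o i) S
      D = deletion (o i) S
      K = link (o i) S
      c′ : ∀ {j} → j < i → v ≢ x j × v ≢ o j × x j # L × o j # L × x j # (Γ ++ (⟨ x i ⟩ ⋆ st) ⋆ L) ×
           NoFace (v ∷ o j ∷ []) (Γ ++ (⟨ x i ⟩ ⋆ st) ⋆ L)
      c′ l with c (m≤n⇒m≤1+n l)
      ... | a , b , x#L , d , x#Γ , nf = a , b , x#L , d ,
        (x#Γ ⊕ (≢# (λ e → <⇒≢ l (x-inj e)) ⊗ #-star (fr (m≤n⇒m≤1+n l))) ⊗ x#L) ,
        (nf ⊞ #⇒NoFaceˡ ((≢# v≢x ⊗ #-star v#S) ⊗ v#L))

  module _ {w q : ℕ} {L : Complex} (w#L : w # L) (q#L : q # L) (w≢q : w ≢ q) where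

    -- Every layer is treated by a bistellar flip. With x = `x i`, h = `o i` and K the link of h,
    -- the complex (w x) * ∂(h q) * K is exchanged for ∂(w x) * (h q) * K. The edge w x leaves and
    -- the edge h q enters, which is why `Γ` may contain neither.
    split-collar : ∀ i S {Γ} → Fresh i S →
      (∀ {j} → j < i → w ≢ x j × w ≢ o j × q ≢ x j × q ≢ o j × x j # L × o j # L ×
                       NoFace (w ∷ x j ∷ []) Γ × NoFace (q ∷ o j ∷ []) Γ) → w # S → q # S →
      Γ ++ (⟨ w ⟩ ⋆ (collar S i ++ ⟨ q ⟩ ⋆ ren (ρ i) S)) ⋆ L ∼ Γ ++ (⟨ w ⟩ ⋆ ⟨ q ⟩ ⋆ S ++ ⟨ q ⟩ ⋆ collar S i) ⋆ L
    split-collar zero S {Γ} fr c w#S q#S rewrite ren-ρ-zero S =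
      ≅⇒∼ (solve 5 (λ Γ w q S L → Γ :+ (w :* (q :* S)) :* L := Γ :+ (w :* (q :* S) :+ q :* con 0) :* L)
        (λ _ → id , id) Γ ⟨ w ⟩ ⟨ q ⟩ S L)
    split-collar (suc i) S {Γ} fr c w#S q#S with c ≤-refl
    ... | w≢x , w≢h , q≢x , q≢h , x#L , h#L , nw , nq rewrite ren-ρ-suc i S =
      ≅⇒∼ (solve 7 (λ Γ w x st C qT L → Γ :+ (w :* ((x :* st :+ C) :+ qT)) :* L :=
                (Γ :+ (w :* (x :* st)) :* L) :+ (w :* (C :+ qT)) :* L)
        (λ _ → id , id) Γ ⟨ w ⟩ ⟨ x i ⟩ st C (⟨ q ⟩ ⋆ ren (ρ i) T) L)
      ◅◅ split-collar i T {Γ ++ (⟨ w ⟩ ⋆ (⟨ x i ⟩ ⋆ st)) ⋆ L} (Fresh-sw fr) c′ (#-sw fr w#S w≢x) (#-sw fr q#S q≢x)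
      ◅◅ in-ctx (Γ ++ (⟨ w ⟩ ⋆ (⟨ x i ⟩ ⋆ st)) ⋆ L) (⟨ w ⟩ ⋆ ⟨ q ⟩ ⋆ T ++ ⟨ q ⟩ ⋆ C) (⟨ w ⟩ ⋆ ⟨ q ⟩ ⋆ (D ++ ⟨ x i ⟩ ⋆ K) ++ ⟨ q ⟩ ⋆ C) L
           (++-mono {⟨ w ⟩ ⋆ ⟨ q ⟩ ⋆ T} {_} {⟨ q ⟩ ⋆ C} (⋆-mono {⟨ w ⟩} {⟨ w ⟩} {⟨ q ⟩ ⋆ T} ≅-refl
             (⋆-mono {⟨ q ⟩} {⟨ q ⟩} {T} ≅-refl (decompose-swap (o i) (x i) S (fr ≤-refl)))) ≅-refl)
      ◅◅ ≅⇒∼ (solve 9 (λ Γ w x st q D K C L →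
                 (Γ :+ (w :* (x :* st)) :* L) :+ (w :* (q :* (D :+ x :* K)) :+ q :* C) :* L :=
                 ((Γ :+ (w :* (q :* D)) :* L :+ (q :* C) :* L) :+ (w :* (x :* (q :* K))) :* L) :+ st :* (w :* (x :* L)))
           (λ _ → id , id) Γ ⟨ w ⟩ ⟨ x i ⟩ st ⟨ q ⟩ D K C L)
      ◅◅ in-ctx ((Γ ++ (⟨ w ⟩ ⋆ ⟨ q ⟩ ⋆ D) ⋆ L ++ (⟨ q ⟩ ⋆ C) ⋆ L) ++ (⟨ w ⟩ ⋆ ⟨ x i ⟩ ⋆ ⟨ q ⟩ ⋆ K) ⋆ L)
           st (⟨ o i ⟩ ⋆ K) (⟨ w ⟩ ⋆ ⟨ x i ⟩ ⋆ L) (star≅ (o i) S)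
      ◅◅ ≅⇒∼ (solve 7 (λ Θ w x h q K L →
                 (Θ :+ (w :* (x :* (q :* K))) :* L) :+ (h :* K) :* (w :* (x :* L)) :=
                 Θ :+ (w :* x) :* ((h :+ q) :* (K :* L)))
           (λ _ → id , id) Θ ⟨ w ⟩ ⟨ x i ⟩ ⟨ o i ⟩ ⟨ q ⟩ K L)
      -- The flip passes through the common subdivision b * ∂(w x) * ∂(h q) * K: subdivide w x by an
      -- auxiliary vertex `b`, then undo the subdivision of h q by the same `b`.
      ◅◅ subdivideEdge {Θ} {w} {x i} {(⟨ o i ⟩ ++ ⟨ q ⟩) ⋆ (K ⋆ L)} {b} w≢x
           ((≢# w≢h ⊕ ≢# w≢q) ⊗ #-link w#S ⊗ w#L) ((≢# (o≢e ∘ sym) ⊕ ≢# (q≢x ∘ sym)) ⊗ #-link (fr ≤-refl) ⊗ x#L)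
           (nw ⊞ #⇒NoFaceʳ ((≢# (w≢x ∘ sym) ⊗ ≢# (q≢x ∘ sym) ⊗ #-deletion (fr ≤-refl)) ⊗ x#L) ⊞
             #⇒NoFaceˡ ((≢# w≢q ⊗ #-collar i (Fresh-sw fr) (#-sw fr w#S w≢x) (λ l → proj₁ (c (m≤n⇒m≤1+n l)))) ⊗ w#L))
           (#-++ˡ b#) ((≢# b≢h ⊕ ≢# b≢q) ⊗ b#K ⊗ b#L) b≢w b≢x
      ◅◅ ≅⇒∼ (solve 8 (λ Θ b w x h q K L → Θ :+ (b :* (w :+ x)) :* ((h :+ q) :* (K :* L)) :=
                 Θ :+ (b :* (h :+ q)) :* ((w :+ x) :* (K :* L)))
           (λ _ → id , id) Θ ⟨ b ⟩ ⟨ w ⟩ ⟨ x i ⟩ ⟨ o i ⟩ ⟨ q ⟩ K L)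
      ◅◅ ∼-sym (subdivideEdge {Θ} {o i} {q} {(⟨ w ⟩ ++ ⟨ x i ⟩) ⋆ (K ⋆ L)} {b} (q≢h ∘ sym)
           ((≢# (w≢h ∘ sym) ⊕ ≢# o≢e) ⊗ #-link-self S ⊗ h#L) ((≢# (w≢q ∘ sym) ⊕ ≢# q≢x) ⊗ #-link q#S ⊗ q#L)
           (NoFace-sym nq ⊞ #⇒NoFaceˡ ((≢# (w≢h ∘ sym) ⊗ ≢# (q≢h ∘ sym) ⊗ #-deletion-self S) ⊗ h#L) ⊞
             #⇒NoFaceˡ ((≢# (q≢h ∘ sym) ⊗ #-collar i (Fresh-sw fr) (h#-sw fr) (λ _ → o≢e)) ⊗ h#L))
           (#-++ˡ b#) ((≢# b≢w ⊕ ≢# b≢x) ⊗ b#K ⊗ b#L) b≢h b≢q)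
      ◅◅ ≅⇒∼ (solve 9 (λ Γ w q D C L x h K →
                 (Γ :+ (w :* (q :* D)) :* L :+ (q :* C) :* L) :+ (h :* q) :* ((w :+ x) :* (K :* L)) :=
                 (Γ :+ (w :* (q :* (D :+ h :* K)) :+ q :* C) :* L) :+ (h :* K) :* (q :* (x :* L)))
           (λ _ → id , id) Γ ⟨ w ⟩ ⟨ q ⟩ D C L ⟨ x i ⟩ ⟨ o i ⟩ K)
      ◅◅ in-ctx (Γ ++ (⟨ w ⟩ ⋆ ⟨ q ⟩ ⋆ (D ++ ⟨ o i ⟩ ⋆ K) ++ ⟨ q ⟩ ⋆ C) ⋆ L) (⟨ o i ⟩ ⋆ K) st (⟨ q ⟩ ⋆ ⟨ x i ⟩ ⋆ L)
           (≅-sym {st} (star≅ (o i) S))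
      ◅◅ ≅⇒∼ (solve 8 (λ Γ w q S′ C L x st →
                 (Γ :+ (w :* (q :* S′) :+ q :* C) :* L) :+ st :* (q :* (x :* L)) :=
                 (Γ :+ (q :* C) :* L :+ (q :* (x :* st)) :* L) :+ S′ :* (w :* (q :* L)))
           (λ _ → id , id) Γ ⟨ w ⟩ ⟨ q ⟩ (D ++ ⟨ o i ⟩ ⋆ K) C L ⟨ x i ⟩ st)
      ◅◅ in-ctx (Γ ++ (⟨ q ⟩ ⋆ C) ⋆ L ++ (⟨ q ⟩ ⋆ ⟨ x i ⟩ ⋆ st) ⋆ L) (D ++ ⟨ o i ⟩ ⋆ K) S (⟨ w ⟩ ⋆ ⟨ q ⟩ ⋆ L)
           (≅-sym {S} (decompose (o i) S))
      ◅◅ ≅⇒∼ (solve 8 (λ Γ w q S C L x st →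
                 (Γ :+ (q :* C) :* L :+ (q :* (x :* st)) :* L) :+ S :* (w :* (q :* L)) :=
                 Γ :+ (w :* (q :* S) :+ q :* (x :* st :+ C)) :* L)
           (λ _ → id , id) Γ ⟨ w ⟩ ⟨ q ⟩ S C L ⟨ x i ⟩ st)
      where
      T = ren (sw i) S
      st = star (o i) S
      D = deletion (o i) S
      K = link (o i) S
      C = collar T i
      Θ = Γ ++ (⟨ w ⟩ ⋆ ⟨ q ⟩ ⋆ D) ⋆ L ++ (⟨ q ⟩ ⋆ C) ⋆ L
      Ξ = K ++ L ++ ⟨ w ⟩ ++ ⟨ x i ⟩ ++ ⟨ o i ⟩ ++ ⟨ q ⟩
      b = proj₁ (fresh (Θ ++ Ξ))
      b# : b # (Θ ++ Ξ)
      b# = proj₂ (fresh (Θ ++ Ξ))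
      b#Ξ : b # Ξ
      b#Ξ = #-++ʳ Θ b#
      b#K : b # K
      b#K = #-++ˡ b#Ξ
      b#L : b # L
      b#L = #-++ˡ (#-++ʳ K b#Ξ)
      b#vs : b # (⟨ w ⟩ ++ ⟨ x i ⟩ ++ ⟨ o i ⟩ ++ ⟨ q ⟩)
      b#vs = #-++ʳ L (#-++ʳ K b#Ξ)
      b≢w : b ≢ w
      b≢w e = b#vs (here refl) (here e)
      b≢x : b ≢ x i
      b≢x e = b#vs (there (here refl)) (here e)
      b≢h : b ≢ o i
      b≢h e = b#vs (there (there (here refl))) (here e)
      b≢q : b ≢ q
      b≢q e = b#vs (there (there (there (here refl)))) (here e)
      c′ : ∀ {j} → j < i → w ≢ x j × w ≢ o j × q ≢ x j × q ≢ o j × x j # L × o j # L ×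
             NoFace (w ∷ x j ∷ []) (Γ ++ (⟨ w ⟩ ⋆ (⟨ x i ⟩ ⋆ st)) ⋆ L) ×
             NoFace (q ∷ o j ∷ []) (Γ ++ (⟨ w ⟩ ⋆ (⟨ x i ⟩ ⋆ st)) ⋆ L)
      c′ l with c (m≤n⇒m≤1+n l)
      ... | w≢x′ , w≢h′ , q≢x′ , q≢h′ , x#L′ , h#L′ , nw′ , nq′ = w≢x′ , w≢h′ , q≢x′ , q≢h′ , x#L′ , h#L′ ,
        (nw′ ⊞ #⇒NoFaceʳ ((≢# (w≢x′ ∘ sym) ⊗ ≢# (λ e → <⇒≢ l (x-inj e)) ⊗ #-star (fr (m≤n⇒m≤1+n l))) ⊗ x#L′)) ,
        (nq′ ⊞ #⇒NoFaceˡ ((≢# (w≢q ∘ sym) ⊗ ≢# q≢x ⊗ #-star q#S) ⊗ q#L))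

-- Stellar moves for the next ball

_⊆V_ : Complex → (ℕ → Set) → Set
Δ ⊆V V = ∀ {F u} → F ∈ Δ → u ∈ F → V u

⊆V-# : ∀ {Δ V a} → Δ ⊆V V → (∀ {u} → V u → u ≢ a) → a # Δ
⊆V-# cover n F∈ z = n (cover F∈ z) refl

module Step (m k : ℕ) (B₊ B₋ S₀ : Complex) where
  open Collar m public

  v y : ℕ
  v = e m
  y = e (suc m)

  S P Q R C ball : Complex
  S = B₊ ++ B₋
  P = ren (ρ k) B₊
  Q = ren (ρ k) B₋
  R = ren (ρ k) S₀
  C = collar S k
  ball = C ++ ⟨ v ⟩ ⋆ P ++ ⟨ v ⟩ ⋆ ⟨ y ⟩ ⋆ R ++ ⟨ y ⟩ ⋆ Q

  P++Q : ren (ρ k) S ≡ P ++ Q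
  P++Q = map-++ (map (ρ k)) B₊ B₋

  -- `VQ` and `IQ` are the vertex and interior predicates for the ball `Q`, while `V` and `I` are
  -- those established for `ball`.
  module Moves {V I VQ IQ : ℕ → Set} {N : ℕ} (splitQ : Split Q R VQ IQ) (VQ-bound : ∀ {u} → VQ u → u < N)
    (fr : Fresh k S) (v≢y : v ≢ y)
    (apex≢ : ∀ {j} → j < k → (v ≢ x j × v ≢ o j) × (y ≢ x j × y ≢ o j))
    (v#PQRS : v # P × v # Q × v # R × v # S) (y#PQRS : y # P × y # Q × y # R × y # S)
    (h#PQR : ∀ {j} → j < k → o j # P × o j # Q × o j # R)
    (VQ≢ : ∀ {u} → VQ u → u ≢ v × u ≢ y)
    (IQ⇒VQ : ∀ {u} → IQ u → VQ u) (IQ# : ∀ {u} → IQ u → u # P × u # R)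
    (VQ⇒V : ∀ {u} → VQ u → V u) (Iv : I v) (Iy : I y) (Ix : ∀ {j} → j < k → I (x j)) (I⇒V : ∀ {u} → I u → V u)
    (Vh : ∀ {j} → j < k → V (o j)) (P⊆V : P ⊆V V) (Q⊆V : Q ⊆V V) (R⊆V : R ⊆V V) (S⊆V : S ⊆V V)
    where

    private
      v#P = proj₁ v#PQRS
      v#Q = proj₁ (proj₂ v#PQRS)
      v#R = proj₁ (proj₂ (proj₂ v#PQRS))
      v#S = proj₂ (proj₂ (proj₂ v#PQRS))
      y#P = proj₁ y#PQRS
      y#Q = proj₁ (proj₂ y#PQRS)
      y#R = proj₁ (proj₂ (proj₂ y#PQRS))
      y#S = proj₂ (proj₂ (proj₂ y#PQRS))

      v#C : v # C
      v#C = #-collar k fr v#S λ l → proj₁ (proj₁ (apex≢ l))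
      y#C : y # C
      y#C = #-collar k fr y#S λ l → proj₁ (proj₂ (apex≢ l))

    -- Undoing the splitting of v * Q merges `y` into `v` and leaves the full cone v * (P ++ Q)
    -- above the collar. Then `coneOff-collar` brings the cone down to `S`.
    ball-conesOff : ConesOff ball S v V I
    ball-conesOff {Γ} {L} i vL =
      ≅⇒∼ (solve 8 (λ Γ C v P y R Q L → Γ :+ (C :+ v :* P :+ v :* y :* R :+ y :* Q) :* L :=
               (Γ :+ C :* L :+ (v :* P) :* L) :+ (y :* (v :* R :+ Q)) :* L)
          (λ _ → id , id) Γ C ⟨ v ⟩ P ⟨ y ⟩ R Q L)
      ◅◅ ∼-sym (splitQ {Γ ++ C ⋆ L ++ (⟨ v ⟩ ⋆ P) ⋆ L} {L} {v} {y}
           (i Iy ⊕ (y#C ⊗ y#L) ⊕ (≢# (v≢y ∘ sym) ⊗ y#P) ⊗ y#L) y#L v#L (v≢y ∘ sym)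
           (λ p → proj₁ (VQ≢ p) , proj₂ (VQ≢ p) , vL (VQ⇒V p))
           (λ p → #⇒NoFaceˡ (i Iv) ⊞ #⇒NoFaceˡ (v#C ⊗ v#L) ⊞
             #⇒NoFaceʳ ((≢# (proj₁ (VQ≢ (IQ⇒VQ p))) ⊗ proj₁ (IQ# p)) ⊗ vL (VQ⇒V (IQ⇒VQ p)))))
      ◅◅ ≅⇒∼ (solve 6 (λ Γ C v P Q L → (Γ :+ C :* L :+ (v :* P) :* L) :+ (v :* Q) :* L := Γ :+ (C :+ v :* (P :+ Q)) :* L)
          (λ _ → id , id) Γ C ⟨ v ⟩ P Q L)
      ◅◅ subst (λ T → Γ ++ (C ++ ⟨ v ⟩ ⋆ T) ⋆ L ∼ Γ ++ (⟨ v ⟩ ⋆ S) ⋆ L) P++Q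
           (coneOff-collar v#L k S {Γ} fr (λ l → let ((a , b) , _) = apex≢ l in
             a , b , vL (I⇒V (Ix l)) , vL (Vh l) , i (Ix l) , #⇒NoFaceˡ (i Iv)) v#S)
      where
      y#L = vL (I⇒V Iy)
      v#L = vL (I⇒V Iv)

    -- The new vertex `q` takes the place of `w` piece by piece: over `P` and `R`, then over `Q`,
    -- and last over the collar.
    ball-split : Split ball S V I
    ball-split {Γ} {L} {w} {q} q#Γ q#L w#L q≢w vs i =
      ≅⇒∼ (solve 9 (λ Γ w C v P y R Q L → Γ :+ (w :* (C :+ v :* P :+ v :* y :* R :+ y :* Q)) :* L :=
               (Γ :+ (w :* C) :* L :+ (w :* y :* Q) :* L) :+ (w :* v) :* ((P :+ y :* R) :* L))
          (λ _ → id , id) Γ ⟨ w ⟩ C ⟨ v ⟩ P ⟨ y ⟩ R Q L)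
      -- After this subdivision w y * (Q ++ q * R) is the only piece, outside `Γ`, that contains the
      -- edge from `w` to `y`.
      ◅◅ subdivideEdge {Θ₁} {w} {v} {(P ++ ⟨ y ⟩ ⋆ R) ⋆ L} {q} (v≢w ∘ sym)
           ((w#P ⊕ ≢# (y≢w ∘ sym) ⊗ w#R) ⊗ w#L) ((v#P ⊕ ≢# v≢y ⊗ v#R) ⊗ v#L)
           (i Iv ⊞ #⇒NoFaceʳ ((≢# v≢w ⊗ v#C) ⊗ v#L) ⊞ #⇒NoFaceʳ ((≢# v≢w ⊗ ≢# v≢y ⊗ v#Q) ⊗ v#L))
           (q#Γ ⊕ (≢# q≢w ⊗ q#C) ⊗ q#L ⊕ (≢# q≢w ⊗ ≢# (y≢q ∘ sym) ⊗ q#Q) ⊗ q#L)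
           ((q#P ⊕ ≢# (y≢q ∘ sym) ⊗ q#R) ⊗ q#L) q≢w (v≢q ∘ sym)
      ◅◅ ≅⇒∼ (solve 10 (λ Γ w C v P y R Q L q →
                 (Γ :+ (w :* C) :* L :+ (w :* y :* Q) :* L) :+ (q :* (w :+ v)) :* ((P :+ y :* R) :* L) :=
                 (Γ :+ (w :* C) :* L :+ (q :* w :* P) :* L :+ (q :* v :* (P :+ y :* R)) :* L) :+ (w :* y) :* ((Q :+ q :* R) :* L))
           (λ _ → id , id) Γ ⟨ w ⟩ C ⟨ v ⟩ P ⟨ y ⟩ R Q L ⟨ q ⟩)
      -- A flip with the ball q * Q in place of an edge: its boundary is Q ++ q * R. Subdividing w y
      -- by `b` gives b * (w + y) * (Q ++ q * R), and the reverse of `splitQ` turns this into q * Q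
      -- * (w + y).
      ◅◅ subdivideEdge {Θ₂} {w} {y} {(Q ++ ⟨ q ⟩ ⋆ R) ⋆ L} {b} (y≢w ∘ sym)
           ((w#Q ⊕ ≢# (q≢w ∘ sym) ⊗ w#R) ⊗ w#L) ((y#Q ⊕ ≢# y≢q ⊗ y#R) ⊗ y#L)
           (i Iy ⊞ #⇒NoFaceʳ ((≢# y≢w ⊗ y#C) ⊗ y#L) ⊞ #⇒NoFaceʳ ((≢# y≢q ⊗ ≢# y≢w ⊗ y#P) ⊗ y#L) ⊞
             #⇒NoFaceˡ ((≢# (q≢w ∘ sym) ⊗ ≢# (v≢w ∘ sym) ⊗ (w#P ⊕ ≢# (y≢w ∘ sym) ⊗ w#R)) ⊗ w#L))
           (#-++ˡ b#) ((b#Q ⊕ ≢# b≢q ⊗ b#R) ⊗ b#L) b≢w b≢y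
      ◅◅ ≅⇒∼ (solve 8 (λ Θ b w y Q q R L → Θ :+ (b :* (w :+ y)) :* ((Q :+ q :* R) :* L) :=
                 Θ :+ (b :* (q :* R :+ Q)) :* ((w :+ y) :* L))
           (λ _ → id , id) Θ₂ ⟨ b ⟩ ⟨ w ⟩ ⟨ y ⟩ Q ⟨ q ⟩ R L)
      ◅◅ ∼-sym (splitQ {Θ₂} {(⟨ w ⟩ ++ ⟨ y ⟩) ⋆ L} {q} {b} (#-++ˡ b#) ((≢# b≢w ⊕ ≢# b≢y) ⊗ b#L)
           ((≢# q≢w ⊕ ≢# (y≢q ∘ sym)) ⊗ q#L) b≢q
           (λ p → let (a , c , d) = vs (VQ⇒V p) in c , (λ { e → b∉VQ p (sym e) }) , (≢# a ⊕ ≢# (proj₂ (VQ≢ p))) ⊗ d)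
           (λ p → let u#P = proj₁ (IQ# p) ; u#R = proj₂ (IQ# p) ; (u≢w , u≢q , u#L) = vs (VQ⇒V (IQ⇒VQ p))
                      (u≢v , u≢y) = VQ≢ (IQ⇒VQ p) in
             #⇒NoFaceˡ q#Γ ⊞ #⇒NoFaceˡ ((≢# q≢w ⊗ q#C) ⊗ q#L) ⊞ #⇒NoFaceʳ ((≢# u≢q ⊗ ≢# u≢w ⊗ u#P) ⊗ u#L) ⊞
             #⇒NoFaceʳ ((≢# u≢q ⊗ ≢# u≢v ⊗ (u#P ⊕ ≢# u≢y ⊗ u#R)) ⊗ u#L)))
      ◅◅ ≅⇒∼ (solve 10 (λ Γ w C q P v y R L Q →
                 (Γ :+ (w :* C) :* L :+ (q :* w :* P) :* L :+ (q :* v :* (P :+ y :* R)) :* L) :+ (q :* Q) :* ((w :+ y) :* L) :=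
                 (Γ :+ (q :* (v :* (P :+ y :* R) :+ y :* Q)) :* L) :+ (w :* (C :+ q :* (P :+ Q))) :* L)
           (λ _ → id , id) Γ ⟨ w ⟩ C ⟨ q ⟩ P ⟨ v ⟩ ⟨ y ⟩ R L Q)
      -- Outside `Γ`, the vertex `w` now occurs only in w * (C ++ q * (P ++ Q)), the shape that
      -- `split-collar` handles.
      ◅◅ subst (λ T → Θ₃ ++ (⟨ w ⟩ ⋆ (C ++ ⟨ q ⟩ ⋆ T)) ⋆ L ∼ Θ₃ ++ (⟨ w ⟩ ⋆ ⟨ q ⟩ ⋆ S ++ ⟨ q ⟩ ⋆ C) ⋆ L) P++Q
           (split-collar w#L q#L (q≢w ∘ sym) k S {Θ₃} fr cond w#S q#S)
      ◅◅ ≅⇒∼ (solve 11 (λ Γ w S C q P v y R Q L →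
                 (Γ :+ (q :* (v :* (P :+ y :* R) :+ y :* Q)) :* L) :+ (w :* q :* S :+ q :* C) :* L :=
                 Γ :+ (q :* (w :* S :+ (C :+ v :* P :+ v :* y :* R :+ y :* Q))) :* L)
           (λ _ → id , id) Γ ⟨ w ⟩ S C ⟨ q ⟩ P ⟨ v ⟩ ⟨ y ⟩ R Q L)
      where
      y#L = proj₂ (proj₂ (vs (I⇒V Iy)))
      v#L = proj₂ (proj₂ (vs (I⇒V Iv)))
      y≢w = proj₁ (vs (I⇒V Iy))
      y≢q = proj₁ (proj₂ (vs (I⇒V Iy)))
      v≢w = proj₁ (vs (I⇒V Iv))
      v≢q = proj₁ (proj₂ (vs (I⇒V Iv)))
      w# : ∀ {Δ} → Δ ⊆V V → w # Δ
      w# cover = ⊆V-# cover λ p → proj₁ (vs p)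
      q# : ∀ {Δ} → Δ ⊆V V → q # Δ
      q# cover = ⊆V-# cover λ p → proj₁ (proj₂ (vs p))
      w#P = w# P⊆V
      w#Q = w# Q⊆V
      w#R = w# R⊆V
      w#S = w# S⊆V
      q#P = q# P⊆V
      q#Q = q# Q⊆V
      q#R = q# R⊆V
      q#S = q# S⊆V
      q#C : q # C
      q#C = #-collar k fr q#S λ l → proj₁ (proj₂ (vs (I⇒V (Ix l)))) ∘ sym
      Θ₁ = Γ ++ (⟨ w ⟩ ⋆ C) ⋆ L ++ (⟨ w ⟩ ⋆ ⟨ y ⟩ ⋆ Q) ⋆ L
      Θ₂ = Γ ++ (⟨ w ⟩ ⋆ C) ⋆ L ++ (⟨ q ⟩ ⋆ ⟨ w ⟩ ⋆ P) ⋆ L ++ (⟨ q ⟩ ⋆ ⟨ v ⟩ ⋆ (P ++ ⟨ y ⟩ ⋆ R)) ⋆ L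
      Θ₃ = Γ ++ (⟨ q ⟩ ⋆ (⟨ v ⟩ ⋆ (P ++ ⟨ y ⟩ ⋆ R) ++ ⟨ y ⟩ ⋆ Q)) ⋆ L
      -- A predicate cannot be avoided by inspecting a list, so all labels below the bound `N` are
      -- added to keep `b` outside `VQ`.
      Ξ = Q ++ R ++ L ++ ⟨ w ⟩ ++ ⟨ q ⟩ ++ ⟨ y ⟩ ++ ⟪ upTo N ⟫
      b = proj₁ (fresh (Θ₂ ++ Ξ))
      b# : b # (Θ₂ ++ Ξ)
      b# = proj₂ (fresh (Θ₂ ++ Ξ))
      b#Ξ : b # Ξ
      b#Ξ = #-++ʳ Θ₂ b#
      b#Q : b # Q
      b#Q = #-++ˡ b#Ξ
      b#R : b # R
      b#R = #-++ˡ (#-++ʳ Q b#Ξ)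
      b#L : b # L
      b#L = #-++ˡ (#-++ʳ R (#-++ʳ Q b#Ξ))
      b#vs : b # (⟨ w ⟩ ++ ⟨ q ⟩ ++ ⟨ y ⟩ ++ ⟪ upTo N ⟫)
      b#vs = #-++ʳ L (#-++ʳ R (#-++ʳ Q b#Ξ))
      b≢w : b ≢ w
      b≢w e = b#vs (here refl) (here e)
      b≢q : b ≢ q
      b≢q e = b#vs (there (here refl)) (here e)
      b≢y : b ≢ y
      b≢y e = b#vs (there (there (here refl))) (here e)
      b∉VQ : ∀ {u} → VQ u → b ≢ u
      b∉VQ p e = b#vs (there (there (there (here refl)))) (subst (_∈ upTo N) (sym e) (∈-upTo⁺ (VQ-bound p)))
      cond : ∀ {j} → j < k → w ≢ x j × w ≢ o j × q ≢ x j × q ≢ o j × x j # L × o j # L ×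
             NoFace (w ∷ x j ∷ []) Θ₃ × NoFace (q ∷ o j ∷ []) Θ₃
      cond l with vs (I⇒V (Ix l)) | vs (Vh l) | apex≢ l | h#PQR l
      ... | x≢w , x≢q , x#L | h≢w , h≢q , h#L | (_ , v≢h) , (_ , y≢h) | h#P , h#Q , h#R =
        x≢w ∘ sym , h≢w ∘ sym , x≢q ∘ sym , h≢q ∘ sym , x#L , h#L ,
        (i (Ix l) ⊞ #⇒NoFaceˡ ((≢# (q≢w ∘ sym) ⊗ ((≢# (v≢w ∘ sym) ⊗ (w#P ⊕ ≢# (y≢w ∘ sym) ⊗ w#R)) ⊕ ≢# (y≢w ∘ sym) ⊗ w#Q)) ⊗ w#L)) ,
        (#⇒NoFaceˡ q#Γ ⊞ #⇒NoFaceʳ ((≢# h≢q ⊗ ((≢# (v≢h ∘ sym) ⊗ (h#P ⊕ ≢# (y≢h ∘ sym) ⊗ h#R)) ⊕ ≢# (y≢h ∘ sym) ⊗ h#Q)) ⊗ h#L))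

-- Vertex ranges at one level

half<⇒< : ∀ {u m} → half u < m → u < e m
half<⇒< {zero} {suc m} _ = s≤s z≤n
half<⇒< {suc zero} {suc m} _ = s≤s (s≤s z≤n)
half<⇒< {suc (suc u)} {suc m} (s≤s p) = s≤s (s≤s (half<⇒< p))

Low : ℕ → ℕ → Set
Low m u = half u < m

Positive : ℕ → Set
Positive u = u ≡ e (half u)

Int : ℕ → ℕ → ℕ → Set
Int k m u = Positive u × k ≤ half u × half u < m

-- The boundary uses both signs on the first `k` pairs, the interior only the positive vertices of
-- the later ones. A common vertex of the ball and its antipode therefore lies among the first `k`
-- pairs.
BallV : ℕ → ℕ → ℕ → Set
BallV k m u = half u < k ⊎ Int k m u

Positive-e : ∀ i → Positive (e i)
Positive-e i = cong e (sym (half-e i))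

Int-e : ∀ {k m i} → k ≤ i → i < m → Int k m (e i)
Int-e {k} {m} {i} p q = Positive-e i , subst (k ≤_) (sym (half-e i)) p , subst (_< m) (sym (half-e i)) q

Low-e : ∀ {m i} → i < m → Low m (e i)
Low-e {m} {i} = subst (_< m) (sym (half-e i))

Low-o : ∀ {m i} → i < m → Low m (o i)
Low-o {m} {i} = subst (_< m) (sym (half-o i))

Split-mono : ∀ {B S V V′ I I′} → (∀ {u} → V u → V′ u) → (∀ {u} → I u → I′ u) → Split B S V I → Split B S V′ I′
Split-mono f g s a b c d v i = s a b c d (v ∘ f) (i ∘ g)

Split-≅ : ∀ {B S S′ V I} → S ≅ S′ → Split B S V I → Split B S′ V I
Split-≅ {B} {S} {S′} p s {Γ} {L} {w} {q} a b c d v i = s a b c d v i ◅◅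
  in-ctx Γ (⟨ q ⟩ ⋆ (⟨ w ⟩ ⋆ S ++ B)) (⟨ q ⟩ ⋆ (⟨ w ⟩ ⋆ S′ ++ B)) L
    (⋆-mono {⟨ q ⟩} {⟨ q ⟩} {⟨ w ⟩ ⋆ S ++ B} ≅-refl (++-mono {⟨ w ⟩ ⋆ S} {⟨ w ⟩ ⋆ S′} {B} (⋆-mono {⟨ w ⟩} {⟨ w ⟩} {S} ≅-refl p) ≅-refl))

∈-ren⁻ : ∀ {g Δ F u} → F ∈ ren g Δ → u ∈ F → ∃ λ G → ∃ λ z → G ∈ Δ × z ∈ G × u ≡ g z
∈-ren⁻ {g} F∈ u∈ with ∈-map⁻ (map g) F∈
... | G , G∈ , refl with ∈-map⁻ g u∈
... | z , z∈ , p = G , z , G∈ , z∈ , p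

ren-⊆V : ∀ {g Δ V W} → Δ ⊆V V → (∀ {u} → V u → W (g u)) → ren g Δ ⊆V W
ren-⊆V {g} {W = W} c f F∈ u∈ with ∈-ren⁻ {g} F∈ u∈
... | G , z , G∈ , z∈ , p = subst W (sym p) (f (c G∈ z∈))

++-⊆V : ∀ {Δ Γ V} → Δ ⊆V V → Γ ⊆V V → (Δ ++ Γ) ⊆V V
++-⊆V {Δ} p q F∈ = [ p , q ]′ (∈-++⁻ Δ F∈)

⋆-⊆V : ∀ {Δ Γ V} → Δ ⊆V V → Γ ⊆V V → (Δ ⋆ Γ) ⊆V V
⋆-⊆V p q H∈ u∈ with ∈-⋆⁻ H∈
... | F , G , F∈ , G∈ , refl = [ p F∈ , q G∈ ]′ (∈-++⁻ F u∈)

⟨⟩-⊆V : ∀ {v} {V : ℕ → Set} → V v → ⟨ v ⟩ ⊆V V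
⟨⟩-⊆V p (here refl) (here refl) = p

module Level (m k : ℕ) (k≤m : k ≤ m) (B S₀ : Complex) (B⊆ : B ⊆V BallV k m) (S₀⊆ : S₀ ⊆V Low k) where

  m′ : ℕ
  -- One further pair for each of the two apices, and one for each `x j` with j < k.
  m′ = suc (suc (m + k))

  open Step m k B (ren σ B) S₀ public

  m<m′ : m < m′
  m<m′ = s≤s (≤-trans (m≤m+n m k) (m≤n+m (m + k) 1))

  1+m<m′ : suc m < m′
  1+m<m′ = s≤s (s≤s (m≤m+n m k))

  x<m′ : ∀ {j} → j < k → suc (suc (m + j)) < m′
  x<m′ l = s≤s (s≤s (+-monoʳ-< m l))

  i<m⇒e≢x : ∀ {i j} → i < suc (suc m) → e i ≢ x j
  i<m⇒e≢x {i} {j} l p = <⇒≱ l (subst (suc (suc m) ≤_) (sym (e-inj p)) (s≤s (s≤s (m≤m+n m j))))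

  ρ-e : ∀ {i} → i < suc (suc m) → ρ k (e i) ≡ e i
  ρ-e l = ρ-other k λ _ → (λ p → o≢e (sym p)) , i<m⇒e≢x l

  ρ-o : ∀ {i} → k ≤ i → ρ k (o i) ≡ o i
  ρ-o k≤i = ρ-other k λ l → (λ p → <⇒≱ l (subst (k ≤_) (o-inj p) k≤i)) , o≢e

  -- The labels that occur after `ρ k`. Negative vertices of the first `k` pairs have become some
  -- `x j`, and the remaining negative ones come only from the antipode of `B`, so `P` and `R` stay
  -- within `PosV`.
  PosV TopV : ℕ → ℕ → Set
  PosV a u = (∃ λ i → i < a × u ≡ e i) ⊎ (∃ λ j → j < k × u ≡ x j)
  TopV a u = (∃ λ i → k ≤ i × i < a × u ≡ o i) ⊎ PosV a u

  ρ-Low : ∀ {a u} → a ≤ m → half u < a → TopV a (ρ k u)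
  ρ-Low {a} {u} a≤m l with view u
  ... | inj₁ p = inj₂ (inj₁ (half u , l , trans (cong (ρ k) p) (ρ-e (m≤n⇒m≤o+n 2 (≤-trans l a≤m)))))
  ... | inj₂ p with half u <? k
  ... | yes q = inj₂ (inj₂ (half u , q , trans (cong (ρ k) p) (ρ-h k q)))
  ... | no q = inj₁ (half u , ≮⇒≥ q , l , trans (cong (ρ k) p) (ρ-o (≮⇒≥ q)))

  ρ-Low-k : ∀ {u} → half u < k → PosV k (ρ k u)
  ρ-Low-k l with ρ-Low k≤m l
  ... | inj₁ (i , k≤i , i<k , _) = ⊥-elim (<⇒≱ i<k k≤i)
  ... | inj₂ p = p

  PosV-mono : ∀ {u} → PosV k u → PosV m u
  PosV-mono (inj₁ (i , l , p)) = inj₁ (i , ≤-trans l k≤m , p)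
  PosV-mono (inj₂ p) = inj₂ p

  ρ-BallV : ∀ {u} → BallV k m u → PosV m (ρ k u)
  ρ-BallV (inj₁ l) = PosV-mono (ρ-Low-k l)
  ρ-BallV {u} (inj₂ (p , _ , l)) = inj₁ (half u , l , trans (cong (ρ k) p) (ρ-e (m≤n⇒m≤o+n 2 l)))

  BallV⇒Low : ∀ {u} → BallV k m u → Low m u
  BallV⇒Low (inj₁ l) = ≤-trans l k≤m
  BallV⇒Low (inj₂ (_ , _ , l)) = l

  σB⊆ : ren σ B ⊆V Low m
  σB⊆ = ren-⊆V {W = Low m} B⊆ (λ {u} p → subst (_< m) (sym (half-σ u)) (BallV⇒Low p))

  S⊆ : S ⊆V Low m
  S⊆ = ++-⊆V {B} (λ F∈ u∈ → BallV⇒Low (B⊆ F∈ u∈)) σB⊆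

  P⊆ : P ⊆V PosV m
  P⊆ = ren-⊆V {W = PosV m} B⊆ ρ-BallV

  Q⊆ : Q ⊆V TopV m
  Q⊆ = ren-⊆V {W = TopV m} σB⊆ (ρ-Low ≤-refl)

  R⊆ : R ⊆V PosV k
  R⊆ = ren-⊆V {W = PosV k} S₀⊆ ρ-Low-k

  P⊆Top : P ⊆V TopV m
  P⊆Top F∈ u∈ = inj₂ (P⊆ F∈ u∈)

  R⊆Top : R ⊆V TopV m
  R⊆Top F∈ u∈ = inj₂ (PosV-mono (R⊆ F∈ u∈))

  PosV⇒Positive : ∀ {a u} → PosV a u → Positive u
  PosV⇒Positive (inj₁ (i , _ , refl)) = Positive-e i
  PosV⇒Positive (inj₂ (j , _ , refl)) = Positive-e (suc (suc (m + j)))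

  TopV⇒Low : ∀ {u} → TopV m u → Low m′ u
  TopV⇒Low (inj₁ (i , _ , l , refl)) = Low-o (≤-trans l (<⇒≤ m<m′))
  TopV⇒Low (inj₂ (inj₁ (i , l , refl))) = Low-e (≤-trans l (<⇒≤ m<m′))
  TopV⇒Low (inj₂ (inj₂ (j , l , refl))) = Low-e (x<m′ l)

  Low≢e : ∀ {u i} → m ≤ i → Low m u → u ≢ e i
  Low≢e {i = i} m≤i l refl = <⇒≱ l (subst (m ≤_) (sym (half-e i)) m≤i)

  TopV≢vy : ∀ {u} → TopV m u → u ≢ v × u ≢ y
  TopV≢vy (inj₁ (i , _ , _ , refl)) = o≢e , o≢e
  TopV≢vy (inj₂ (inj₁ (i , l , refl))) = Low≢e ≤-refl (Low-e l) , Low≢e (m≤n⇒m≤1+n ≤-refl) (Low-e l)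
  TopV≢vy (inj₂ (inj₂ (j , l , refl))) = (λ p → i<m⇒e≢x (m≤n⇒m≤1+n ≤-refl) (sym p)) , (λ p → i<m⇒e≢x ≤-refl (sym p))

  TopV≢h : ∀ {u j} → j < k → TopV m u → u ≢ o j
  TopV≢h l (inj₁ (i , k≤i , _ , refl)) p = <⇒≱ l (subst (k ≤_) (o-inj p) k≤i)
  TopV≢h l (inj₂ (inj₁ (i , _ , refl))) p = o≢e (sym p)
  TopV≢h l (inj₂ (inj₂ (i , _ , refl))) p = o≢e (sym p)

  fr : Fresh k S
  fr {j} l = ⊆V-# S⊆ (Low≢e (m≤n⇒m≤1+n (m≤n⇒m≤1+n (m≤m+n m j))))

  v≢y : v ≢ y
  v≢y p = <⇒≢ (n<1+n m) (e-inj p)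

  apex≢ : ∀ {j} → j < k → (v ≢ x j × v ≢ o j) × (y ≢ x j × y ≢ o j)
  apex≢ l = (i<m⇒e≢x (m≤n⇒m≤1+n ≤-refl) , λ p → o≢e (sym p)) , (i<m⇒e≢x ≤-refl , λ p → o≢e (sym p))

  IntV : ℕ → Set
  IntV u = ∃ λ i → k ≤ i × i < m × u ≡ o i

  module _ (S₀-sym : ren σ S₀ ≅ S₀) (split : Split B S₀ (Low m) (Int k m)) where

    -- `Q` is `B` renamed by `σ` and then by `ρ k`, so its splitting is transported from `B`; the
    -- symmetry of `S₀` identifies the boundary with `R`.
    splitQ : Split Q R (TopV m) IntV
    splitQ = Split-mono
        (λ {u} l → subst (TopV m) (ρρ⁻¹ k u) (ρ-Low ≤-refl (subst (_< m) (half-σ (ρ⁻¹ k u)) l)))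
        (λ {u} (p , k≤ , <m) → let w = ρ⁻¹ k u ; q = trans (sym (σ-inv w)) (trans (cong σ p) (σ-e (half (σ w)))) in
           half (σ w) , k≤ , <m , trans (sym (ρρ⁻¹ k u)) (trans (cong (ρ k) q) (ρ-o k≤)))
        (Split-ren-ρ k {V = Low m ∘ σ} {I = Int k m ∘ σ} (Split-≅ {ren σ B} {_} {S₀} S₀-sym (Split-ren σ σ-inv split)))

    private
      IntV⇒TopV : ∀ {u} → IntV u → TopV m u
      IntV⇒TopV = inj₁

      IntV# : ∀ {u} → IntV u → u # P × u # R
      IntV# (i , _ , _ , refl) = ⊆V-# P⊆ ≢o , ⊆V-# R⊆ ≢o
        where
        ≢o : ∀ {a u} → PosV a u → u ≢ o i
        ≢o p q = o≢e (trans (sym q) (PosV⇒Positive p))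

      v# y# : ∀ {Δ} → Δ ⊆V TopV m → _ # Δ
      v# c = ⊆V-# c (proj₁ ∘ TopV≢vy)
      y# c = ⊆V-# c (proj₂ ∘ TopV≢vy)

      h# : ∀ {j Δ} → j < k → Δ ⊆V TopV m → o j # Δ
      h# l c = ⊆V-# c (TopV≢h l)

      top : ∀ {Δ} → Δ ⊆V TopV m → Δ ⊆V Low m′
      top c F∈ u∈ = TopV⇒Low (c F∈ u∈)

      S⊆′ : S ⊆V Low m′
      S⊆′ F∈ u∈ = ≤-trans (S⊆ F∈ u∈) (<⇒≤ m<m′)

    open Moves {Low m′} {Int m m′} splitQ (half<⇒< ∘ TopV⇒Low) fr v≢y apex≢
      (v# P⊆Top , v# Q⊆ , v# R⊆Top , ⊆V-# S⊆ (Low≢e ≤-refl))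
      (y# P⊆Top , y# Q⊆ , y# R⊆Top , ⊆V-# S⊆ (Low≢e (m≤n⇒m≤1+n ≤-refl)))
      (λ l → h# l P⊆Top , h# l Q⊆ , h# l R⊆Top) TopV≢vy IntV⇒TopV IntV# TopV⇒Low
      (Int-e ≤-refl m<m′) (Int-e (m≤n⇒m≤1+n ≤-refl) 1+m<m′) (λ {j} l → Int-e (m≤n⇒m≤1+n (m≤n⇒m≤1+n (m≤m+n m j))) (x<m′ l))
      (proj₂ ∘ proj₂) (λ l → Low-o (≤-trans l (≤-trans k≤m (<⇒≤ m<m′)))) (top P⊆Top) (top Q⊆) (top R⊆Top) S⊆′ public

  collar⊆ : ∀ i {T} → i ≤ k → T ⊆V BallV m m′ → collar T i ⊆V BallV m m′
  collar⊆ (suc i) {T} i<k c = ++-⊆V {⟨ x i ⟩ ⋆ star (o i) T}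
    (⋆-⊆V (⟨⟩-⊆V {V = BallV m m′} Vx) λ F∈ → c (proj₁ (∈-star⁻ {o i} {T} F∈)))
    (collar⊆ i (<⇒≤ i<k) (ren-⊆V {W = BallV m m′} c swap-V))
    where
    Vx : BallV m m′ (x i)
    Vx = inj₂ (Int-e (m≤n⇒m≤1+n (m≤n⇒m≤1+n (m≤m+n m i))) (x<m′ i<k))
    swap-V : ∀ {u} → BallV m m′ u → BallV m m′ (sw i u)
    swap-V {u} p with u ≟ o i
    ... | yes _ = Vx
    ... | no _ with u ≟ x i
    ... | yes _ = inj₁ (Low-o (≤-trans i<k k≤m))
    ... | no _ = p

  ball⊆ : ball ⊆V BallV m m′
  ball⊆ = ++-⊆V {C} {V = BallV m m′} (collar⊆ k ≤-refl λ F∈ u∈ → inj₁ (S⊆ F∈ u∈))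
    (++-⊆V {⟨ v ⟩ ⋆ P} (join cv (cover P⊆Top))
    (++-⊆V {⟨ v ⟩ ⋆ ⟨ y ⟩ ⋆ R} (join cv (join cy (cover R⊆Top)))
      (join cy (cover Q⊆))))
    where
    join : ∀ {Δ Γ} → Δ ⊆V BallV m m′ → Γ ⊆V BallV m m′ → (Δ ⋆ Γ) ⊆V BallV m m′
    join = ⋆-⊆V {V = BallV m m′}
    cv : ⟨ v ⟩ ⊆V BallV m m′
    cv = ⟨⟩-⊆V {V = BallV m m′} (inj₂ (Int-e ≤-refl m<m′))
    cy : ⟨ y ⟩ ⊆V BallV m m′
    cy = ⟨⟩-⊆V {V = BallV m m′} (inj₂ (Int-e (m≤n⇒m≤1+n ≤-refl) 1+m<m′))
    cover : ∀ {Δ} → Δ ⊆V TopV m → Δ ⊆V BallV m m′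
    cover c F∈ u∈ with c F∈ u∈
    ... | inj₁ (i , _ , l , refl) = inj₁ (Low-o l)
    ... | inj₂ (inj₁ (i , l , refl)) = inj₁ (Low-e l)
    ... | inj₂ (inj₂ (j , l , refl)) = inj₂ (Int-e (m≤n⇒m≤1+n (m≤n⇒m≤1+n (m≤m+n m j))) (x<m′ l))

-- The spheres and balls

-- The vertices of Sph j are the numbers below e (n j), i.e. the first n j antipodal pairs.
n : ℕ → ℕ
n zero = 0
n (suc zero) = 1
n (suc (suc j)) = suc (suc (n (suc j) + n j))

n-mono : ∀ j → n j ≤ n (suc j)
n-mono zero = z≤n
n-mono (suc j) = m≤n⇒m≤1+n (m≤n⇒m≤1+n (m≤m+n (n (suc j)) (n j)))

-- Sph j is the sphere S_{j-1} of the paper, so that Sph 0 has only the empty face,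
-- and Ball (suc j) is the ball B_j with boundary Sph j.
Ball : ℕ → Complex
Sph : ℕ → Complex
Ball zero = ⟪ [] ⟫
Ball (suc zero) = ⟨ 0 ⟩
Ball (suc (suc j)) = Step.ball (n (suc j)) (n j) (Ball (suc j)) (ren σ (Ball (suc j))) (Ball j ++ ren σ (Ball j))
Sph j = Ball j ++ ren σ (Ball j)

Ball⊆ : ∀ j → Ball (suc j) ⊆V BallV (n j) (n (suc j))
Sph⊆ : ∀ j → Sph j ⊆V Low (n j)
module Lv (j : ℕ) = Level (n (suc j)) (n j) (n-mono j) (Ball (suc j)) (Sph j) (Ball⊆ j) (Sph⊆ j)
Ball⊆ zero (here refl) (here refl) = inj₂ (refl , z≤n , s≤s z≤n)
Ball⊆ (suc j) = Lv.ball⊆ j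
Sph⊆ zero (here refl) ()
Sph⊆ zero (there (here refl)) ()
Sph⊆ (suc j) = ++-⊆V {Ball (suc j)} ball-low (ren-⊆V {W = Low (n (suc j))} ball-low (λ {u} p → subst (_< n (suc j)) (sym (half-σ u)) p))
  where
  ball-low : Ball (suc j) ⊆V Low (n (suc j))
  ball-low F∈ u∈ = [ (λ l → ≤-trans l (n-mono j)) , (λ (_ , _ , l) → l) ]′ (Ball⊆ j F∈ u∈)

Sph-sym : ∀ j → ren σ (Sph j) ≅ Sph j
Sph-sym j = subst (_≅ Sph j) (sym (trans (map-++ (map σ) (Ball j) (ren σ (Ball j))) (cong (ren σ (Ball j) ++_) (Relabel.ren-inv σ σ-inv (Ball j)))))
  (++-swap (ren σ (Ball j)) (Ball j))
  where
  ++-swap : ∀ Δ Γ → (Δ ++ Γ) ≅ (Γ ++ Δ)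
  ++-swap Δ Γ = ≼-≅ (λ {F} p → F , [ ∈-++⁺ʳ Γ , ∈-++⁺ˡ ]′ (∈-++⁻ Δ p) , id) (λ {F} p → F , [ ∈-++⁺ʳ Δ , ∈-++⁺ˡ ]′ (∈-++⁻ Γ p) , id)

Sph-zero : Sph 0 ≅ ⟪ [] ⟫
Sph-zero = ≼-≅ (λ { (here refl) → gen (here refl) ; (there (here refl)) → gen (here refl) }) (λ { (here refl) → gen (here refl) })

Ball-split : ∀ j → Split (Ball (suc j)) (Sph j) (Low (n (suc j))) (Int (n j) (n (suc j)))
-- The cone over the point 0 is an edge, and the splitting is its subdivision by `q`.
Ball-split zero = Split-≅ {⟨ 0 ⟩} {⟪ [] ⟫} {Sph 0} (≅-sym {Sph 0} Sph-zero) λ {Γ} {L} {w} {q} q#Γ q#L w#L q≢w vs i →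
  let (0≢w , 0≢q , 0#L) = vs 0<1 in
  subdivideEdge {Γ} {w} {0} {L} {q} (0≢w ∘ sym) w#L 0#L (i (refl , z≤n , 0<1)) q#Γ q#L q≢w (0≢q ∘ sym)
  ◅◅ ≅⇒∼ (solve 5 (λ Γ q w a L → Γ :+ (q :* (w :+ a)) :* L := Γ :+ (q :* (w :* con 1 :+ a)) :* L)
       (λ _ → id , id) Γ ⟨ q ⟩ ⟨ w ⟩ ⟨ 0 ⟩ L)
  where
  0<1 : 0 < 1
  0<1 = s≤s z≤n
Ball-split (suc j) = Lv.ball-split j (Sph-sym j) (Ball-split j)

Ball-conesOff : ∀ j → ConesOff (Ball (suc j)) (Sph j) (e (n j)) (Low (n (suc j))) (Int (n j) (n (suc j)))
Ball-conesOff zero {Γ} {L} i v =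
  ≅⇒∼ (solve 3 (λ Γ a L → Γ :+ a :* L := Γ :+ con 1 :* (a :* L)) (λ _ → id , id) Γ ⟨ 0 ⟩ L)
  ◅◅ in-ctx Γ ⟪ [] ⟫ (Sph 0) (⟨ 0 ⟩ ⋆ L) (≅-sym {Sph 0} Sph-zero)
  ◅◅ ≅⇒∼ (solve 4 (λ Γ a L S → Γ :+ S :* (a :* L) := Γ :+ (a :* S) :* L) (λ _ → id , id) Γ ⟨ 0 ⟩ L (Sph 0))
Ball-conesOff (suc j) = Lv.ball-conesOff j (Sph-sym j) (Ball-split j)

-- Triangulations of simplices and their boundaries

bd-∷ : ∀ {c τ} → c ∉ τ → bd (c ∷ τ) ≅ (⟪ τ ⟫ ++ ⟨ c ⟩ ⋆ bd τ)
bd-∷ {c} {τ} c∉ = ≼-≅ to from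
  where
  to : bd (c ∷ τ) ≼ (⟪ τ ⟫ ++ ⟨ c ⟩ ⋆ bd τ)
  to p with ∈-bd⁻ {c ∷ τ} p
  ... | .c , here refl , refl = τ , here refl , λ z → sub (∈-rm⁻ {A = c ∷ τ} z)
    where
    sub : ∀ {z} → z ∈ c ∷ τ × z ≢ c → z ∈ τ
    sub (here refl , n) = ⊥-elim (n refl)
    sub (there z , _) = z
  ... | j , there j∈ , refl = c ∷ rm j τ , there (∈-⟨⟩⋆⁺ (∈-bd⁺ j∈)) , λ z → sub (∈-rm⁻ {A = c ∷ τ} z)
    where
    sub : ∀ {z} → z ∈ c ∷ τ × z ≢ j → z ∈ c ∷ rm j τ
    sub (here refl , n) = here refl
    sub (there z , n) = there (∈-rm⁺ z n)
  from : (⟪ τ ⟫ ++ ⟨ c ⟩ ⋆ bd τ) ≼ bd (c ∷ τ)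
  from (here refl) = _ , ∈-bd⁺ {c ∷ τ} (here refl) , λ z → ∈-rm⁺ {A = c ∷ τ} (there z) λ { refl → c∉ z }
  from (there p) with ∈-⟨⟩⋆⁻ p
  ... | _ , q , refl with ∈-bd⁻ {τ} q
  ... | j , j∈ , refl = _ , ∈-bd⁺ {c ∷ τ} (there j∈) , λ
    { (here refl) → ∈-rm⁺ {A = c ∷ τ} (here refl) (λ { refl → c∉ j∈ })
    ; (there z) → let (a , b) = ∈-rm⁻ {A = τ} z in ∈-rm⁺ {A = c ∷ τ} (there a) b }

bd-vertex : ∀ a → bd (a ∷ []) ≅ ⟪ [] ⟫
bd-vertex a = ≼-≅ to from
  where
  to : bd (a ∷ []) ≼ ⟪ [] ⟫
  to p with ∈-bd⁻ {a ∷ []} p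
  ... | .a , here refl , refl = [] , here refl , λ z → sub (∈-rm⁻ {A = a ∷ []} z)
    where
    sub : ∀ {z} → z ∈ a ∷ [] × z ≢ a → z ∈ []
    sub (here refl , n) = ⊥-elim (n refl)
  from : ⟪ [] ⟫ ≼ bd (a ∷ [])
  from (here refl) = _ , ∈-bd⁺ {a ∷ []} (here refl) , λ ()

NonEmpty-suc : ∀ {τ : List ℕ} {j} → length τ ≡ suc j → NonEmptyˢ τ
NonEmpty-suc {a ∷ _} _ = a , here refl

Uniq∷ : ∀ {c : ℕ} {τ} → c ∉ τ → Unique τ → Unique (c ∷ τ)
Uniq∷ {c} {τ} n u = All.tabulate (λ z e → n (subst (_∈ τ) (sym e) z)) ∷ u

starFacet : ∀ {Γ τ L q} → NonEmptyˢ τ → (∀ {z} → z ∈ τ → z # L) → NoFace τ Γ → q # Γ → q # L → q ∉ τ →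
  Γ ++ (⟨ q ⟩ ⋆ bd τ) ⋆ L ∼ Γ ++ ⟪ τ ⟫ ⋆ L
starFacet {Γ} {τ} {L} {q} a b c d e f = ∼-sym (subdivide {Γ} {τ} {L} {q} a b c d e f)

NoFace-cone-bd : ∀ {τ c L} → c ∉ τ → (∀ {z} → z ∈ τ → z # L) → NoFace τ ((⟨ c ⟩ ⋆ bd τ) ⋆ L)
NoFace-cone-bd {τ} {c} c∉ τ#L F∈ s with ∈-⋆⁻ F∈
... | _ , l , G∈ , l∈ , refl with ∈-⟨⟩⋆⁻ G∈
... | _ , H∈ , refl with ∈-bd⁻ {τ} H∈
... | j , j∈ , refl = bad (s j∈)
  where
  bad : j ∉ (c ∷ rm j τ) ++ l
  bad (here refl) = c∉ j∈
  bad (there z) = [ (λ a → proj₂ (∈-rm⁻ {A = τ} a) refl) , τ#L j∈ l∈ ]′ (∈-++⁻ (rm j τ) z)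

-- The cone d * ∂τ is a stellar subdivision of the simplex τ. Undoing it turns the two cones into τ
-- ∪ c * ∂τ, which is the boundary of the simplex on `c` and τ.
suspension : ∀ {τ c d L} → NonEmptyˢ τ → (∀ {z} → z ∈ τ → z # ((⟨ c ⟩ ++ ⟨ d ⟩) ⋆ L)) → ∃ (_∈ L) → c ≢ d → c # L → d # L →
  bd τ ⋆ ((⟨ c ⟩ ++ ⟨ d ⟩) ⋆ L) ∼ bd (c ∷ τ) ⋆ L
suspension {τ} {c} {d} {L} ne τ# (l , l∈) c≢d c#L d#L =
  ≅⇒∼ (solve 4 (λ t c d L → t :* ((c :+ d) :* L) := (c :* t) :* L :+ (d :* t) :* L) (λ _ → id , id) (bd τ) ⟨ c ⟩ ⟨ d ⟩ L)
  ◅◅ starFacet {(⟨ c ⟩ ⋆ bd τ) ⋆ L} {τ} {L} {d} ne τ#L (NoFace-cone-bd c∉ τ#L)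
       ((≢# (c≢d ∘ sym) ⊗ #-bd d∉) ⊗ d#L) d#L d∉
  ◅◅ ≅⇒∼ (solve 4 (λ c t s L → (c :* t) :* L :+ s :* L := (s :+ c :* t) :* L) (λ _ → id , id) ⟨ c ⟩ (bd τ) ⟪ τ ⟫ L)
  ◅◅ in-ctx [] (⟪ τ ⟫ ++ ⟨ c ⟩ ⋆ bd τ) (bd (c ∷ τ)) L (≅-sym {bd (c ∷ τ)} (bd-∷ c∉))
  where
  τ#L : ∀ {z} → z ∈ τ → z # L
  τ#L z∈ G∈ z = τ# z∈ (∈-⋆⁺ {⟨ c ⟩ ++ ⟨ d ⟩} (here refl) G∈) (there z)
  c∉ : c ∉ τ
  c∉ z = τ# z (∈-⋆⁺ {⟨ c ⟩ ++ ⟨ d ⟩} (here refl) l∈) (here refl)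
  d∉ : d ∉ τ
  d∉ z = τ# z (∈-⋆⁺ {⟨ c ⟩ ++ ⟨ d ⟩} (there (here refl)) l∈) (here refl)

cone-bd : ∀ {τ c L} → NonEmptyˢ τ → (∀ {z} → z ∈ τ → z # (⟨ c ⟩ ⋆ L)) → ∃ (_∈ L) → c # L →
  bd τ ⋆ (⟨ c ⟩ ⋆ L) ∼ ⟪ τ ⟫ ⋆ L
cone-bd {τ} {c} {L} ne τ# (l , l∈) c#L =
  ≅⇒∼ (solve 3 (λ t c L → t :* (c :* L) := (c :* t) :* L) (λ _ → id , id) (bd τ) ⟨ c ⟩ L)
  ◅◅ starFacet {[]} {τ} {L} {c} ne (λ z∈ G∈ z → τ# z∈ (∈-⟨⟩⋆⁺ G∈) (there z)) (λ ()) (λ ()) c#L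
       (λ z → τ# z (∈-⟨⟩⋆⁺ l∈) (here refl))

-- Spheres and balls inside a join

Int⇒#Sph : ∀ j {u} → n j ≤ half u → u # Sph j
Int⇒#Sph j p = ⊆V-# (Sph⊆ j) λ { l refl → <⇒≱ l p }

apex : ℕ → ℕ
apex j = e (n j)

n< : ∀ j → n j < n (suc j)
n< zero = s≤s z≤n
n< (suc j) = Lv.m<m′ j

-- The factor `L` lets the statement be applied inside joins, where `τ` need only be disjoint from
-- `L`; the standard labels are restored at the end by `relabel`.
SphereIn : Complex → ℕ → Complex → Set
SphereIn Δ d L = ∃ λ τ → length τ ≡ suc d × Unique τ × (∀ {z} → z ∈ τ → z # L) × Δ ⋆ L ∼ bd τ ⋆ L

FacetIn : Complex → ℕ → Complex → Set
FacetIn Δ d L = ∃ λ τ → length τ ≡ d × Unique τ × (∀ {z} → z ∈ τ → z # L) × Δ ⋆ L ∼ ⟪ τ ⟫ ⋆ L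

-- Once both halves are coned off, the two apices are moved into the link factor, so that the
-- induction hypothesis applies to `Sph j` alone. Then `suspension` adds one vertex to the simplex.
Sph-∼ : ∀ j L → ∃ (_∈ L) → (∀ {u} → Low (n j) u → u # L) → SphereIn (Sph j) j L
Sph-∼ zero L _ _ with fresh L
... | a , a#L = a ∷ [] , refl , (Uniq∷ (λ ()) []) , (λ { (here refl) → a#L }) ,
  in-ctx [] (Sph 0) (bd (a ∷ [])) L (≅-trans {Sph 0} {⟪ [] ⟫} {bd (a ∷ [])} Sph-zero (≅-sym {bd (a ∷ [])} (bd-vertex a)))
Sph-∼ (suc j) L (l , l∈) low with Sph-∼ j ((⟨ apex j ⟩ ++ ⟨ σ (apex j) ⟩) ⋆ L)
    (_ , ∈-⋆⁺ {⟨ apex j ⟩ ++ ⟨ σ (apex j) ⟩} (here refl) l∈)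
    (λ {u} p → (≢# (λ { refl → <⇒≢ p (half-e (n j)) }) ⊕ ≢# (λ { refl → <⇒≢ p (trans (half-σ (apex j)) (half-e (n j))) }))
                 ⊗ low (≤-trans p (n-mono j)))
... | τ , len , uniq , τ# , eq = c ∷ τ , cong suc len , Uniq∷ c∉ uniq ,
    (λ { (here refl) → c#L ; (there z) G∈ w → τ# z (∈-⋆⁺ {⟨ c ⟩ ++ ⟨ d ⟩} (here refl) G∈) (there w) }) ,
    (≅⇒∼ (solve 3 (λ b b′ L → (b :+ b′) :* L := b′ :* L :+ b :* L) (λ _ → id , id) B (ren σ B) L)
    -- The antipodal half may stay in the context: its vertices beyond the first `n j` pairs are
    -- negative, so it contains no interior vertex of `B`.
    ◅◅ Ball-conesOff j {ren σ B ⋆ L} {L}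
         (λ i → ⊆V-# {V = σBV} (ren-⊆V {W = σBV} (Ball⊆ j) (λ {u} → σBV-intro {u})) (λ p → λ { refl → σBV⇒¬Int p i }) ⊗ low (proj₂ (proj₂ i)))
         low
    ◅◅ ≅⇒∼ (solve 4 (λ b′ L c S → b′ :* L :+ (c :* S) :* L := (c :* S) :* L :+ b′ :* L) (λ _ → id , id) (ren σ B) L ⟨ c ⟩ (Sph j))
    ◅◅ ConesOff-ren σ σ-inv {V = Low (n (suc j))} {I = Int (n j) (n (suc j))} (Ball-conesOff j) {(⟨ c ⟩ ⋆ Sph j) ⋆ L} {L}
         (λ {u} (pos , k≤ , <m) → (≢# (λ { refl → o≢e (trans (sym (σ-e (n j))) pos) }) ⊗
             Int⇒#Sph j (subst (n j ≤_) (half-σ u) k≤)) ⊗ low (subst (_< n (suc j)) (half-σ u) <m))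
         (λ {u} p → low (subst (_< n (suc j)) (half-σ u) p))
    ◅◅ in-ctx ((⟨ c ⟩ ⋆ Sph j) ⋆ L) (⟨ d ⟩ ⋆ ren σ (Sph j)) (⟨ d ⟩ ⋆ Sph j) L (⋆-mono {⟨ d ⟩} {⟨ d ⟩} {ren σ (Sph j)} ≅-refl (Sph-sym j))
    ◅◅ ≅⇒∼ (solve 4 (λ c d S L → (c :* S) :* L :+ (d :* S) :* L := S :* ((c :+ d) :* L)) (λ _ → id , id) ⟨ c ⟩ ⟨ d ⟩ (Sph j) L)
    ◅◅ eq
    ◅◅ suspension (NonEmpty-suc len) τ# (l , l∈) (λ p → o≢e (trans (sym (σ-e (n j))) (sym p))) c#L d#L)
  where
  B = Ball (suc j)
  c = apex j
  d = σ c
  c#L : c # L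
  c#L = low (Low-e (n< j))
  d#L : d # L
  d#L = low (subst (_< n (suc j)) (sym (trans (half-σ c) (half-e (n j)))) (n< j))
  c∉ : c ∉ τ
  c∉ z = τ# z (∈-⋆⁺ {⟨ c ⟩ ++ ⟨ d ⟩} (here refl) l∈) (here refl)
  σBV : ℕ → Set
  σBV u = BallV (n j) (n (suc j)) (σ u)
  σBV-intro : ∀ {u} → BallV (n j) (n (suc j)) u → σBV (σ u)
  σBV-intro {u} = subst (BallV (n j) (n (suc j))) (sym (σ-inv u))
  σBV⇒¬Int : ∀ {u} → σBV u → Int (n j) (n (suc j)) u → ⊥
  σBV⇒¬Int {u} (inj₁ l) (_ , k≤ , _) = <⇒≱ (subst (_< n j) (half-σ u) l) k≤
  σBV⇒¬Int {u} (inj₂ (pos , _)) (pos′ , _) = o≢e (trans (sym (trans (cong σ pos′) (σ-e (half u)))) pos)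

Ball-∼ : ∀ j L → ∃ (_∈ L) → (∀ {u} → Low (n (suc j)) u → u # L) →
  FacetIn (Ball (suc j)) (suc j) L
Ball-∼ j L (l , l∈) low with Sph-∼ j (⟨ apex j ⟩ ⋆ L) (_ , ∈-⟨⟩⋆⁺ l∈)
    (λ p → ≢# (λ { refl → <⇒≢ p (half-e (n j)) }) ⊗ low (≤-trans p (n-mono j)))
... | τ , len , uniq , τ# , eq = τ , len , uniq , (λ z G∈ w → τ# z (∈-⟨⟩⋆⁺ G∈) (there w)) ,
  (Ball-conesOff j {[]} {L} (λ _ ()) low
  ◅◅ ≅⇒∼ (solve 3 (λ c S L → (c :* S) :* L := S :* (c :* L)) (λ _ → id , id) ⟨ apex j ⟩ (Sph j) L)
  ◅◅ eq ◅◅ cone-bd (NonEmpty-suc len) τ# (l , l∈) (low (Low-e (n< j))))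

-- Renaming vertices

-- The boundary of a vertex has only the empty face, so subdividing at the vertex `a` replaces it by
-- `b`.
rename : ∀ {a b Δ} → a ≢ b → b # Δ → Δ ∼ ren (swap a b) Δ
rename {a} {b} {Δ} a≢b b#Δ =
  ≅⇒∼ (decompose a Δ)
  ◅◅ subdivide {deletion a Δ} {a ∷ []} {link a Δ} {b} (a , here refl) (λ { (here refl) → #-link-self Δ })
       (λ F∈ s → #-deletion-self Δ F∈ (s (here refl))) (#-deletion b#Δ) (#-link b#Δ) (λ { (here p) → a≢b (sym p) })
  ◅◅ in-ctx (deletion a Δ) (⟨ b ⟩ ⋆ bd (a ∷ [])) (⟨ b ⟩ ⋆ ⟪ [] ⟫) (link a Δ) (⋆-mono {⟨ b ⟩} {⟨ b ⟩} {bd (a ∷ [])} ≅-refl (bd-vertex a))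
  ◅◅ ≅⇒∼ (solve 3 (λ D b K → D :+ (b :* con 1) :* K := D :+ b :* K) (λ _ → id , id) (deletion a Δ) ⟨ b ⟩ (link a Δ))
  ◅◅ ≅⇒∼ (≅-sym {ren (swap a b) Δ} (decompose-swap a b Δ b#Δ))

-- What simplices and boundaries of simplices share, so that relabelling is treated once for both.
record Natural (F : List ℕ → Complex) : Set where
  field
    #F : ∀ {b τ} → b ∉ τ → b # F τ
    ren-F : ∀ g → (∀ {u w} → g u ≡ g w → u ≡ w) → ∀ τ → ren g (F τ) ≡ F (map g τ)

rm-map : ∀ g → (∀ {u w} → g u ≡ g w → u ≡ w) → ∀ j τ → map g (rm j τ) ≡ rm (g j) (map g τ)
rm-map g inj j [] = refl
rm-map g inj j (a ∷ τ) with a ≟ j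
... | yes refl = trans (cong (map g) (filter-reject (λ z → ¬? (z ≟ j)) {xs = τ} (λ n → n refl)))
  (trans (rm-map g inj j τ) (sym (filter-reject (λ z → ¬? (z ≟ g j)) {xs = map g τ} (λ n → n refl))))
... | no n = trans (cong (map g) (filter-accept (λ z → ¬? (z ≟ j)) {xs = τ} n))
  (trans (cong (g a ∷_) (rm-map g inj j τ)) (sym (filter-accept (λ z → ¬? (z ≟ g j)) {xs = map g τ} (n ∘ inj))))

Natural-bd : Natural bd
Natural-bd = record { #F = #-bd ; ren-F = λ g inj τ →
  trans (sym (map-∘ τ)) (trans (map-cong (λ j → rm-map g inj j τ) τ) (map-∘ τ)) }

Natural-facet : Natural ⟪_⟫
Natural-facet = record { #F = λ { n (here refl) → n } ; ren-F = λ _ _ _ → refl }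

Disjoint : List ℕ → List ℕ → Set
Disjoint X Y = ∀ {z} → z ∈ X → z ∉ Y

module _ {F : List ℕ → Complex} (nat : Natural F) where
  open Natural nat

  replaceAll : ∀ pre {τ τ′} → length τ ≡ length τ′ → Unique τ → Unique τ′ → Disjoint τ τ′ →
    Disjoint pre τ → Disjoint pre τ′ → F (pre ++ τ) ∼ F (pre ++ τ′)
  replaceAll pre {[]} {[]} _ _ _ _ _ _ = ε
  replaceAll pre {a ∷ τ} {b ∷ τ′} len (a∉ ∷ u) (b∉ ∷ u′) d dp dp′ =
    subst (F (pre ++ a ∷ τ) ∼_) eq (rename (λ { refl → d (here refl) (here refl) }) (#F b∉all))
    ◅◅ subst₂ (λ X Y → F X ∼ F Y) (++-assoc pre (b ∷ []) τ) (++-assoc pre (b ∷ []) τ′)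
         (replaceAll (pre ++ b ∷ []) (suc-injective len) u u′ (λ z w → d (there z) (there w))
           (λ z → [ (λ p w → dp p (there w)) , (λ { (here refl) w → d (there w) (here refl) }) ]′ (∈-++⁻ pre z))
           (λ z → [ (λ p w → dp′ p (there w)) , (λ { (here refl) w → All.lookup b∉ w refl }) ]′ (∈-++⁻ pre z)))
    where
    b∉all : b ∉ pre ++ a ∷ τ
    b∉all z = [ (λ p → dp′ p (here refl)) , (λ p → d p (here refl)) ]′ (∈-++⁻ pre z)
    swap-inj : ∀ {u w} → swap a b u ≡ swap a b w → u ≡ w
    swap-inj {u} {w} p = trans (sym (swap-inv a b u)) (trans (cong (swap a b) p) (swap-inv a b w))
    fixed : ∀ X → a ∉ X → b ∉ X → map (swap a b) X ≡ X
    fixed X p q = map-id-local (All.tabulate λ z → swap-other (λ { refl → p z }) (λ { refl → q z }))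
    eq : ren (swap a b) (F (pre ++ a ∷ τ)) ≡ F (pre ++ b ∷ τ)
    eq = trans (ren-F (swap a b) swap-inj _) (cong F (trans (map-++ (swap a b) pre (a ∷ τ))
      (cong₂ _++_ (fixed pre (λ z → dp z (here refl)) (λ z → dp′ z (here refl)))
        (cong₂ _∷_ (swap-h a b) (fixed τ (λ z → All.lookup a∉ z refl) (λ z → b∉all (∈-++⁺ʳ pre (there z))))))))

  -- The two lists may overlap whereas `replaceAll` needs disjoint ones, so the renaming passes
  -- through labels larger than all those in `τ` and `τ′`.
  relabel : ∀ {τ τ′} → length τ ≡ length τ′ → Unique τ → Unique τ′ → F τ ∼ F τ′
  relabel {τ} {τ′} len u u′ =
    replaceAll [] {τ} {far} (sym (trans (length-map _ (upTo (length τ))) (length-upTo (length τ)))) u far-unique (λ z w → far# (∈-++⁺ˡ z) w) (λ ()) (λ ())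
    ◅◅ replaceAll [] {far} {τ′} (trans (trans (length-map _ (upTo (length τ))) (length-upTo (length τ))) len) far-unique u′
         (λ w z → far# (∈-++⁺ʳ τ z) w) (λ ()) (λ ())
    where
    N = suc (sum (τ ++ τ′))
    far = map (N +_) (upTo (length τ))
    far-unique : Unique far
    far-unique = Unique.map⁺ (+-cancelˡ-≡ N _ _) (Unique.upTo⁺ (length τ))
    far# : Disjoint (τ ++ τ′) far
    far# z w with ∈-map⁻ (N +_) w
    ... | i , _ , refl = <⇒≱ (s≤s (∈⇒≤sum z)) (m≤m+n N i)

-- From stellar equivalence to PL homeomorphism

HasVertex : Complex → Set
HasVertex Δ = ∃ (_∈V Δ)

stellar-≅ : ∀ {Δ Γ Δ′} → Δ ≅ Γ → StellarSubdivision Γ Δ′ → StellarSubdivision Δ Δ′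
stellar-≅ p (A , a , A∈ , ne , a∉ , eq) = A , a , proj₂ (p A) A∈ , ne , (a∉ ∘ proj₁ (p (a ∷ []))) ,
  λ X → (λ f → [ (λ (f , n) → inj₁ (proj₂ (p X) f , n)) , (λ (Y , s , f , n) → inj₂ (Y , s , proj₂ (p (Y ++ A)) f , n)) ]′ (proj₁ (eq X) f)) ,
        (λ c → proj₂ (eq X) ([ (λ (f , n) → inj₁ (proj₁ (p X) f , n)) , (λ (Y , s , f , n) → inj₂ (Y , s , proj₁ (p (Y ++ A)) f , n)) ]′ c))

-- A stellar subdivision depends only on the faces, so subdividing either complex at a common vertex
-- `a` gives the same complex. One subdivision and one inverse then connect the two.
≅⇒PL : ∀ {Δ Γ} → HasVertex Δ → Δ ≅ Γ → PLHomeomorphic Δ Γ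
≅⇒PL {Δ} {Γ} (a , F , F∈ , s) p = fwd (stellar-≅ (decompose a Δ) stellar) ◅
  bwd (stellar-≅ (≅-trans {Γ} {Δ} {deletion a Δ ++ ⟨ a ⟩ ⋆ link a Δ} (≅-sym {Δ} p) (decompose a Δ)) stellar) ◅ ε
  where
  b = proj₁ (fresh (Δ ++ ⟨ a ⟩))
  b# : b # (Δ ++ ⟨ a ⟩)
  b# = proj₂ (fresh (Δ ++ ⟨ a ⟩))
  b#Δ : b # Δ
  b#Δ = #-++ˡ b#
  stellar = stellarSubdivision {deletion a Δ} {a ∷ []} {link a Δ} {b} (a , here refl)
    (_ , ∈-map⁺ (rm a) (∈-filter⁺ (a ∈?_) F∈ (s (here refl)))) (λ { (here refl) → #-link-self Δ })
    (λ F∈ s → #-deletion-self Δ F∈ (s (here refl))) (#-deletion b#Δ) (#-link b#Δ)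
    (λ { (here q) → #⟨⟩⇒≢ (#-++ʳ Δ b#) q })

HasVertex-stellar : ∀ {Δ Δ′} → StellarSubdivision Δ Δ′ → HasVertex Δ × HasVertex Δ′
HasVertex-stellar {Δ} (A , a , (F , F∈ , s) , (z , z∈) , _ , eq) =
  (z , F , F∈ , λ { (here refl) → s z∈ }) ,
  (a , proj₂ (eq (a ∷ [])) (inj₂ ([] , (id , id) , (F , F∈ , s) , λ t → no-[] (t z∈))))
  where
  no-[] : ∀ {z : ℕ} → z ∉ []
  no-[] ()

-- Every move preserves the existence of a vertex, so each step that is a mere equality of faces can
-- be replaced by `≅⇒PL`.
∼⇒PL : ∀ {Δ Γ} → HasVertex Δ → Δ ∼ Γ → PLHomeomorphic Δ Γ
∼⇒PL h ε = ε
∼⇒PL (a , f) (fwd (inj₁ p) ◅ r) = ≅⇒PL (a , f) p ◅◅ ∼⇒PL (a , proj₁ (p (a ∷ [])) f) r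
∼⇒PL {Δ} (a , f) (_◅_ {j = Γ} (bwd (inj₁ p)) r) = ≅⇒PL (a , f) (≅-sym {Γ} {Δ} p) ◅◅ ∼⇒PL (a , proj₂ (p (a ∷ [])) f) r
∼⇒PL h (fwd (inj₂ s) ◅ r) = fwd s ◅ ∼⇒PL (proj₂ (HasVertex-stellar s)) r
∼⇒PL h (bwd (inj₂ s) ◅ r) = bwd s ◅ ∼⇒PL (proj₁ (HasVertex-stellar s)) r

-- Finite sets as duplicate-free lists

length-mono : ∀ {X Y : List ℕ} → Unique X → X ⊆ Y → length X ≤ length Y
length-mono {[]} _ _ = z≤n
length-mono {a ∷ X} {Y} (a∉ ∷ u) s = ≤-trans (s≤s (length-mono {X} {rm a Y} u
    λ z → ∈-rm⁺ {A = Y} (s (there z)) λ { refl → All.lookup a∉ z refl }))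
  (filter-notAll (λ z → ¬? (z ≟ a)) Y (lose (s (here refl)) (λ n → n refl)))

⊆-antisym : ∀ {X Y : List ℕ} → Unique X → length X ≡ length Y → X ⊆ Y → Y ⊆ X
⊆-antisym {X} {Y} u len s {y} y∈ with y ∈? X
... | yes p = p
... | no n = ⊥-elim (<-irrefl len (length-mono {y ∷ X} (Uniq∷ n u) (λ { (here refl) → y∈ ; (there z) → s z })))

missing : ∀ {X Y : List ℕ} → Unique Y → length X < length Y → ∃ λ y → y ∈ Y × y ∉ X
missing {X} {Y} u l = ⊈⇒∃ Y λ s → <⇒≱ l (length-mono u s)

-- Facets

-- Here `d` counts vertices, so the dimension is one less.
Pure : ℕ → Complex → Set
Pure d Δ = ∀ {F} → F ∈ Δ → length F ≡ d × Unique F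

-- The facet across the ridge of `F` without `u`. When the facets of `Δ` have one vertex less than
-- `F`, it says instead that this ridge is itself a facet of `Δ`.
Opposite : List ℕ → ℕ → Complex → Set
Opposite F u Δ = ∃ λ F′ → F′ ∈ Δ × (∀ {z} → z ∈ F → z ≢ u → z ∈ F′) × u ∉ F′

Closed : Complex → Set
Closed Δ = ∀ {F u} → F ∈ Δ → u ∈ F → Opposite F u Δ

module _ {g : ℕ → ℕ} (inj : ∀ {u w} → g u ≡ g w → u ≡ w) where

  ∈-map-inj : ∀ {u F} → g u ∈ map g F → u ∈ F
  ∈-map-inj {F = F} p with ∈-map⁻ g p
  ... | w , w∈ , e = subst (_∈ F) (sym (inj e)) w∈

  Pure-ren : ∀ {d Δ} → Pure d Δ → Pure d (ren g Δ)
  Pure-ren pure F∈ with ∈-map⁻ (map g) F∈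
  ... | F , F∈′ , refl = trans (length-map g F) (proj₁ (pure F∈′)) , Unique.map⁺ inj (proj₂ (pure F∈′))

  Opposite-ren : ∀ {F u Δ} → Opposite F u Δ → Opposite (map g F) (g u) (ren g Δ)
  Opposite-ren {F} {u} (F′ , F′∈ , s , n) = map g F′ , ∈-map⁺ (map g) F′∈ , sub , n ∘ ∈-map-inj
    where
    sub : ∀ {z} → z ∈ map g F → z ≢ g u → z ∈ map g F′
    sub z≢ with ∈-map⁻ g z≢
    ... | w , w∈ , refl = λ n → ∈-map⁺ g (s w∈ (n ∘ cong g))

  Closed-ren : ∀ {Δ} → Closed Δ → Closed (ren g Δ)
  Closed-ren closed F∈ u∈ with ∈-map⁻ (map g) F∈
  ... | F , F∈′ , refl with ∈-map⁻ g u∈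
  ... | u , u∈′ , refl = Opposite-ren (closed F∈′ u∈′)

⊆-restore : ∀ {F F′ : List ℕ} {u} → (∀ {z} → z ∈ F → z ≢ u → z ∈ F′) → u ∈ F′ → F ⊆ F′
⊆-restore {u = u} s u∈ {z} z∈ with z ≟ u
... | yes refl = u∈
... | no n = s z∈ n

Opposite-mono : ∀ {F u Δ Γ} → (∀ {G} → G ∈ Δ → G ∈ Γ) → Opposite F u Δ → Opposite F u Γ
Opposite-mono f (F′ , F′∈ , s) = F′ , f F′∈ , s

-- Facets and ridges of the collar

module CollarFacets (m : ℕ) where
  open Collar m

  sw-inj : ∀ i {u w} → sw i u ≡ sw i w → u ≡ w
  sw-inj i {u} {w} p = trans (sym (swap-inv (o i) (x i) u)) (trans (cong (sw i) p) (swap-inv (o i) (x i) w))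

  ρ-inj : ∀ i {u w} → ρ i u ≡ ρ i w → u ≡ w
  ρ-inj i {u} {w} p = trans (sym (ρ⁻¹ρ i u)) (trans (cong (ρ⁻¹ i) p) (ρ⁻¹ρ i w))

  -- A one-way substitution instead of the transposition `sw i`: a collar facet may contain both
  -- `x i` and `o i`, and both must go to `o i`.
  back : ℕ → ℕ → ℕ
  back i u with u ≟ x i
  ... | yes _ = o i
  ... | no _ = u

  back-x : ∀ i → back i (x i) ≡ o i
  back-x i with x i ≟ x i
  ... | yes _ = refl
  ... | no n = ⊥-elim (n refl)

  back-other : ∀ i {u} → u ≢ x i → back i u ≡ u
  back-other i {u} n with u ≟ x i
  ... | yes p = ⊥-elim (n p)
  ... | no _ = refl

  π : ℕ → ℕ → ℕ
  π zero u = u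
  π (suc i) u = back i (π i u)

  π-other : ∀ i {u} → (∀ {j} → j < i → u ≢ x j) → π i u ≡ u
  π-other zero n = refl
  π-other (suc i) n = trans (cong (back i) (π-other i λ l → n (m≤n⇒m≤1+n l))) (back-other i (n ≤-refl))

  π-x : ∀ i {j} → j < i → π i (x j) ≡ o j
  π-x (suc i) {j} (s≤s j≤i) with m≤n⇒m<n∨m≡n j≤i
  ... | inj₁ l = trans (cong (back i) (π-x i l)) (back-other i o≢e)
  ... | inj₂ refl = trans (cong (back i) (π-other i λ l p → <⇒≢ l (sym (x-inj p)))) (back-x i)

  NoH : ℕ → List ℕ → Set
  NoH i F = ∀ {j} → j < i → o j ∉ F

  map-fixed : ∀ {g : ℕ → ℕ} {F} → (∀ {z} → z ∈ F → g z ≡ z) → map g F ≡ F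
  map-fixed f = map-id-local (All.tabulate f)

  sw-fixed : ∀ {i S F} → Fresh (suc i) S → F ∈ S → o i ∉ F → map (sw i) F ≡ F
  sw-fixed fr F∈ n = map-fixed λ z → swap-other (λ { refl → n z }) (λ { refl → fr ≤-refl F∈ z })

  ρ-fixed : ∀ i {S F} → Fresh i S → F ∈ S → NoH i F → map (ρ i) F ≡ F
  ρ-fixed i fr F∈ n = map-fixed λ z → ρ-other i λ l → (λ { refl → n l z }) , (λ { refl → fr l F∈ z })

  data CollarView (S : Complex) (i : ℕ) : List ℕ → Set where
    first : ∀ {G} → G ∈ S → o i ∈ G → CollarView S i (x i ∷ G)
    later : ∀ {F} → F ∈ collar (ren (sw i) S) i → CollarView S i F

  collarView : ∀ {S i F} → F ∈ collar S (suc i) → CollarView S i F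
  collarView {S} {i} p with ∈-++⁻ (⟨ x i ⟩ ⋆ star (o i) S) p
  ... | inj₂ q = later q
  ... | inj₁ q with ∈-⟨⟩⋆⁻ q
  ... | G , r , refl = let (G∈ , h∈) = ∈-star⁻ {o i} {S} r in first G∈ h∈

  first⁺ : ∀ {S i G} → G ∈ S → o i ∈ G → (x i ∷ G) ∈ collar S (suc i)
  first⁺ {i = i} G∈ h∈ = ∈-++⁺ˡ (∈-⟨⟩⋆⁺ (∈-filter⁺ (o i ∈?_) G∈ h∈))

  later⁺ : ∀ {S i F} → F ∈ collar (ren (sw i) S) i → F ∈ collar S (suc i)
  later⁺ {S} {i} = ∈-++⁺ʳ (⟨ x i ⟩ ⋆ star (o i) S)

  ∈-sw⁺ : ∀ {S i G} → G ∈ S → map (sw i) G ∈ ren (sw i) S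
  ∈-sw⁺ {i = i} = ∈-map⁺ (map (sw i))

  ∈-sw-fixed : ∀ {i S F} → Fresh (suc i) S → F ∈ S → o i ∉ F → F ∈ ren (sw i) S
  ∈-sw-fixed {i} {S} fr F∈ n = subst (_∈ ren (sw i) S) (sw-fixed fr F∈ n) (∈-sw⁺ {S} {i} F∈)

  map-sw⊆ : ∀ {i S G} → Fresh (suc i) S → G ∈ S → map (sw i) G ⊆ x i ∷ G
  map-sw⊆ {i} {G = G} fr G∈ z with ∈-map⁻ (sw i) z
  ... | u , u∈ , refl with u ≟ o i
  ... | yes refl = here refl
  ... | no n with u ≟ x i
  ... | yes refl = ⊥-elim (fr ≤-refl G∈ u∈)
  ... | no k = there u∈

  h#-later : ∀ {S i} → Fresh (suc i) S → o i # collar (ren (sw i) S) i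
  h#-later {i = i} fr = #-collar i (Fresh-sw fr) (h#-sw fr) (λ _ → o≢e)

  collar-proj : ∀ i {S F} → Fresh i S → F ∈ collar S i → ∃ λ G → G ∈ S × (∀ {z} → z ∈ F → π i z ∈ G)
  collar-proj (suc i) {S} fr F∈ with collarView F∈
  ... | first {G} G∈ h∈ = G , G∈ , λ
    { (here refl) → subst (_∈ G) (sym (π-x (suc i) ≤-refl)) h∈
    ; (there z) → subst (_∈ G) (sym (π-other (suc i) λ { l refl → fr l G∈ z })) z }
  ... | later q with collar-proj i (Fresh-sw fr) q
  ... | _ , p , s with ∈-map⁻ (map (sw i)) p
  ... | G , G∈ , refl = G , G∈ , λ z → unsw (s z)
    where
    unsw : ∀ {u} → u ∈ map (sw i) G → back i u ∈ G
    unsw u∈ with ∈-map⁻ (sw i) u∈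
    ... | w , w∈ , refl with w ≟ o i
    ... | yes refl = subst (_∈ G) (sym (back-x i)) w∈
    ... | no n with w ≟ x i
    ... | yes refl = ⊥-elim (fr ≤-refl G∈ w∈)
    ... | no k = subst (_∈ G) (sym (back-other i k)) w∈

  collar-pure : ∀ i {S d} → Fresh i S → Pure d S → Pure (suc d) (collar S i)
  collar-pure (suc i) {S} fr pure F∈ with collarView F∈
  ... | first G∈ h∈ = cong suc (proj₁ (pure G∈)) , Uniq∷ (fr ≤-refl G∈) (proj₂ (pure G∈))
  ... | later q = collar-pure i (Fresh-sw fr) (Pure-ren (sw-inj i) pure) q

  -- For the largest `i` with `o i` in `G`, the facet above `G` is `x i ∷ G`. A facet without
  -- replaced vertices belongs to both the bottom and the top of the collar.
  collar-bottom : ∀ i {S G} → Fresh i S → G ∈ S → (∃ λ F → F ∈ collar S i × G ⊆ F) ⊎ NoH i G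
  collar-bottom zero fr G∈ = inj₂ λ ()
  collar-bottom (suc i) {S} {G} fr G∈ with o i ∈? G
  ... | yes h∈ = inj₁ (x i ∷ G , first⁺ G∈ h∈ , there)
  ... | no n with collar-bottom i (Fresh-sw fr) (∈-sw-fixed fr G∈ n)
  ... | inj₁ (F , F∈ , s) = inj₁ (F , later⁺ F∈ , s)
  ... | inj₂ k = inj₂ λ { (s≤s j≤i) z → [ (λ l → k l z) , (λ { refl → n z }) ]′ (m≤n⇒m<n∨m≡n j≤i) }

  map-ρ-suc : ∀ i G → map (ρ i) (map (sw i) G) ≡ map (ρ (suc i)) G
  map-ρ-suc i G = sym (map-∘ G)

  -- Dually, the smallest replaced index decides, because it is replaced last.
  collar-top : ∀ i {S G} → Fresh i S → G ∈ S → (∃ λ F → F ∈ collar S i × map (ρ i) G ⊆ F) ⊎ NoH i G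
  collar-top zero fr G∈ = inj₂ λ ()
  collar-top (suc i) {S} {G} fr G∈ with collar-top i (Fresh-sw fr) (∈-sw⁺ {S} {i} G∈)
  ... | inj₁ (F , F∈ , s) = inj₁ (F , later⁺ F∈ , subst (_⊆ F) (map-ρ-suc i G) s)
  ... | inj₂ k with o i ∈? G
  ... | yes h∈ = inj₁ (x i ∷ G , first⁺ G∈ h∈ , subst (_⊆ x i ∷ G)
          (trans (sym (ρ-fixed i (Fresh-sw fr) (∈-sw⁺ {S} {i} G∈) k)) (map-ρ-suc i G)) (map-sw⊆ fr G∈))
  ... | no n = inj₂ λ { (s≤s j≤i) z → [ (λ l → k l (subst (_ ∈_) (sym (sw-fixed fr G∈ n)) z)) , (λ { refl → n z }) ]′ (m≤n⇒m<n∨m≡n j≤i) }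

  -- In the layer at `x i`, dropping `x i` leaves a bottom facet, dropping `o i` leads to a later
  -- layer or to the top, and dropping any other vertex stays in the layer because `S` has no
  -- boundary.
  collar-opposite : ∀ i {S F u} → Fresh i S → Closed S → F ∈ collar S i → u ∈ F →
    Opposite F u (collar S i) ⊎ Opposite F u S ⊎ Opposite F u (ren (ρ i) S)
  collar-opposite (suc i) {S} {F} {u} fr closed F∈ u∈ with collarView F∈
  collar-opposite (suc i) {S} fr closed F∈ (here refl) | first {G} G∈ h∈ =
    inj₂ (inj₁ (G , G∈ , (λ { (here refl) n → ⊥-elim (n refl) ; (there z) _ → z }) , fr ≤-refl G∈))
  collar-opposite (suc i) {S} {_} {u} fr closed F∈ (there u∈) | first {G} G∈ h∈ with u ≟ o i
  ... | no n with closed G∈ u∈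
  ... | G′ , G′∈ , s , u∉ = inj₁ (x i ∷ G′ , first⁺ G′∈ (s h∈ (n ∘ sym)) ,
        (λ { (here refl) _ → here refl ; (there z) k → there (s z k) }) ,
        λ { (here refl) → fr ≤-refl G∈ u∈ ; (there z) → u∉ z })
  collar-opposite (suc i) {S} {_} {u} fr closed F∈ (there u∈) | first {G} G∈ h∈ | yes refl
    with collar-bottom i (Fresh-sw fr) (∈-sw⁺ {S} {i} G∈)
  ... | inj₁ (F′ , F′∈ , s) = inj₁ (F′ , later⁺ F′∈ , (λ z n → s (sub z n)) , h#-later fr F′∈)
    where
    sub : ∀ {z} → z ∈ x i ∷ G → z ≢ o i → z ∈ map (sw i) G
    sub (here refl) _ = subst (_∈ map (sw i) G) (swap-h (o i) (x i)) (∈-map⁺ (sw i) h∈)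
    sub (there z) n = subst (_∈ map (sw i) G) (swap-other n λ { refl → fr ≤-refl G∈ z }) (∈-map⁺ (sw i) z)
  ... | inj₂ k = inj₂ (inj₂ (map (sw i) G , top , sub , h#-sw fr (∈-sw⁺ {S} {i} G∈)))
    where
    top : map (sw i) G ∈ ren (ρ (suc i)) S
    top = subst (_∈ ren (ρ (suc i)) S) (trans (sym (map-ρ-suc i G)) (ρ-fixed i (Fresh-sw fr) (∈-sw⁺ {S} {i} G∈) k))
      (∈-map⁺ (map (ρ (suc i))) G∈)
    sub : ∀ {z} → z ∈ x i ∷ G → z ≢ o i → z ∈ map (sw i) G
    sub (here refl) _ = subst (_∈ map (sw i) G) (swap-h (o i) (x i)) (∈-map⁺ (sw i) h∈)
    sub (there z) n = subst (_∈ map (sw i) G) (swap-other n λ { refl → fr ≤-refl G∈ z }) (∈-map⁺ (sw i) z)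
  collar-opposite (suc i) {S} {F} {u} fr closed F∈ u∈ | later q
    with collar-opposite i (Fresh-sw fr) (Closed-ren (sw-inj i) closed) q u∈
  ... | inj₁ opp = inj₁ (Opposite-mono (later⁺ {S} {i}) opp)
  ... | inj₂ (inj₂ opp) = inj₂ (inj₂ (subst (Opposite F u) (sym (ren-ρ-suc i S)) opp))
  ... | inj₂ (inj₁ (_ , p , s , u∉)) with ∈-map⁻ (map (sw i)) p
  -- A ridge at the bottom of the later layers is a facet of `S` if `G` avoids `o i`; otherwise it
  -- is the top of the layer at `x i`.
  ... | G , G∈ , refl with o i ∈? G
  ... | no n = inj₂ (inj₁ (G , G∈ , (λ z k → subst (_ ∈_) (sw-fixed fr G∈ n) (s z k)) ,
                           λ z → u∉ (subst (u ∈_) (sym (sw-fixed fr G∈ n)) z)))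
  ... | yes h∈ = inj₁ (x i ∷ G , first⁺ G∈ h∈ , (λ z k → map-sw⊆ fr G∈ (s z k)) , λ
    { (here refl) → u∉ (subst (_∈ map (sw i) G) (swap-h (o i) (x i)) (∈-map⁺ (sw i) h∈))
    ; (there z) → u∉ (subst (_∈ map (sw i) G) (swap-other (λ { refl → h#-later fr q u∈ }) λ { refl → fr ≤-refl G∈ z }) (∈-map⁺ (sw i) z)) })

  -- This keeps the collar and the cones over `P` and `Q` from containing the same facet of `S`: a
  -- facet of `S` inside such a cone has no replaced vertex.
  collar-over : ∀ i {S d G F} → Fresh i S → Pure d S → G ∈ S → F ∈ collar S i → G ⊆ F → ∃ λ j → j < i × o j ∈ G
  collar-over (suc i) {S} {d} {G} fr pure G∈ F∈ s with collarView F∈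
  ... | first {G₀} G₀∈ h∈ = i , ≤-refl , ⊆-antisym (proj₂ (pure G∈)) (trans (proj₁ (pure G∈)) (sym (proj₁ (pure G₀∈)))) (strip s) h∈
    where
    strip : G ⊆ x i ∷ G₀ → G ⊆ G₀
    strip s z with s z
    ... | here refl = ⊥-elim (fr ≤-refl G∈ z)
    ... | there w = w
  ... | later q with o i ∈? G
  ... | yes h∈ = i , ≤-refl , h∈
  ... | no n with collar-over i (Fresh-sw fr) (Pure-ren (sw-inj i) pure) (∈-sw-fixed fr G∈ n) q s
  ... | j , l , h∈ = j , m≤n⇒m≤1+n l , h∈

  collar-unique : ∀ i {S d G F F′} → Fresh i S → Pure d S → G ∈ S → F ∈ collar S i → F′ ∈ collar S i →
    G ⊆ F → G ⊆ F′ → F ⊆ F′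
  collar-unique (suc i) {S} {d} {G} {F} {F′} fr pure G∈ F∈ F′∈ s s′ = cases (collarView F∈) (collarView F′∈) s s′
    where
    full : ∀ {G₀} → G₀ ∈ S → G ⊆ x i ∷ G₀ → G₀ ⊆ G
    full {G₀} G₀∈ s = ⊆-antisym (proj₂ (pure G∈)) (trans (proj₁ (pure G∈)) (sym (proj₁ (pure G₀∈)))) strip
      where
      strip : G ⊆ G₀
      strip z with s z
      ... | here refl = ⊥-elim (fr ≤-refl G∈ z)
      ... | there w = w
    cases : ∀ {F F′} → CollarView S i F → CollarView S i F′ → G ⊆ F → G ⊆ F′ → F ⊆ F′
    cases (first G₀∈ _) (first G₁∈ h∈) s s′ (here refl) = here refl
    cases (first G₀∈ _) (first G₁∈ h∈) s s′ (there z) = s′ (full G₀∈ s z)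
    cases (first G₀∈ h∈) (later q) s s′ = ⊥-elim (h#-later fr q (s′ (full G₀∈ s h∈)))
    cases (later q) (first G₀∈ h∈) s s′ = ⊥-elim (h#-later fr q (s (full G₀∈ s′ h∈)))
    cases (later q) (later q′) s s′ = collar-unique i (Fresh-sw fr) (Pure-ren (sw-inj i) pure)
      (∈-sw-fixed fr G∈ (λ z → h#-later fr q (s z))) q q′ s s′

-- The boundary of the balls

-- The statement that `S₀` is the boundary of `B`, phrased through facets and ridges so that it can
-- be carried through the induction. By `opposite`, a ridge in only one facet lies in `S₀`, and
-- `unique` gives the converse. The intersection of `B` with its antipode is found from `full`, and
-- `closed` serves the facets of v * y * R.
record Facets (k m d : ℕ) (B S₀ : Complex) : Set where
  field
    pureB : Pure (suc d) B
    pureS₀ : Pure d S₀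
    symS₀ : ∀ {G} → G ∈ S₀ → map σ G ∈ S₀
    full : ∀ {X} → Face B X → (∀ {z} → z ∈ X → half z < k) → Face S₀ X
    cover : ∀ {G} → G ∈ S₀ → Face B G
    opposite : ∀ {F u} → F ∈ B → u ∈ F → Opposite F u B ⊎ Opposite F u S₀
    unique : ∀ {G F F′} → G ∈ S₀ → F ∈ B → F′ ∈ B → G ⊆ F → G ⊆ F′ → F ⊆ F′
    closed : Closed S₀
    positive : ∀ {w} → Positive w → half w < m → Face B (w ∷ [])
    low : ∀ {w} → half w < k → Face S₀ (w ∷ [])
    inhabited : ∃ (_∈ S₀)

σ-inj : ∀ {u w} → σ u ≡ σ w → u ≡ w
σ-inj {u} {w} p = trans (sym (σ-inv u)) (trans (cong σ p) (σ-inv w))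

open Relabel σ σ-inv using () renaming (map-inv to map-σσ; Face-ren to Face-σ; Face-ren⁻ to Face-σ⁻)

-- Facets and ridges of the next ball

module LevelFacets (m k : ℕ) (k≤m : k ≤ m) (B S₀ : Complex) (B⊆ : B ⊆V BallV k m) (S₀⊆ : S₀ ⊆V Low k)
                   {d : ℕ} (facts : Facets k m d B S₀) where
  open Level m k k≤m B S₀ B⊆ S₀⊆ public
  open CollarFacets m public
  open Facets facts

  data BallView : List ℕ → Set where
    inC : ∀ {F} → F ∈ C → BallView F
    inP : ∀ {G} → G ∈ B → BallView (v ∷ map (ρ k) G)
    inR : ∀ {G} → G ∈ S₀ → BallView (v ∷ y ∷ map (ρ k) G)
    inQ : ∀ {G} → G ∈ ren σ B → BallView (y ∷ map (ρ k) G)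

  ballView : ∀ {F} → F ∈ ball → BallView F
  ballView p with ∈-++⁻ C p
  ... | inj₁ q = inC q
  ... | inj₂ p with ∈-++⁻ (⟨ v ⟩ ⋆ P) p
  ... | inj₁ q with ∈-⟨⟩⋆⁻ q
  ... | _ , r , refl with ∈-map⁻ (map (ρ k)) r
  ... | G , G∈ , refl = inP G∈
  ballView p | inj₂ p₁ | inj₂ p₂ with ∈-++⁻ (⟨ v ⟩ ⋆ ⟨ y ⟩ ⋆ R) p₂
  ... | inj₁ q with ∈-⟨⟩⋆⁻ q
  ... | _ , r , refl with ∈-⟨⟩⋆⁻ r
  ... | _ , s , refl with ∈-map⁻ (map (ρ k)) s
  ... | G , G∈ , refl = inR G∈
  ballView p | inj₂ p₁ | inj₂ p₂ | inj₂ q with ∈-⟨⟩⋆⁻ q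
  ... | _ , r , refl with ∈-map⁻ (map (ρ k)) r
  ... | G , G∈ , refl = inQ G∈

  C⁺ : ∀ {F} → F ∈ C → F ∈ ball
  C⁺ = ∈-++⁺ˡ

  P⁺ : ∀ {G} → G ∈ B → (v ∷ map (ρ k) G) ∈ ball
  P⁺ G∈ = ∈-++⁺ʳ C (∈-++⁺ˡ (∈-⟨⟩⋆⁺ (∈-map⁺ (map (ρ k)) G∈)))

  R⁺ : ∀ {G} → G ∈ S₀ → (v ∷ y ∷ map (ρ k) G) ∈ ball
  R⁺ G∈ = ∈-++⁺ʳ C (∈-++⁺ʳ (⟨ v ⟩ ⋆ P) (∈-++⁺ˡ (∈-⟨⟩⋆⁺ (∈-⟨⟩⋆⁺ (∈-map⁺ (map (ρ k)) G∈)))))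

  Q⁺ : ∀ {G} → G ∈ ren σ B → (y ∷ map (ρ k) G) ∈ ball
  Q⁺ G∈ = ∈-++⁺ʳ C (∈-++⁺ʳ (⟨ v ⟩ ⋆ P) (∈-++⁺ʳ (⟨ v ⟩ ⋆ ⟨ y ⟩ ⋆ R) (∈-⟨⟩⋆⁺ (∈-map⁺ (map (ρ k)) G∈))))

  B⇒S : ∀ {G} → G ∈ B → G ∈ S
  B⇒S = ∈-++⁺ˡ

  σB⇒S : ∀ {G} → G ∈ ren σ B → G ∈ S
  σB⇒S = ∈-++⁺ʳ B

  pureσB : Pure (suc d) (ren σ B)
  pureσB = Pure-ren σ-inj pureB

  pureS : Pure (suc d) S
  pureS F∈ = [ pureB , pureσB ]′ (∈-++⁻ B F∈)

  FaceS₀-σ : ∀ {X} → Face S₀ (map σ X) → Face S₀ X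
  FaceS₀-σ {X} (F , F∈ , s) = map σ F , symS₀ F∈ , Relabel.⊆-map⇐ σ σ-inv s

  σfull : ∀ {X} → Face (ren σ B) X → (∀ {z} → z ∈ X → half z < k) → Face S₀ X
  σfull {X} f l = FaceS₀-σ (full (Face-σ⁻ f) l′)
    where
    l′ : ∀ {z} → z ∈ map σ X → half z < k
    l′ z with ∈-map⁻ σ z
    ... | w , w∈ , refl = subst (_< k) (sym (half-σ w)) (l w∈)

  σcover : ∀ {G} → G ∈ S₀ → Face (ren σ B) G
  σcover {G} G∈ = subst (Face (ren σ B)) (map-σσ G) (Face-σ (cover (symS₀ G∈)))

  symS₀-ren : ∀ {G} → G ∈ ren σ S₀ → G ∈ S₀
  symS₀-ren p with ∈-map⁻ (map σ) p
  ... | G , G∈ , refl = symS₀ G∈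

  σopposite : ∀ {F u} → F ∈ ren σ B → u ∈ F → Opposite F u (ren σ B) ⊎ Opposite F u S₀
  σopposite F∈ u∈ with ∈-map⁻ (map σ) F∈
  ... | F , F∈′ , refl with ∈-map⁻ σ u∈
  ... | u , u∈′ , refl with opposite F∈′ u∈′
  ... | inj₁ opp = inj₁ (Opposite-ren σ-inj opp)
  ... | inj₂ opp = inj₂ (Opposite-mono symS₀-ren (Opposite-ren σ-inj opp))

  Low-σ : ∀ {a u} → half u < a → half (σ u) < a
  Low-σ {a} {u} = subst (_< a) (sym (half-σ u))

  -- No common vertex is interior, because interior vertices of `B` are positive and those of its
  -- antipode negative; `full` does the rest.
  both⇒S₀ : ∀ {X} → Face B X → Face (ren σ B) X → Face S₀ X
  both⇒S₀ {X} f@(F , F∈ , s) (F′ , F′∈ , s′) = full f λ z → lowk (B⊆ F∈ (s z)) (σBV F′∈ (s′ z))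
    where
    σBV : ∀ {F u} → F ∈ ren σ B → u ∈ F → BallV k m (σ u)
    σBV F∈ u∈ with ∈-ren⁻ {σ} {B} F∈ u∈
    ... | G , w , G∈ , w∈ , refl = subst (BallV k m) (sym (σ-inv w)) (B⊆ G∈ w∈)
    lowk : ∀ {u} → BallV k m u → BallV k m (σ u) → half u < k
    lowk (inj₁ l) _ = l
    lowk {u} (inj₂ _) (inj₁ l) = subst (_< k) (half-σ u) l
    lowk {u} (inj₂ (p , _)) (inj₂ (q , _)) = ⊥-elim (o≢e (trans (sym (trans (cong σ p) (σ-e (half u)))) q))

  ρ-low : ∀ {z} → half z < m → half (ρ k z) < m → ρ k z ≡ z
  ρ-low {z} l l′ with view z
  ... | inj₁ p = trans (cong (ρ k) p) (trans (ρ-e (m≤n⇒m≤o+n 2 l)) (sym p))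
  ... | inj₂ p with half z <? k
  ... | no q = trans (cong (ρ k) p) (trans (ρ-o (≮⇒≥ q)) (sym p))
  ... | yes q = ⊥-elim (<⇒≱ (subst (_< m) (trans (cong half (trans (cong (ρ k) p) (ρ-h k q))) (half-e _)) l′)
                              (m≤n⇒m≤1+n (m≤n⇒m≤1+n (m≤m+n m (half z)))))

  Low≢x : ∀ {z j} → half z < m → z ≢ x j
  Low≢x {j = j} = Low≢e (m≤n⇒m≤1+n (m≤n⇒m≤1+n (m≤m+n m j)))

  π-low : ∀ {z} → half z < m → π k z ≡ z
  π-low l = π-other k λ _ → Low≢x l

  πρ : ∀ {z} → half z < m → π k (ρ k z) ≡ z
  πρ {z} l with view z
  ... | inj₁ p = trans (cong (π k) (trans (cong (ρ k) p) (trans (ρ-e (m≤n⇒m≤o+n 2 l)) (sym p)))) (π-low l)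
  ... | inj₂ p with half z <? k
  ... | no q = trans (cong (π k) (trans (cong (ρ k) p) (trans (ρ-o (≮⇒≥ q)) (sym p)))) (π-low l)
  ... | yes q = trans (cong (π k) (trans (cong (ρ k) p) (ρ-h k q))) (trans (π-x k q) (sym p))

  S-low : ∀ {G z} → G ∈ S → z ∈ G → half z < m
  S-low = S⊆

  ∈-mapρ⁻ : ∀ {G z} → G ∈ S → z ∈ map (ρ k) G → π k z ∈ G
  ∈-mapρ⁻ {G} G∈ z with ∈-map⁻ (ρ k) z
  ... | w , w∈ , refl = subst (_∈ G) (sym (πρ (S-low G∈ w∈))) w∈

  -- Replacing x i by o i maps the part of the ball away from v and y onto its boundary.
  projection : ∀ {F} → F ∈ ball → ∃ λ G → G ∈ S × (∀ {z} → z ∈ F → z ≢ v → z ≢ y → π k z ∈ G)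
  projection F∈ with ballView F∈
  ... | inC p = let (G , G∈ , s) = collar-proj k fr p in G , G∈ , λ z _ _ → s z
  ... | inP {G} p = G , B⇒S p , λ { (here refl) n _ → ⊥-elim (n refl) ; (there z) _ _ → ∈-mapρ⁻ (B⇒S p) z }
  ... | inQ {G} p = G , σB⇒S p , λ { (here refl) _ n → ⊥-elim (n refl) ; (there z) _ _ → ∈-mapρ⁻ (σB⇒S p) z }
  ... | inR {G} p with cover p
  ... | F , F∈′ , s = F , B⇒S F∈′ , λ
    { (here refl) n _ → ⊥-elim (n refl) ; (there (here refl)) _ n → ⊥-elim (n refl)
    ; (there (there z)) _ _ → ∈-mapρ⁻ (B⇒S F∈′) (Sub.map⁺ (ρ k) s z) }

  ball-full : ∀ {X} → Face ball X → (∀ {z} → z ∈ X → half z < m) → Face S X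
  ball-full {X} (F , F∈ , s) l with projection F∈
  ... | G , G∈ , t = G , G∈ , λ z → subst (_∈ G) (π-low (l z))
      (t (s z) (Low≢e ≤-refl (l z)) (Low≢e (m≤n⇒m≤1+n ≤-refl) (l z)))

  NoH⇒fixed : ∀ {G} → G ∈ S → NoH k G → map (ρ k) G ≡ G
  NoH⇒fixed = ρ-fixed k fr

  ball-cover : ∀ {G} → G ∈ S → Face ball G
  ball-cover {G} G∈ with collar-bottom k fr G∈
  ... | inj₁ (F , F∈ , s) = F , C⁺ F∈ , s
  ... | inj₂ nh with ∈-++⁻ B G∈
  ... | inj₁ p = v ∷ map (ρ k) G , P⁺ p , λ z → there (subst (_ ∈_) (sym (NoH⇒fixed G∈ nh)) z)
  ... | inj₂ p = y ∷ map (ρ k) G , Q⁺ p , λ z → there (subst (_ ∈_) (sym (NoH⇒fixed G∈ nh)) z)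

  mapρ-Top : ∀ {G u} → G ∈ S → u ∈ map (ρ k) G → TopV m u
  mapρ-Top G∈ u∈ with ∈-map⁻ (ρ k) u∈
  ... | w , w∈ , refl = ρ-Low ≤-refl (S-low G∈ w∈)

  v∉ρ : ∀ {G} → G ∈ S → v ∉ map (ρ k) G
  v∉ρ G∈ z = proj₁ (TopV≢vy (mapρ-Top G∈ z)) refl

  y∉ρ : ∀ {G} → G ∈ S → y ∉ map (ρ k) G
  y∉ρ G∈ z = proj₂ (TopV≢vy (mapρ-Top G∈ z)) refl

  v#S : v # S
  v#S = ⊆V-# S⊆ (Low≢e ≤-refl)
  y#S : y # S
  y#S = ⊆V-# S⊆ (Low≢e (m≤n⇒m≤1+n ≤-refl))
  v#C : v # C
  v#C = #-collar k fr v#S λ l → proj₁ (proj₁ (apex≢ l))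
  y#C : y # C
  y#C = #-collar k fr y#S λ l → proj₁ (proj₂ (apex≢ l))

  S₀⇒S : ∀ {G} → G ∈ S₀ → ∃ λ F → F ∈ S × G ⊆ F
  S₀⇒S G∈ with cover G∈
  ... | F , F∈ , s = F , B⇒S F∈ , s

  y∉ρ₀ : ∀ {G} → G ∈ S₀ → y ∉ map (ρ k) G
  y∉ρ₀ G∈ z with S₀⇒S G∈
  ... | F , F∈ , s = y∉ρ F∈ (Sub.map⁺ (ρ k) s z)
  v∉ρ₀ : ∀ {G} → G ∈ S₀ → v ∉ map (ρ k) G
  v∉ρ₀ G∈ z with S₀⇒S G∈
  ... | F , F∈ , s = v∉ρ F∈ (Sub.map⁺ (ρ k) s z)

  ball-pure : Pure (suc (suc d)) ball
  ball-pure F∈ with ballView F∈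
  ... | inC p = collar-pure k fr pureS p
  ... | inP {G} p = cong suc (trans (length-map (ρ k) G) (proj₁ (pureB p))) , Uniq∷ (v∉ρ (B⇒S p)) (Unique.map⁺ (ρ-inj k) (proj₂ (pureB p)))
  ... | inQ {G} p = cong suc (trans (length-map (ρ k) G) (proj₁ (pureσB p))) , Uniq∷ (y∉ρ (σB⇒S p)) (Unique.map⁺ (ρ-inj k) (proj₂ (pureσB p)))
  ... | inR {G} p = cong (suc ∘ suc) (trans (length-map (ρ k) G) (proj₁ (pureS₀ p))) ,
        Uniq∷ (λ { (here q) → v≢y q ; (there z) → v∉ρ₀ p z }) (Uniq∷ (y∉ρ₀ p) (Unique.map⁺ (ρ-inj k) (proj₂ (pureS₀ p))))

  not-both : ∀ {G} → G ∈ S → Face B G → Face (ren σ B) G → ⊥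
  not-both G∈ f g with both⇒S₀ f g
  ... | H , H∈ , s = <⇒≱ (n<1+n d) (subst₂ _≤_ (proj₁ (pureS G∈)) (proj₁ (pureS₀ H∈)) (length-mono (proj₂ (pureS G∈)) s))

  -- Across a ridge in `S₀` lies a facet of the other half. If it contained `u`, the original facet
  -- would lie in both halves, which is impossible by dimension.
  S-closed : Closed S
  S-closed {F} {u} F∈ u∈ with ∈-++⁻ B F∈
  ... | inj₁ p with opposite p u∈
  ... | inj₁ opp = Opposite-mono B⇒S opp
  ... | inj₂ (G , G∈ , s , u∉) with σcover G∈
  ... | F′ , F′∈ , t = F′ , σB⇒S F′∈ , (λ z n → t (s z n)) , λ u∈F′ →
          not-both F∈ (gen p) (F′ , F′∈ , ⊆-restore (λ z n → t (s z n)) u∈F′)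
  S-closed {F} {u} F∈ u∈ | inj₂ p with σopposite p u∈
  ... | inj₁ opp = Opposite-mono σB⇒S opp
  ... | inj₂ (G , G∈ , s , u∉) with cover G∈
  ... | F′ , F′∈ , t = F′ , B⇒S F′∈ , (λ z n → t (s z n)) , λ u∈F′ →
          not-both F∈ (F′ , F′∈ , ⊆-restore (λ z n → t (s z n)) u∈F′) (gen p)

  top-facet : ∀ {G} → G ∈ S → ∃ λ a → (a ≡ v ⊎ a ≡ y) × (a ∷ map (ρ k) G) ∈ ball
  top-facet G∈ = [ (λ p → v , inj₁ refl , P⁺ p) , (λ p → y , inj₂ refl , Q⁺ p) ]′ (∈-++⁻ B G∈)

  apex-opposite : ∀ {G a} → G ∈ S → a # C → a # S → Opposite (a ∷ map (ρ k) G) a ball ⊎ Opposite (a ∷ map (ρ k) G) a S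
  apex-opposite {G} {a} G∈ a#C a#S with collar-top k fr G∈
  ... | inj₁ (F , F∈ , s) = inj₁ (F , C⁺ F∈ , (λ { (here refl) n → ⊥-elim (n refl) ; (there z) _ → s z }) , a#C F∈)
  ... | inj₂ nh = inj₂ (G , G∈ , (λ { (here refl) n → ⊥-elim (n refl) ; (there z) _ → subst (_ ∈_) (NoH⇒fixed G∈ nh) z }) , a#S G∈)

  Opposite-∷ : ∀ {a F u Δ Γ} → u ≢ a → (∀ {G} → G ∈ Δ → (a ∷ G) ∈ Γ) → Opposite F u Δ → Opposite (a ∷ F) u Γ
  Opposite-∷ {a} u≢a f (F′ , F′∈ , s , u∉) = a ∷ F′ , f F′∈ , (λ { (here refl) _ → here refl ; (there z) n → there (s z n) }) ,
    λ { (here p) → u≢a p ; (there z) → u∉ z }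

  -- Common to the cones over `P` and `Q`: a ridge over `S₀` is crossed into v * y * R, whose facet
  -- adds only the other apex `b`.
  side-opposite : ∀ {B₁ a b F u} → (∀ {G} → G ∈ B₁ → (a ∷ map (ρ k) G) ∈ ball) → a ∉ map (ρ k) F → b ∉ map (ρ k) F →
    (∀ {G} → G ∈ S₀ → ∃ λ H → H ∈ ball × a ∷ map (ρ k) G ⊆ H × (∀ {z} → z ∈ H → z ≡ b ⊎ z ∈ a ∷ map (ρ k) G)) →
    (∀ {w} → w ∈ F → Opposite F w B₁ ⊎ Opposite F w S₀) → u ∈ map (ρ k) F → Opposite (a ∷ map (ρ k) F) u ball
  side-opposite {B₁} {a} {b} {F} {u} f a∉ b∉ g opp u∈ with ∈-map⁻ (ρ k) u∈
  ... | w , w∈ , refl with opp w∈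
  ... | inj₁ o₁ = Opposite-∷ {Δ = ren (ρ k) B₁} (λ { refl → a∉ u∈ }) f′ (Opposite-ren (ρ-inj k) o₁)
    where
    f′ : ∀ {G} → G ∈ ren (ρ k) B₁ → (a ∷ G) ∈ ball
    f′ p with ∈-map⁻ (map (ρ k)) p
    ... | G , G∈ , refl = f G∈
  ... | inj₂ o₂ with Opposite-ren (ρ-inj k) o₂
  ... | _ , p , s , u∉ with ∈-map⁻ (map (ρ k)) p
  ... | G , G∈ , refl with g G∈
  ... | H , H∈ , t , t⁻ = H , H∈ , (λ { (here refl) _ → t (here refl) ; (there z) n → t (there (s z n)) }) ,
        λ z → [ (λ { refl → b∉ u∈ }) , (λ { (here refl) → a∉ u∈ ; (there z) → u∉ z }) ]′ (t⁻ z)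

  ball-opposite : ∀ {F u} → F ∈ ball → u ∈ F → Opposite F u ball ⊎ Opposite F u S
  ball-opposite F∈ u∈ with ballView F∈
  ball-opposite {F} {u} F∈ u∈ | inC p with collar-opposite k fr S-closed p u∈
  ... | inj₁ opp = inj₁ (Opposite-mono C⁺ opp)
  ... | inj₂ (inj₁ opp) = inj₂ opp
  ... | inj₂ (inj₂ (_ , q , s , u∉)) with ∈-map⁻ (map (ρ k)) q
  ... | G , G∈ , refl with top-facet G∈
  ... | a , a≡ , a∈ = inj₁ (a ∷ map (ρ k) G , a∈ , (λ z n → there (s z n)) ,
        λ { (here refl) → [ (λ { refl → v#C p u∈ }) , (λ { refl → y#C p u∈ }) ]′ a≡ ; (there z) → u∉ z })
  ball-opposite F∈ (here refl) | inP p = apex-opposite (B⇒S p) v#C v#S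
  ball-opposite F∈ (here refl) | inQ p = apex-opposite (σB⇒S p) y#C y#S
  ball-opposite F∈ (there u∈) | inP p = inj₁ (side-opposite P⁺ (v∉ρ (B⇒S p)) (y∉ρ (B⇒S p))
    (λ {G} G∈ → v ∷ y ∷ map (ρ k) G , R⁺ G∈ , (λ { (here refl) → here refl ; (there z) → there (there z) }) ,
       λ { (here refl) → inj₂ (here refl) ; (there (here refl)) → inj₁ refl ; (there (there z)) → inj₂ (there z) })
    (opposite p) u∈)
  ball-opposite F∈ (there u∈) | inQ p = inj₁ (side-opposite Q⁺ (y∉ρ (σB⇒S p)) (v∉ρ (σB⇒S p))
    (λ {G} G∈ → v ∷ y ∷ map (ρ k) G , R⁺ G∈ , there ,
       λ { (here refl) → inj₁ refl ; (there z) → inj₂ z })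
    (σopposite p) u∈)
  -- From v * y * R, dropping `v` leads into y * Q, and dropping `y` leads into v * P.
  ball-opposite F∈ (here refl) | inR {G} p with σcover p
  ... | F′ , F′∈ , s = inj₁ (y ∷ map (ρ k) F′ , Q⁺ F′∈ ,
        (λ { (here refl) n → ⊥-elim (n refl) ; (there (here refl)) _ → here refl ; (there (there z)) _ → there (Sub.map⁺ (ρ k) s z) }) ,
        λ { (here q) → v≢y q ; (there z) → v∉ρ (σB⇒S F′∈) z })
  ball-opposite F∈ (there (here refl)) | inR {G} p with cover p
  ... | F′ , F′∈ , s = inj₁ (v ∷ map (ρ k) F′ , P⁺ F′∈ ,
        (λ { (here refl) _ → here refl ; (there (here refl)) n → ⊥-elim (n refl) ; (there (there z)) _ → there (Sub.map⁺ (ρ k) s z) }) ,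
        λ { (here q) → v≢y (sym q) ; (there z) → y∉ρ (B⇒S F′∈) z })
  ball-opposite F∈ (there (there u∈)) | inR {G} p = inj₁ (Opposite-∷ {Δ = map (y ∷_) (ren (ρ k) S₀)}
      (λ { refl → v∉ρ₀ p u∈ }) R⁺′ (Opposite-∷ {Δ = ren (ρ k) S₀} (λ { refl → y∉ρ₀ p u∈ }) (∈-map⁺ (y ∷_))
        (Closed-ren (ρ-inj k) closed (∈-map⁺ (map (ρ k)) p) u∈)))
    where
    R⁺′ : ∀ {G} → G ∈ map (y ∷_) (ren (ρ k) S₀) → (v ∷ G) ∈ ball
    R⁺′ q with ∈-map⁻ (y ∷_) q
    ... | _ , r , refl with ∈-map⁻ (map (ρ k)) r
    ... | G , G∈ , refl = R⁺ G∈

  drop-apex : ∀ {a G F} → a # S → G ∈ S → G ⊆ a ∷ F → G ⊆ F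
  drop-apex a#S G∈ s z with s z
  ... | here refl = ⊥-elim (a#S G∈ z)
  ... | there w = w

  -- Equality of sizes makes `G` the image of `G₀` under `ρ k`, and `ρ k` fixes every label whose
  -- image is still old. Hence `G` is `G₀` itself and contains no replaced vertex.
  below : ∀ {a G G₀} → a # S → G ∈ S → G₀ ∈ S → G ⊆ a ∷ map (ρ k) G₀ →
    map (ρ k) G₀ ⊆ G × G ⊆ G₀ × NoH k G
  below {a} {G} {G₀} a#S G∈ G₀∈ s = s⁻ , G⊆G₀ , noH
    where
    s′ : G ⊆ map (ρ k) G₀
    s′ = drop-apex a#S G∈ s
    s⁻ : map (ρ k) G₀ ⊆ G
    s⁻ = ⊆-antisym (proj₂ (pureS G∈)) (trans (proj₁ (pureS G∈)) (sym (trans (length-map (ρ k) G₀) (proj₁ (pureS G₀∈))))) s′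
    G⊆G₀ : G ⊆ G₀
    G⊆G₀ z with ∈-map⁻ (ρ k) (s′ z)
    ... | w , w∈ , refl = subst (_∈ G₀) (sym (ρ-low (S-low G₀∈ w∈) (S-low G∈ z))) w∈
    noH : NoH k G
    noH l z = TopV≢h l (mapρ-Top G₀∈ (s′ z)) refl

  not-R : ∀ {G G₀} → G ∈ S → G₀ ∈ S₀ → G ⊆ v ∷ y ∷ map (ρ k) G₀ → ⊥
  not-R {G} {G₀} G∈ G₀∈ s = <⇒≱ (n<1+n d) (subst₂ _≤_ (proj₁ (pureS G∈)) (trans (length-map (ρ k) G₀) (proj₁ (pureS₀ G₀∈)))
    (length-mono (proj₂ (pureS G∈)) (drop-apex y#S G∈ (drop-apex v#S G∈ s))))

  -- Replaced vertices separate the collar from the cones, `not-both` separates the cone over `P`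
  -- from that over `Q`, and the facets of v * y * R have too few old vertices to contain `G`.
  ball-unique : ∀ {G F F′} → G ∈ S → F ∈ ball → F′ ∈ ball → G ⊆ F → G ⊆ F′ → F ⊆ F′
  ball-unique {G} G∈ F∈ F′∈ = cases (ballView F∈) (ballView F′∈)
    where
    same : ∀ {a G₀ F′} → a # S → G₀ ∈ S → G ⊆ a ∷ map (ρ k) G₀ → a ∈ F′ → G ⊆ F′ → a ∷ map (ρ k) G₀ ⊆ F′
    same a#S G₀∈ s a∈ s′ (here refl) = a∈
    same a#S G₀∈ s a∈ s′ (there z) = s′ (proj₁ (below a#S G∈ G₀∈ s) z)
    collar-side : ∀ {F a G₀} → F ∈ C → a # S → G₀ ∈ S → G ⊆ F → G ⊆ a ∷ map (ρ k) G₀ → ⊥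
    collar-side p a#S G₀∈ s s′ with collar-over k fr pureS G∈ p s
    ... | j , l , h∈ = proj₂ (proj₂ (below a#S G∈ G₀∈ s′)) l h∈
    cross : ∀ {G₀ G₁} → G₀ ∈ B → G₁ ∈ ren σ B → G ⊆ v ∷ map (ρ k) G₀ → G ⊆ y ∷ map (ρ k) G₁ → ⊥
    cross p q s s′ = not-both G∈ (_ , p , proj₁ (proj₂ (below v#S G∈ (B⇒S p) s)))
                                 (_ , q , proj₁ (proj₂ (below y#S G∈ (σB⇒S q) s′)))
    cases : ∀ {F F′} → BallView F → BallView F′ → G ⊆ F → G ⊆ F′ → F ⊆ F′
    cases (inR p) _ s s′ = ⊥-elim (not-R G∈ p s)
    cases _ (inR p) s s′ = ⊥-elim (not-R G∈ p s′)
    cases (inC p) (inC q) s s′ = collar-unique k fr pureS G∈ p q s s′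
    cases (inC p) (inP q) s s′ = ⊥-elim (collar-side p v#S (B⇒S q) s s′)
    cases (inC p) (inQ q) s s′ = ⊥-elim (collar-side p y#S (σB⇒S q) s s′)
    cases (inP q) (inC p) s s′ = ⊥-elim (collar-side p v#S (B⇒S q) s′ s)
    cases (inQ q) (inC p) s s′ = ⊥-elim (collar-side p y#S (σB⇒S q) s′ s)
    cases (inP p) (inQ q) s s′ = ⊥-elim (cross p q s s′)
    cases (inQ q) (inP p) s s′ = ⊥-elim (cross p q s′ s)
    cases (inP p) (inP q) s s′ = same v#S (B⇒S p) s (here refl) s′
    cases (inQ p) (inQ q) s s′ = same y#S (σB⇒S p) s (here refl) s′

-- No vertex is adjacent to both a and σ a; this excludes fixed faces as well as
-- induced centrally symmetric 4-cycles.
AntipodeFree : Complex → Set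
AntipodeFree Δ = ∀ {z a} → Face Δ (z ∷ a ∷ []) → Face Δ (z ∷ σ a ∷ []) → ⊥

Positive⇒¬σ : ∀ {u} → Positive u → Positive (σ u) → ⊥
Positive⇒¬σ {u} p q = o≢e (trans (sym (trans (cong σ p) (σ-e (half u)))) q)

Negative⇒σ : ∀ {u} → u ≡ o (half u) → Positive (σ u)
Negative⇒σ {u} p = trans (trans (cong σ p) (σ-o (half u))) (cong e (sym (half-σ u)))

Face-⊆ : ∀ {Δ X Y} → Y ⊆ X → Face Δ X → Face Δ Y
Face-⊆ s (F , F∈ , t) = F , F∈ , t ∘ s

flip-edge : ∀ {Δ a b} → Face Δ (a ∷ b ∷ []) → Face Δ (b ∷ a ∷ [])
flip-edge = Face-⊆ λ { (here refl) → there (here refl) ; (there (here refl)) → here refl }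

-- Neighbours of the new vertices

module NextLevel (m k : ℕ) (k≤m : k ≤ m) (B S₀ : Complex) (B⊆ : B ⊆V BallV k m) (S₀⊆ : S₀ ⊆V Low k)
                 {d : ℕ} (facts : Facets k m d B S₀) where
  open LevelFacets m k k≤m B S₀ B⊆ S₀⊆ facts public
  open Facets facts

  ∈-mapρ : ∀ {w G} → ρ k w ≡ w → w ∈ G → w ∈ map (ρ k) G
  ∈-mapρ {w} {G} p z = subst (_∈ map (ρ k) G) p (∈-map⁺ (ρ k) z)

  high : ∀ {z} → m ≤ half z → BallV m m′ z → Positive z × half z < m′
  high g (inj₁ l) = ⊥-elim (<⇒≱ l g)
  high g (inj₂ (p , _ , l)) = p , l

  new-vertex : ∀ {z} → m ≤ half z → BallV m m′ z → z ≡ v ⊎ z ≡ y ⊎ ∃ λ j → j < k × z ≡ x j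
  new-vertex {z} g bv with high g bv | m≤n⇒∃[o]m+o≡n g
  ... | pos , l | zero , p = inj₁ (trans pos (cong e (trans (sym p) (+-identityʳ m))))
  ... | pos , l | suc zero , p = inj₂ (inj₁ (trans pos (cong e (trans (sym p) (trans (+-suc m 0) (cong suc (+-identityʳ m)))))))
  ... | pos , l | suc (suc j) , p = inj₂ (inj₂ (j , +-cancelˡ-< m j k (s<s⁻¹ (s<s⁻¹ (subst (_< m′) half≡ l))) , trans pos (cong e half≡)))
    where
    half≡ : half z ≡ suc (suc (m + j))
    half≡ = trans (sym p) (trans (+-suc m (suc j)) (cong suc (+-suc m j)))

  -- Old positive vertices are reached through v * P, and `y` and every `x j` through v * y * R.
  -- With its antipode this yields the covering of all vertices by two stars.
  v-adjacent : ∀ {w} → Positive w → half w < m′ → Face ball (v ∷ w ∷ [])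
  v-adjacent {w} pos l with half w <? m
  ... | yes q with positive pos q
  ... | F , F∈ , s = v ∷ map (ρ k) F , P⁺ F∈ , λ
    { (here refl) → here refl
    ; (there (here refl)) → there (∈-mapρ (trans (cong (ρ k) pos) (trans (ρ-e (m≤n⇒m≤o+n 2 q)) (sym pos))) (s (here refl))) }
  v-adjacent {w} pos l | no q with new-vertex (≮⇒≥ q) (inj₂ (pos , ≮⇒≥ q , l)) | inhabited
  ... | inj₁ refl | G , G∈ = v ∷ y ∷ map (ρ k) G , R⁺ G∈ , λ { (here refl) → here refl ; (there (here refl)) → here refl }
  ... | inj₂ (inj₁ refl) | G , G∈ = v ∷ y ∷ map (ρ k) G , R⁺ G∈ , λ { (here refl) → here refl ; (there (here refl)) → there (here refl) }
  ... | inj₂ (inj₂ (j , j<k , refl)) | _ with low (Low-o j<k)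
  ... | G , G∈ , s = v ∷ y ∷ map (ρ k) G , R⁺ G∈ , λ
    { (here refl) → here refl ; (there (here refl)) → there (there (subst (_∈ map (ρ k) G) (ρ-h k j<k) (∈-map⁺ (ρ k) (s (here refl))))) }

  S-vertices : ∀ {w} → half w < m → Face S (w ∷ [])
  S-vertices {w} l with view w
  ... | inj₁ p = Face-++ˡ (positive p l)
  ... | inj₂ p = Face-++ʳ B (subst (λ u → Face (ren σ B) (u ∷ [])) (σ-inv w)
                   (Face-σ (positive (Negative⇒σ p) (Low-σ {m} {w} l))))

  S-sym : ∀ {G} → G ∈ S → map σ G ∈ S
  S-sym {G} G∈ with ∈-++⁻ B G∈
  ... | inj₁ p = σB⇒S (∈-map⁺ (map σ) p)
  ... | inj₂ p with ∈-map⁻ (map σ) p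
  ... | H , H∈ , refl = B⇒S (subst (_∈ B) (sym (map-σσ H)) H∈)

  next : Facets m m′ (suc d) ball S
  next = record
    { pureB = ball-pure ; pureS₀ = pureS ; symS₀ = S-sym ; full = ball-full ; cover = ball-cover
    ; opposite = ball-opposite ; unique = ball-unique ; closed = S-closed
    ; positive = λ p l → Face-⊆ there (v-adjacent p l) ; low = S-vertices
    ; inhabited = let (G , G∈) = inhabited ; (F , F∈ , _) = cover G∈ in F , B⇒S F∈ }

  v-neighbour : ∀ {F a} → F ∈ ball → v ∈ F → a ∈ F → half a < m → Positive a
  v-neighbour F∈ v∈ a∈ l with ballView F∈
  ... | inC p = ⊥-elim (v#C p v∈)
  v-neighbour F∈ (here q) a∈ l | inQ p = ⊥-elim (v≢y q)
  v-neighbour F∈ (there v∈) a∈ l | inQ p = ⊥-elim (v∉ρ (σB⇒S p) v∈)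
  v-neighbour F∈ v∈ (here refl) l | inP p = Positive-e m
  v-neighbour F∈ v∈ (there a∈) l | inP p = PosV⇒Positive (P⊆ (∈-map⁺ (map (ρ k)) p) a∈)
  v-neighbour F∈ v∈ (here refl) l | inR p = Positive-e m
  v-neighbour F∈ v∈ (there (here refl)) l | inR p = Positive-e (suc m)
  v-neighbour F∈ v∈ (there (there a∈)) l | inR p = PosV⇒Positive (R⊆ (∈-map⁺ (map (ρ k)) p) a∈)

  -- The old neighbours of `y` are positive on the first `k` pairs, where negative vertices were
  -- replaced, and negative on the later ones, where they are interior to the antipode of `B`.
  YV : ℕ → Set
  YV a = (Positive a × half a < k) ⊎ (Positive (σ a) × k ≤ half a)

  Q-low : ∀ {G a} → G ∈ ren σ B → a ∈ map (ρ k) G → half a < m → YV a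
  Q-low {G} {a} G∈ a∈ l with ∈-map⁻ (ρ k) a∈
  ... | w , w∈ , e₁ with trans e₁ (ρ-low (S-low (σB⇒S G∈) w∈) (subst (λ u → half u < m) e₁ l))
  ... | refl with ∈-ren⁻ {σ} {B} G∈ w∈
  ... | H , u , H∈ , u∈ , refl with B⊆ H∈ u∈
  ... | inj₂ (pos , k≤ , _) = inj₂ (subst Positive (sym (σ-inv u)) pos , subst (k ≤_) (sym (half-σ u)) k≤)
  ... | inj₁ u<k with view (σ u)
  ... | inj₁ p = inj₁ (p , Low-σ {k} {u} u<k)
  ... | inj₂ p = ⊥-elim (TopV≢h (Low-σ {k} {u} u<k) (mapρ-Top (σB⇒S G∈) a∈) p)

  y-neighbour : ∀ {F a} → F ∈ ball → y ∈ F → a ∈ F → half a < m → YV a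
  y-neighbour F∈ y∈ a∈ l with ballView F∈
  ... | inC p = ⊥-elim (y#C p y∈)
  y-neighbour F∈ (here q) a∈ l | inP p = ⊥-elim (v≢y (sym q))
  y-neighbour F∈ (there y∈) a∈ l | inP p = ⊥-elim (y∉ρ (B⇒S p) y∈)
  y-neighbour F∈ y∈ (here refl) l | inQ p = ⊥-elim (Low≢e (m≤n⇒m≤1+n ≤-refl) l refl)
  y-neighbour F∈ y∈ (there a∈) l | inQ p = Q-low p a∈ l
  y-neighbour F∈ y∈ (here refl) l | inR p = ⊥-elim (Low≢e ≤-refl l refl)
  y-neighbour F∈ y∈ (there (here refl)) l | inR p = ⊥-elim (Low≢e (m≤n⇒m≤1+n ≤-refl) l refl)
  y-neighbour F∈ y∈ (there (there a∈)) l | inR p with R⊆ (∈-map⁺ (map (ρ k)) p) a∈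
  ... | inj₁ (i , i<k , refl) = inj₁ (Positive-e i , Low-e i<k)
  ... | inj₂ (j , _ , refl) = ⊥-elim (Low≢x l refl)

  YV-free : ∀ {a} → YV a → YV (σ a) → ⊥
  YV-free (inj₁ (p , _)) (inj₁ (q , _)) = Positive⇒¬σ p q
  YV-free {a} (inj₁ (_ , l)) (inj₂ (_ , g)) = <⇒≱ l (subst (k ≤_) (half-σ a) g)
  YV-free {a} (inj₂ (_ , g)) (inj₁ (_ , l)) = <⇒≱ l (subst (k ≤_) (sym (half-σ a)) g)
  YV-free {a} (inj₂ (p , _)) (inj₂ (q , _)) = Positive⇒¬σ (subst Positive (σ-inv a) q) p

  x-neighbour : ∀ {j a} → j < k → Face ball (x j ∷ a ∷ []) → half a < m → Face S (o j ∷ a ∷ [])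
  x-neighbour {j} {a} l (F , F∈ , s) low with projection F∈
  ... | G , G∈ , t = G , G∈ , λ
    { (here refl) → subst (_∈ G) (π-x k l) (t (s (here refl)) (proj₁ (proj₁ (apex≢ l)) ∘ sym) (proj₁ (proj₂ (apex≢ l)) ∘ sym))
    ; (there (here refl)) → subst (_∈ G) (π-low low) (t (s (there (here refl))) (Low≢e ≤-refl low) (Low≢e (m≤n⇒m≤1+n ≤-refl) low)) }

  ball-vertex : ∀ {z a} → Face ball (z ∷ a ∷ []) → BallV m m′ z × BallV m m′ a
  ball-vertex (F , F∈ , s) = ball⊆ F∈ (s (here refl)) , ball⊆ F∈ (s (there (here refl)))

  module _ (free : AntipodeFree S) where

    new-free : ∀ {z a} → m ≤ half z → Face ball (z ∷ a ∷ []) → Face ball (z ∷ σ a ∷ []) → ⊥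
    new-free {z} {a} g f f′ with half a <? m
    ... | no q = Positive⇒¬σ (proj₁ (high (≮⇒≥ q) (proj₂ (ball-vertex f))))
                   (proj₁ (high (subst (m ≤_) (sym (half-σ a)) (≮⇒≥ q)) (proj₂ (ball-vertex f′))))
    ... | yes l with new-vertex g (proj₁ (ball-vertex f)) | f | f′
    ... | inj₁ refl | F , F∈ , s | F′ , F′∈ , s′ = Positive⇒¬σ
            (v-neighbour F∈ (s (here refl)) (s (there (here refl))) l)
            (v-neighbour F′∈ (s′ (here refl)) (s′ (there (here refl))) (Low-σ {m} {a} l))
    ... | inj₂ (inj₁ refl) | F , F∈ , s | F′ , F′∈ , s′ = YV-free
            (y-neighbour F∈ (s (here refl)) (s (there (here refl))) l)
            (y-neighbour F′∈ (s′ (here refl)) (s′ (there (here refl))) (Low-σ {m} {a} l))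
    ... | inj₂ (inj₂ (j , j<k , refl)) | _ | _ = free (x-neighbour j<k f l) (x-neighbour j<k f′ (Low-σ {m} {a} l))

    sphere : Complex
    sphere = ball ++ ren σ ball

    S-Face-σ : ∀ {X} → Face S (map σ X) → Face S X
    S-Face-σ (F , F∈ , s) = map σ F , S-sym F∈ , Relabel.⊆-map⇐ σ σ-inv s

    sphere-full : ∀ {X} → Face sphere X → (∀ {z} → z ∈ X → half z < m) → Face S X
    sphere-full {X} f l with Face-++⁻ ball f
    ... | inj₁ g = ball-full g l
    ... | inj₂ g = S-Face-σ (ball-full (Face-σ⁻ g) l′)
      where
      l′ : ∀ {z} → z ∈ map σ X → half z < m
      l′ z with ∈-map⁻ σ z
      ... | w , w∈ , refl = Low-σ {m} {w} (l w∈)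

    positive-side : ∀ {z a} → Face sphere (z ∷ a ∷ []) → m ≤ half z → Positive z → Face ball (z ∷ a ∷ [])
    positive-side {z} f g pos with Face-++⁻ ball f
    ... | inj₁ p = p
    ... | inj₂ p = ⊥-elim (Positive⇒¬σ pos (proj₁ (high (subst (m ≤_) (sym (half-σ z)) g) (proj₁ (ball-vertex (Face-σ⁻ p))))))

    negative-side : ∀ {z a} → Face sphere (z ∷ a ∷ []) → m ≤ half z → Positive (σ z) → Face ball (σ z ∷ σ a ∷ [])
    negative-side {z} f g neg with Face-++⁻ ball f
    ... | inj₂ p = Face-σ⁻ p
    ... | inj₁ p = ⊥-elim (Positive⇒¬σ (proj₁ (high g (proj₁ (ball-vertex p)))) neg)

    sphere-free : AntipodeFree sphere
    sphere-free {z} {a} f f′ with half z <? m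
    ... | no q with view z
    ... | inj₁ p = new-free (≮⇒≥ q) (positive-side f (≮⇒≥ q) p) (positive-side f′ (≮⇒≥ q) p)
    ... | inj₂ p = new-free (subst (m ≤_) (sym (half-σ z)) (≮⇒≥ q))
            (negative-side f (≮⇒≥ q) (Negative⇒σ p)) (negative-side f′ (≮⇒≥ q) (Negative⇒σ p))
    sphere-free {z} {a} f f′ | yes l with half a <? m
    ... | yes l′ = free (sphere-full f λ { (here refl) → l ; (there (here refl)) → l′ })
                        (sphere-full f′ λ { (here refl) → l ; (there (here refl)) → Low-σ {m} {a} l′ })
    -- For old `z` and new `a`, the antipodal map turns the two edges at `z` into edges of `ball`
    -- from one new vertex to both `z` and `σ z`.
    ... | no q with view a
    ... | inj₁ p = new-free (≮⇒≥ q) (positive-side (flip-edge f) (≮⇒≥ q) p)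
            (subst (λ u → Face ball (u ∷ σ z ∷ [])) (σ-inv a) (negative-side (flip-edge f′) (subst (m ≤_) (sym (half-σ a)) (≮⇒≥ q)) (subst Positive (sym (σ-inv a)) p)))
    ... | inj₂ p = new-free (subst (m ≤_) (sym (half-σ a)) (≮⇒≥ q))
            (positive-side (flip-edge f′) (subst (m ≤_) (sym (half-σ a)) (≮⇒≥ q)) (Negative⇒σ p))
            (negative-side (flip-edge f) (≮⇒≥ q) (Negative⇒σ p))

-- Induction over all levels

Facets-zero : Facets 0 1 0 (Ball 1) (Sph 0)
Facets-zero = record
  { pureB = λ { (here refl) → refl , Uniq∷ (λ ()) [] }
  ; pureS₀ = λ { (here refl) → refl , [] ; (there (here refl)) → refl , [] }
  ; symS₀ = λ { (here refl) → here refl ; (there (here refl)) → here refl }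
  ; full = λ { {[]} _ _ → gen (here refl) ; {z ∷ _} _ l → ⊥-elim (<⇒≱ (l (here refl)) z≤n) }
  ; cover = λ { (here refl) → _ , here refl , (λ ()) ; (there (here refl)) → _ , here refl , (λ ()) }
  ; opposite = λ { (here refl) (here refl) → inj₂ ([] , here refl , (λ { (here refl) n → ⊥-elim (n refl) }) , λ ()) }
  ; unique = λ { _ (here refl) (here refl) _ _ → id }
  ; closed = λ { (here refl) () ; (there (here refl)) () }
  ; positive = λ { {zero} _ _ → gen (here refl) ; {suc zero} () _ ; {suc (suc w)} _ (s≤s ()) }
  ; low = λ ()
  ; inhabited = [] , here refl }

facets : ∀ j → Facets (n j) (n (suc j)) j (Ball (suc j)) (Sph j)
facets zero = Facets-zero
facets (suc j) = NextLevel.next (n (suc j)) (n j) (n-mono j) (Ball (suc j)) (Sph j) (Ball⊆ j) (Sph⊆ j) (facets j)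

module Lev (j : ℕ) = NextLevel (n (suc j)) (n j) (n-mono j) (Ball (suc j)) (Sph j) (Ball⊆ j) (Sph⊆ j) (facets j)

Sph-free : ∀ j → AntipodeFree (Sph j)
Sph-free zero (F , here refl , s) _ with s (here refl)
... | ()
Sph-free zero (F , there (here refl) , s) _ with s (here refl)
... | ()
Sph-free (suc zero) {z} {a} f f′ = odd-even (edge f) (edge f′)
  where
  edge : ∀ {z a} → Face (Sph 1) (z ∷ a ∷ []) → z ≡ a
  edge (_ , here refl , s) with s (here refl) | s (there (here refl))
  ... | here refl | here refl = refl
  edge (_ , there (here refl) , s) with s (here refl) | s (there (here refl))
  ... | here refl | here refl = refl
  odd-even : z ≡ a → z ≡ σ a → ⊥
  odd-even refl q with view z
  ... | inj₁ p = Positive⇒¬σ p (subst Positive q p)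
  ... | inj₂ p = Positive⇒¬σ (subst Positive (sym q) (Negative⇒σ p)) (Negative⇒σ p)
Sph-free (suc (suc j)) = Lev.sphere-free j (Sph-free (suc j))

-- The positive half of a sphere and the inner balls

Positive? : ∀ u → Dec (Positive u)
Positive? u = u ≟ e (half u)

positives : List ℕ → List ℕ
positives = filter Positive?

-- Faces are arbitrary subsets of generators, so filtering the generators gives the induced
-- subcomplex on the labels kept; `Inner` uses the same device.
half-sphere : Complex → Complex
half-sphere = map positives

above : ℕ → List ℕ → List ℕ
above m = filter (λ u → m ≤? half u)

Inner : ℕ → Complex
Inner zero = ⟨ 0 ⟩
Inner (suc j) = map (above (n (suc j))) (Ball (suc (suc j)))

∈-positives⁻ : ∀ {z X} → z ∈ positives X → z ∈ X × Positive z
∈-positives⁻ {X = X} = ∈-filter⁻ Positive? {xs = X}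

∈-above⁻ : ∀ {m z X} → z ∈ above m X → z ∈ X × m ≤ half z
∈-above⁻ {m} {X = X} = ∈-filter⁻ (λ u → m ≤? half u) {xs = X}

module Halves (j : ℕ) where
  open Lev j
  open Facets (facets j)
  k m : ℕ
  k = n j
  m = n (suc j)
  B S₀ : Complex
  B = Ball (suc j)
  S₀ = Sph j

  below-k : List ℕ → List ℕ
  below-k = filter (λ u → half u <? k)

  below-k-face : ∀ {G} → G ∈ S → ∃ λ G₁ → G₁ ∈ S₀ × below-k G ⊆ G₁
  below-k-face {G} G∈ with ∈-++⁻ B G∈
  ... | inj₁ p = full (G , p , λ z → proj₁ (∈-filter⁻ _ {xs = G} z)) λ z → proj₂ (∈-filter⁻ _ {xs = G} z)
  ... | inj₂ p = σfull (G , p , λ z → proj₁ (∈-filter⁻ _ {xs = G} z)) λ z → proj₂ (∈-filter⁻ _ {xs = G} z)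

  -- Interior vertices of the antipode of `B` are negative and fixed by `ρ k`, so positive labels
  -- come only from its boundary.
  Q-positive : ∀ {G} → G ∈ ren σ B → ∃ λ G₁ → G₁ ∈ S₀ × (∀ {z} → z ∈ map (ρ k) G → Positive z → z ∈ map (ρ k) G₁)
  Q-positive {G} G∈ with below-k-face (σB⇒S G∈)
  ... | G₁ , G₁∈ , s = G₁ , G₁∈ , sub
    where
    sub : ∀ {z} → z ∈ map (ρ k) G → Positive z → z ∈ map (ρ k) G₁
    sub z pos with ∈-map⁻ (ρ k) z
    ... | w , w∈ , refl with half w <? k
    ... | yes q = ∈-map⁺ (ρ k) (s (∈-filter⁺ (λ u → half u <? k) w∈ q))
    ... | no q with ∈-ren⁻ {σ} {B} G∈ w∈
    ... | H , u , H∈ , u∈ , refl with Ball⊆ j H∈ u∈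
    ... | inj₁ l = ⊥-elim (q (Low-σ {k} {u} l))
    ... | inj₂ (p , _) = ⊥-elim (o≢e (trans (sym σu≡o) (trans (sym ρ≡) pos)))
      where
      σu≡o : σ u ≡ o (half u)
      σu≡o = trans (cong σ p) (σ-e (half u))
      ρ≡ : ρ k (σ u) ≡ σ u
      ρ≡ = trans (cong (ρ k) σu≡o) (trans (ρ-o (subst (k ≤_) (half-σ u) (≮⇒≥ q))) (sym σu≡o))

  Star : Complex
  Star = ⟨ v ⟩ ⋆ (P ++ ⟨ y ⟩ ⋆ R)

  star-P : ∀ {X G} → G ∈ B → X ⊆ v ∷ map (ρ k) G → Face Star X
  star-P G∈ s = _ , ∈-⟨⟩⋆⁺ (∈-++⁺ˡ (∈-map⁺ (map (ρ k)) G∈)) , s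

  star-R : ∀ {X G} → G ∈ S₀ → X ⊆ v ∷ y ∷ map (ρ k) G → Face Star X
  star-R G∈ s = _ , ∈-⟨⟩⋆⁺ (∈-++⁺ʳ P (∈-⟨⟩⋆⁺ (∈-map⁺ (map (ρ k)) G∈))) , s

  star-S : ∀ {X G} → G ∈ S → (∀ {z} → z ∈ X → Positive z × z ∈ map (ρ k) G) → Face Star X
  star-S {X} {G} G∈ s with ∈-++⁻ B G∈
  ... | inj₁ p = star-P p λ z → there (proj₂ (s z))
  ... | inj₂ p with Q-positive p
  ... | G₁ , G₁∈ , t = star-R G₁∈ λ z → there (there (t (proj₂ (s z)) (proj₁ (s z))))

  positive-fixed : ∀ {z} → Positive z → half z < m → ρ k z ≡ z
  positive-fixed pos l = trans (cong (ρ k) pos) (trans (ρ-e (m≤n⇒m≤o+n 2 l)) (sym pos))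

  -- The positive vertices induce the star of `v`: the positive part of a collar facet lies in a
  -- facet of the relabelled sphere, that of y * Q lies in y * R, and the antipodal half contributes
  -- only old vertices.
  half-sphere≅ : half-sphere (Sph (suc (suc j))) ≅ Star
  half-sphere≅ = ≼-≅ to from
    where
    in-collar : ∀ {F G} → F ∈ C → (∀ {z} → z ∈ F → z ≢ v → z ≢ y → π k z ∈ G) →
      ∀ {z} → z ∈ positives F → Positive z × z ∈ map (ρ k) G
    in-collar {F} {G} p t {z} z∈ with ∈-positives⁻ {X = F} z∈
    ... | z∈F , pos = pos , go (half z <? m)
      where
      πz : π k z ∈ G
      πz = t z∈F (λ { refl → v#C p z∈F }) (λ { refl → y#C p z∈F })
      go : Dec (half z < m) → z ∈ map (ρ k) G
      go (yes l) = ∈-mapρ (positive-fixed pos l) (subst (_∈ G) (π-low l) πz)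
      go (no q) with new-vertex (≮⇒≥ q) (ball⊆ (C⁺ p) z∈F)
      ... | inj₁ refl = ⊥-elim (v#C p z∈F)
      ... | inj₂ (inj₁ refl) = ⊥-elim (y#C p z∈F)
      ... | inj₂ (inj₂ (i , i<k , refl)) = subst (_∈ map (ρ k) G) (ρ-h k i<k) (∈-map⁺ (ρ k) (subst (_∈ G) (π-x k i<k) πz))
    to-ball : ∀ {F} → F ∈ ball → Face Star (positives F)
    to-ball {F} F∈ with ballView F∈
    ... | inC p = let (G , G∈ , t) = projection F∈ in star-S G∈ (in-collar p t)
    ... | inP p = star-P p λ z → proj₁ (∈-positives⁻ {X = F} z)
    ... | inR p = star-R p λ z → proj₁ (∈-positives⁻ {X = F} z)
    ... | inQ {G} p with Q-positive p
    ... | G₁ , G₁∈ , t = star-R G₁∈ λ z → sub (∈-positives⁻ {X = F} z)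
      where
      sub : ∀ {z} → z ∈ y ∷ map (ρ k) G × Positive z → z ∈ v ∷ y ∷ map (ρ k) G₁
      sub (here refl , _) = there (here refl)
      sub (there z , pos) = there (there (t z pos))
    to-σball : ∀ {F} → F ∈ ball → Face Star (positives (map σ F))
    to-σball {F} F∈ with projection F∈
    ... | G , G∈ , t = star-S (S-sym G∈) λ z → sub (∈-positives⁻ {X = map σ F} z)
      where
      sub : ∀ {z} → z ∈ map σ F × Positive z → Positive z × z ∈ map (ρ k) (map σ G)
      sub (z∈ , pos) with ∈-map⁻ σ z∈
      ... | w , w∈ , refl = pos , ∈-mapρ (positive-fixed pos (Low-σ {m} {w} w<m)) (∈-map⁺ σ (subst (_∈ G) (π-low w<m)
              (t w∈ (Low≢e ≤-refl w<m) (Low≢e (m≤n⇒m≤1+n ≤-refl) w<m))))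
        where
        w<m : half w < m
        w<m with ball⊆ F∈ w∈
        ... | inj₁ l = l
        ... | inj₂ (q , _) = ⊥-elim (Positive⇒¬σ q pos)
    to : half-sphere (Sph (suc (suc j))) ≼ Star
    to p with ∈-map⁻ positives p
    ... | F , F∈ , refl with ∈-++⁻ ball F∈
    ... | inj₁ q = to-ball q
    ... | inj₂ q with ∈-map⁻ (map σ) q
    ... | F₀ , F₀∈ , refl = to-σball F₀∈
    all-positive : ∀ {F} → F ∈ ball → (∀ {z} → z ∈ F → Positive z) → Face (half-sphere (Sph (suc (suc j)))) F
    all-positive F∈ f = _ , ∈-map⁺ positives (∈-++⁺ˡ F∈) , λ z → ∈-filter⁺ Positive? z (f z)
    from : Star ≼ half-sphere (Sph (suc (suc j)))
    from p with ∈-⟨⟩⋆⁻ p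
    ... | _ , q , refl with ∈-++⁻ P q
    ... | inj₁ r with ∈-map⁻ (map (ρ k)) r
    ... | G , G∈ , refl = all-positive (P⁺ G∈) λ { (here refl) → Positive-e m ; (there z) → PosV⇒Positive (P⊆ r z) }
    from p | _ , q , refl | inj₂ r with ∈-⟨⟩⋆⁻ r
    ... | _ , s , refl with ∈-map⁻ (map (ρ k)) s
    ... | G , G∈ , refl = all-positive (R⁺ G∈) λ { (here refl) → Positive-e m ; (there (here refl)) → Positive-e (suc m) ; (there (there z)) → PosV⇒Positive (R⊆ s z) }

  -- Each `x i` stands for `o i`, so apart from `v` and `y` the new vertices induce the relabelled
  -- negative half of `S₀`, which is the antipode of its positive half.
  inner≅ : Inner (suc j) ≅ (⟨ v ⟩ ⋆ ⟨ y ⟩ ⋆ ren (ρ k) (ren σ (half-sphere S₀)))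
  inner≅ = ≼-≅ to from
    where
    to : Inner (suc j) ≼ (⟨ v ⟩ ⋆ ⟨ y ⟩ ⋆ ren (ρ k) (ren σ (half-sphere S₀)))
    to p with ∈-map⁻ (above m) p
    ... | F , F∈ , refl with projection F∈
    ... | G , G∈ , t with below-k-face G∈
    ... | G₁ , G₁∈ , s = _ , ∈-⟨⟩⋆⁺ (∈-⟨⟩⋆⁺ (∈-map⁺ (map (ρ k)) (∈-map⁺ (map σ) (∈-map⁺ positives (symS₀ G₁∈))))) , λ z → sub (∈-above⁻ {X = F} z)
      where
      sub : ∀ {z} → z ∈ F × m ≤ half z → z ∈ v ∷ y ∷ map (ρ k) (map σ (positives (map σ G₁)))
      sub (z∈ , g) with new-vertex g (ball⊆ F∈ z∈)
      ... | inj₁ refl = here refl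
      ... | inj₂ (inj₁ refl) = there (here refl)
      ... | inj₂ (inj₂ (i , i<k , refl)) = there (there (subst (_∈ map (ρ k) (map σ (positives (map σ G₁))))
            (trans (cong (ρ k) (σ-e i)) (ρ-h k i<k)) (∈-map⁺ (ρ k) (∈-map⁺ σ (∈-filter⁺ Positive?
              (subst (_∈ map σ G₁) (σ-o i) (∈-map⁺ σ (s (∈-filter⁺ (λ u → half u <? k) h∈ (Low-o i<k))))) (Positive-e i))))))
        where
        h∈ : o i ∈ G
        h∈ = subst (_∈ G) (π-x k i<k) (t z∈ (proj₁ (proj₁ (apex≢ i<k)) ∘ sym) (proj₁ (proj₂ (apex≢ i<k)) ∘ sym))
    from : (⟨ v ⟩ ⋆ ⟨ y ⟩ ⋆ ren (ρ k) (ren σ (half-sphere S₀))) ≼ Inner (suc j)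
    from p with ∈-⟨⟩⋆⁻ p
    ... | _ , q , refl with ∈-⟨⟩⋆⁻ q
    ... | _ , r , refl with ∈-map⁻ (map (ρ k)) r
    ... | _ , s , refl with ∈-map⁻ (map σ) s
    ... | _ , t , refl with ∈-map⁻ positives t
    ... | G , G∈ , refl = _ , ∈-map⁺ (above m) (R⁺ (symS₀ G∈)) , λ
      { (here refl) → keep (here refl) (subst (m ≤_) (sym (half-e m)) ≤-refl)
      ; (there (here refl)) → keep (there (here refl)) (subst (m ≤_) (sym (half-e (suc m))) (m≤n⇒m≤1+n ≤-refl))
      ; (there (there z)) → sub z }
      where
      F = v ∷ y ∷ map (ρ k) (map σ G)
      keep : ∀ {z} → z ∈ F → m ≤ half z → z ∈ above m F
      keep = ∈-filter⁺ (λ u → m ≤? half u)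
      sub : ∀ {z} → z ∈ map (ρ k) (map σ (positives G)) → z ∈ above m F
      sub z with ∈-map⁻ (ρ k) z
      ... | _ , a , refl with ∈-map⁻ σ a
      ... | w , b , refl with ∈-positives⁻ {X = G} b
      ... | w∈ , pos = keep (there (there (∈-map⁺ (ρ k) (∈-map⁺ σ w∈))))
            (subst (m ≤_) (sym (trans (cong half (trans (cong (ρ k) (trans (cong σ pos) (σ-e (half w)))) (ρ-h k (Sph⊆ j G∈ w∈)))) (half-e _)))
              (m≤n⇒m≤1+n (m≤n⇒m≤1+n (m≤m+n m (half w)))))

-- Before relabelling, the star is v * (B ++ y * S₀). Coning off `B` turns the link of `v` into the
-- suspension of `S₀` with points `c` and `y`, hence into the boundary of a simplex, and the cone
-- over that is equivalent to the simplex.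
half-sphere-∼ : ∀ j L → ∃ (_∈ L) → (∀ {u} → Low (n j) u → u # L) → FacetIn (half-sphere (Sph j)) j L
half-sphere-∼ zero L _ _ = [] , refl , [] , (λ ()) ,
  in-ctx [] (half-sphere (Sph 0)) ⟪ [] ⟫ L (≼-≅ (λ { (here refl) → gen (here refl) ; (there (here refl)) → gen (here refl) }) λ { (here refl) → gen (here refl) })
half-sphere-∼ (suc zero) L _ low = 0 ∷ [] , refl , Uniq∷ (λ ()) [] , (λ { (here refl) → low (s≤s z≤n) }) ,
  in-ctx [] (half-sphere (Sph 1)) ⟪ 0 ∷ [] ⟫ L (≼-≅ (λ { (here refl) → gen (here refl) ; (there (here refl)) → _ , here refl , λ () }) λ { (here refl) → gen (here refl) })
half-sphere-∼ (suc (suc j)) L (l , l∈) low with Sph-∼ j ((⟨ apex j ⟩ ++ ⟨ Lev.y j ⟩) ⋆ (⟨ Lev.v j ⟩ ⋆ L))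
    (_ , ∈-⋆⁺ {⟨ apex j ⟩ ++ ⟨ Lev.y j ⟩} (here refl) (∈-⟨⟩⋆⁺ l∈))
    (λ {u} p → let p′ = ≤-trans p (n-mono j) in
      (≢# (λ { refl → <⇒≢ p (half-e (n j)) }) ⊕ ≢# (Lev.Low≢e j (m≤n⇒m≤1+n ≤-refl) p′)) ⊗
        ≢# (Lev.Low≢e j ≤-refl p′) ⊗ low (≤-trans p′ (n-mono (suc j))))
... | τ , len , uniq , τ# , eq = map (ρ k) (c ∷ τ) , trans (length-map (ρ k) (c ∷ τ)) (cong suc len) ,
    Unique.map⁺ (ρ-inj k) (Uniq∷ c∉ uniq) , ρτ#L ,
    (in-ctx [] (half-sphere (Sph (suc (suc j)))) (ren (ρ k) X) L
       (subst (half-sphere (Sph (suc (suc j))) ≅_) (sym renX) half-sphere≅)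
    ◅◅ subst₂ _∼_ (trans (ren-⋆ X L) (cong (ren (ρ k) X ⋆_) renL)) (trans (ren-⋆ ⟪ c ∷ τ ⟫ L) (cong (⟪ map (ρ k) (c ∷ τ) ⟫ ⋆_) renL))
         (∼-ren-ρ k X∼))
  where
  open Halves j
  open Lev j
  c = apex j
  X = ⟨ v ⟩ ⋆ (B ++ ⟨ y ⟩ ⋆ S₀)
  ren-⋆ : ∀ Δ Γ → ren (ρ k) (Δ ⋆ Γ) ≡ ren (ρ k) Δ ⋆ ren (ρ k) Γ
  ren-⋆ = map-map-⋆ (ρ k)
  renX : ren (ρ k) X ≡ Star
  renX = trans (ren-⋆ ⟨ v ⟩ (B ++ ⟨ y ⟩ ⋆ S₀)) (cong₂ _⋆_ (cong ⟨_⟩ (ρ-e (m≤n⇒m≤1+n ≤-refl)))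
    (trans (map-++ (map (ρ k)) B (⟨ y ⟩ ⋆ S₀)) (cong (P ++_) (trans (ren-⋆ ⟨ y ⟩ S₀) (cong (λ a → ⟨ a ⟩ ⋆ R) (ρ-e ≤-refl))))))
  L-fixed : ∀ {F z} → F ∈ L → z ∈ F → ρ k z ≡ z
  L-fixed F∈ z∈ = ρ-other k λ l →
    (λ { refl → low (Low-o (≤-trans l (≤-trans (n-mono j) (n-mono (suc j))))) F∈ z∈ }) , (λ { refl → low (Low-e (x<m′ l)) F∈ z∈ })
  renL : ren (ρ k) L ≡ L
  renL = map-fixed′ λ F∈ → map-fixed (L-fixed F∈)
    where
    map-fixed′ : ∀ {f : List ℕ → List ℕ} {Δ} → (∀ {F} → F ∈ Δ → f F ≡ F) → map f Δ ≡ Δ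
    map-fixed′ f = map-id-local (All.tabulate f)
  c# : c # (⟨ v ⟩ ⋆ L)
  c# = ≢# (Low≢e ≤-refl (Low-e (n< j))) ⊗ low (Low-e (≤-trans (n< j) (n-mono (suc j))))
  v#L : v # L
  v#L = low (Low-e m<m′)
  y# : y # (⟨ v ⟩ ⋆ L)
  y# = ≢# (v≢y ∘ sym) ⊗ low (Low-e 1+m<m′)
  τ#vL : ∀ {z} → z ∈ τ → z # (⟨ v ⟩ ⋆ L)
  τ#vL z∈ G∈ z = τ# z∈ (∈-⋆⁺ {⟨ c ⟩ ++ ⟨ y ⟩} (here refl) G∈) (there z)
  cτ#vL : ∀ {z} → z ∈ c ∷ τ → z # (⟨ v ⟩ ⋆ L)
  cτ#vL (here refl) = c#
  cτ#vL (there z) = τ#vL z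
  cτ#L : ∀ {z} → z ∈ c ∷ τ → z # L
  cτ#L z∈ G∈ z = cτ#vL z∈ (∈-⟨⟩⋆⁺ G∈) (there z)
  ρτ#L : ∀ {z} → z ∈ map (ρ k) (c ∷ τ) → z # L
  ρτ#L z∈ G∈ z with ∈-map⁻ (ρ k) z∈
  ... | w , w∈ , refl = cτ#L w∈ G∈ (subst (_∈ _) (ρ-inj k (L-fixed G∈ z)) z)
  c∉ : c ∉ τ
  c∉ z = τ# z (∈-⋆⁺ {⟨ c ⟩ ++ ⟨ y ⟩} (here refl) (∈-⟨⟩⋆⁺ l∈)) (here refl)
  X∼ : X ⋆ L ∼ ⟪ c ∷ τ ⟫ ⋆ L
  X∼ = ≅⇒∼ (solve 5 (λ v B y S L → (v :* (B :+ y :* S)) :* L := (y :* S) :* (v :* L) :+ B :* (v :* L)) (λ _ → id , id) ⟨ v ⟩ B ⟨ y ⟩ S₀ L)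
    ◅◅ Ball-conesOff j {(⟨ y ⟩ ⋆ S₀) ⋆ (⟨ v ⟩ ⋆ L)} {⟨ v ⟩ ⋆ L}
         (λ (_ , g , l) → (≢# (Low≢e (m≤n⇒m≤1+n ≤-refl) l) ⊗ Int⇒#Sph j g) ⊗ ≢# (Low≢e ≤-refl l) ⊗ low (≤-trans l (n-mono (suc j))))
         (λ l → ≢# (Low≢e ≤-refl l) ⊗ low (≤-trans l (n-mono (suc j))))
    ◅◅ ≅⇒∼ (solve 5 (λ y S v L c → (y :* S) :* (v :* L) :+ (c :* S) :* (v :* L) := S :* ((c :+ y) :* (v :* L))) (λ _ → id , id) ⟨ y ⟩ S₀ ⟨ v ⟩ L ⟨ c ⟩)
    ◅◅ eq
    ◅◅ suspension (NonEmpty-suc len) τ# (_ , ∈-⟨⟩⋆⁺ l∈) (Low≢e (m≤n⇒m≤1+n ≤-refl) (Low-e (n< j))) c# y#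
    ◅◅ cone-bd (c , here refl) cτ#vL (l , l∈) v#L

Inner-∼ : ∀ j → Inner (suc j) ∼ simplex (suc j)
-- The link factor consists of the antipodes of `v` and `y`: renaming by `σ` then produces the
-- negative half joined with v * y, and `ρ` fixes `v` and `y`.
Inner-∼ j with half-sphere-∼ j (⟨ σ (Lev.v j) ⟩ ⋆ ⟨ σ (Lev.y j) ⟩) (_ , ∈-⟨⟩⋆⁺ (here refl))
    (λ {u} p → ≢# (λ { refl → <⇒≱ p (≤-trans (n-mono j) (subst (n (suc j) ≤_) (sym (trans (half-σ (Lev.v j)) (half-e (n (suc j))))) ≤-refl)) }) ⊗
               ≢# (λ { refl → <⇒≱ p (≤-trans (n-mono j) (subst (n (suc j) ≤_) (sym (trans (half-σ (Lev.y j)) (half-e (suc (n (suc j)))))) (m≤n⇒m≤1+n ≤-refl))) }))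
... | τ , len , uniq , τ# , eq =
  ≅⇒∼ (subst (Inner (suc j) ≅_) (sym ren-eq) (≅-trans {Inner (suc j)} inner≅
    (solve 3 (λ v y E → v :* y :* E := E :* (v :* y)) (λ _ → id , id) ⟨ v ⟩ ⟨ y ⟩ (ren (ρ k) (ren σ (half-sphere S₀))))))
  ◅◅ ∼-ren-ρ k (Relabel.∼-ren σ σ-inv (eq ◅◅ ≅⇒∼ join≅))
  ◅◅ relabel Natural-facet {map (ρ k) (map σ τ′)} {upTo (suc (suc j))}
       (trans (length-map (ρ k) (map σ τ′)) (trans (length-map σ τ′) (trans (cong (λ a → suc (suc a)) len) (sym (length-upTo (suc (suc j)))))))
       (Unique.map⁺ (ρ-inj k) (Unique.map⁺ σ-inj (Uniq∷ v∉ (Uniq∷ y∉ uniq)))) (Unique.upTo⁺ (suc (suc j)))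
  where
  open Halves j
  open Lev j
  a = σ v
  b = σ y
  τ′ = a ∷ b ∷ τ
  a∉τ : a ∉ τ
  a∉τ z = τ# z (∈-⟨⟩⋆⁺ (here refl)) (here refl)
  y∉ : b ∉ τ
  y∉ z = τ# z (∈-⟨⟩⋆⁺ (here refl)) (there (here refl))
  v∉ : a ∉ b ∷ τ
  v∉ (here q) = v≢y (σ-inj q)
  v∉ (there z) = a∉τ z
  join≅ : (⟪ τ ⟫ ⋆ (⟨ a ⟩ ⋆ ⟨ b ⟩)) ≅ ⟪ τ′ ⟫
  join≅ = ≅-trans {⟪ τ ⟫ ⋆ (⟨ a ⟩ ⋆ ⟨ b ⟩)} {⟨ a ⟩ ⋆ ⟨ b ⟩ ⋆ ⟪ τ ⟫} {⟪ τ′ ⟫}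
    (solve 3 (λ t a b → t :* (a :* b) := a :* b :* t) (λ _ → id , id) ⟪ τ ⟫ ⟨ a ⟩ ⟨ b ⟩) (≼-≅ to from)
    where
    to : (⟨ a ⟩ ⋆ ⟨ b ⟩ ⋆ ⟪ τ ⟫) ≼ ⟪ τ′ ⟫
    to p with ∈-⟨⟩⋆⁻ p
    ... | _ , q , refl with ∈-⟨⟩⋆⁻ q
    ... | _ , here refl , refl = gen (here refl)
    from : ⟪ τ′ ⟫ ≼ (⟨ a ⟩ ⋆ ⟨ b ⟩ ⋆ ⟪ τ ⟫)
    from (here refl) = gen (∈-⟨⟩⋆⁺ (∈-⟨⟩⋆⁺ (here refl)))
  E = half-sphere S₀
  ren-eq : ren (ρ k) (ren σ (E ⋆ (⟨ a ⟩ ⋆ ⟨ b ⟩))) ≡ ren (ρ k) (ren σ E) ⋆ (⟨ v ⟩ ⋆ ⟨ y ⟩)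
  ren-eq = trans (cong (ren (ρ k)) (map-map-⋆ σ E _)) (trans (map-map-⋆ (ρ k) (ren σ E) _) (cong (ren (ρ k) (ren σ E) ⋆_)
    (trans (cong (ren (ρ k)) (map-map-⋆ σ ⟨ a ⟩ ⟨ b ⟩)) (trans (map-map-⋆ (ρ k) (ren σ ⟨ a ⟩) (ren σ ⟨ b ⟩))
      (cong₂ _⋆_ (cong ⟨_⟩ (trans (cong (ρ k) (σ-inv v)) (ρ-e (m≤n⇒m≤1+n ≤-refl)))) (cong ⟨_⟩ (trans (cong (ρ k) (σ-inv y)) (ρ-e ≤-refl))))))))

-- Numbers of vertices

<⇒half< : ∀ {u m} → u < e m → half u < m
<⇒half< {zero} {suc m} _ = s≤s z≤n
<⇒half< {suc zero} {suc m} _ = s≤s z≤n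
<⇒half< {suc (suc u)} {suc m} (s≤s (s≤s p)) = s≤s (<⇒half< p)

e-+ : ∀ a b → e (a + b) ≡ e a + e b
e-+ zero b = refl
e-+ (suc a) b = cong (λ u → suc (suc u)) (e-+ a b)

f₀-count : ∀ Δ N → (∀ {u} → u < N → u ∈V Δ) → (∀ {F u} → F ∈ Δ → u ∈ F → u < N) → f₀ Δ ≡ N
f₀-count Δ N all bound = ≤-antisym
  (subst (length vs ≤_) (length-upTo N) (length-mono (deduplicate-! (concat Δ)) λ z → ∈-upTo⁺ (below (∈-deduplicate⁻ _≟_ (concat Δ) z))))
  (subst (_≤ length vs) (length-upTo N) (length-mono (Unique.upTo⁺ N) λ z → ∈-deduplicate⁺ _≟_ (occurs (all (∈-upTo⁻ z)))))
  where
  vs = deduplicate _≟_ (concat Δ)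
  below : ∀ {u} → u ∈ concat Δ → u < N
  below z with ∈-concat⁻′ Δ z
  ... | F , u∈ , F∈ = bound F∈ u∈
  occurs : ∀ {u} → u ∈V Δ → u ∈ concat Δ
  occurs (F , F∈ , s) = ∈-concat⁺′ (s (here refl)) F∈

f₀-Sph : ∀ j → f₀ (Sph j) ≡ e (n j)
f₀-Sph j = f₀-count (Sph j) (e (n j)) (λ l → Facets.low (facets j) (<⇒half< l)) (λ F∈ u∈ → half<⇒< (Sph⊆ j F∈ u∈))

f₀-recursion : ∀ j → f₀ (Sph (suc (suc j))) ≡ f₀ (Sph (suc j)) + f₀ (Sph j) + 4
f₀-recursion j = trans (f₀-Sph (suc (suc j))) (trans (cong (4 +_) (e-+ (n (suc j)) (n j)))
  (trans (+-comm 4 _) (sym (cong (_+ 4) (cong₂ _+_ (f₀-Sph (suc j)) (f₀-Sph j))))))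

-- The properties of the family

#∅ : ∀ {u} → u # ⟪ [] ⟫
#∅ (here refl) ()

HasVertex-Sph : ∀ j → HasVertex (Sph (suc j))
HasVertex-Sph j = 0 , Facets.low (facets (suc j)) (≤-trans (s≤s z≤n) (n< j))

⋆-unit : ∀ Δ → (Δ ⋆ ⟪ [] ⟫) ≅ Δ
⋆-unit Δ = solve 1 (λ D → D :* con 1 := D) (λ _ → id , id) Δ

unit⇒PL : ∀ Δ Γ Θ → HasVertex Δ → Δ ⋆ ⟪ [] ⟫ ∼ Γ ⋆ ⟪ [] ⟫ → Γ ∼ Θ → PLHomeomorphic Δ Θ
unit⇒PL Δ Γ Θ h p q = ∼⇒PL h (≅⇒∼ (≅-sym {Δ ⋆ ⟪ [] ⟫} (⋆-unit Δ)) ◅◅ p ◅◅ ≅⇒∼ (⋆-unit Γ) ◅◅ q)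

SphereIn⇒PL : ∀ Δ d → HasVertex Δ → SphereIn Δ (suc d) ⟪ [] ⟫ → IsPLSphere d Δ
SphereIn⇒PL Δ d h (τ , len , uniq , _ , eq) = unit⇒PL Δ (bd τ) (∂simplex (suc d)) h eq
  (relabel Natural-bd {τ} {upTo (suc (suc d))} (trans len (sym (length-upTo (suc (suc d))))) uniq (Unique.upTo⁺ (suc (suc d))))

FacetIn⇒PL : ∀ Δ d → HasVertex Δ → FacetIn Δ (suc d) ⟪ [] ⟫ → IsPLBall d Δ
FacetIn⇒PL Δ d h (τ , len , uniq , _ , eq) = unit⇒PL Δ ⟪ τ ⟫ (simplex d) h eq
  (relabel Natural-facet {τ} {upTo (suc d)} (trans len (sym (length-upTo (suc d)))) uniq (Unique.upTo⁺ (suc d)))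

Sph-isPLSphere : ∀ j → IsPLSphere j (Sph (suc j))
Sph-isPLSphere j = SphereIn⇒PL (Sph (suc j)) j (HasVertex-Sph j) (Sph-∼ (suc j) ⟪ [] ⟫ (_ , here refl) (λ _ → #∅))

Ball-isPLBall : ∀ j → IsPLBall j (Ball (suc j))
Ball-isPLBall j = FacetIn⇒PL (Ball (suc j)) j (apex j , Facets.positive (facets j) (Positive-e (n j)) (Low-e (n< j)))
  (Ball-∼ j ⟪ [] ⟫ (_ , here refl) (λ _ → #∅))

Sph-isCS : ∀ j → IsCS σ (Sph j)
Sph-isCS j = (λ x _ → σ-inv x) ,
  (λ X (F , F∈ , s) → map σ F , Facets.symS₀ (facets j) F∈ , Sub.map⁺ σ s) ,
  -- A fixed face contains both `x` and `σ x`, so the degenerate choice z = a = x contradicts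
  -- `AntipodeFree`.
  λ X f (x , x∈) (s , _) → Sph-free j {x} {x} (Face-⊆ (λ { (here refl) → x∈ ; (there (here refl)) → x∈ }) f)
    (Face-⊆ (λ { (here refl) → x∈ ; (there (here refl)) → s (∈-map⁺ σ x∈) }) f)

free⇒no4Cycle : ∀ {Δ} → AntipodeFree Δ → ¬ HasInducedCS4Cycle σ Δ
free⇒no4Cycle {Δ} free (a , b , c , d , _ , ab , bc , cd , da , _ , _ , closed) = cases (closed a (here refl))
  where
  aa : Face Δ (a ∷ a ∷ [])
  aa = Face-⊆ (λ { (here refl) → here refl ; (there (here refl)) → here refl }) ab
  cases : σ a ∈ a ∷ b ∷ c ∷ d ∷ [] → ⊥
  cases (here p) = free aa (subst (λ u → Face Δ (a ∷ u ∷ [])) (sym p) aa)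
  cases (there (here p)) = free aa (subst (λ u → Face Δ (a ∷ u ∷ [])) (sym p) ab)
  -- If `σ a` is the opposite corner `c`, then `b` is adjacent to both; in the other cases `a`
  -- itself takes the role of `z`.
  cases (there (there (here p))) = free (flip-edge ab) (subst (λ u → Face Δ (b ∷ u ∷ [])) (sym p) bc)
  cases (there (there (there (here p)))) = free aa (subst (λ u → Face Δ (a ∷ u ∷ [])) (sym p) (flip-edge da))

σFace⇒ : ∀ {Γ X} → σFace σ Γ X → Face (ren σ Γ) X
σFace⇒ (Y , f , (s , _)) = Face-⊆ s (Face-σ f)

σFace⇐ : ∀ {Γ X} → Face (ren σ Γ) X → σFace σ Γ X
σFace⇐ {X = X} f = map σ X , Face-σ⁻ f , subst (X ⊆_) (sym (map-σσ X)) id , subst (_⊆ X) (sym (map-σσ X)) id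

Sph⊑Ball : ∀ j → Sph j ⊑ Ball (suc j)
Sph⊑Ball j X (G , G∈ , s) = Face-⊆ s (Facets.cover (facets j) G∈)

-- Let `u` be a vertex of the facet outside the ridge `R`. The facet of `B` across `R` would be a
-- second one containing `R`, so `opposite` must place `R` in `S₀`.
boundary⇒ : ∀ {k m d B S₀} → Facets k m d B S₀ → ∀ {X} → BoundaryFace d B X → Face S₀ X
boundary⇒ {d = d} {B} facts {X} (R , X⊆R , _ , (uniqR , lenR) , F , (F₀ , F₀∈ , F⊆F₀) , (uniqF , lenF) , R⊆F , only)
  with missing {R} {F₀} (proj₂ (Facets.pureB facts F₀∈)) (subst₂ _<_ (sym lenR) (sym (proj₁ (Facets.pureB facts F₀∈))) (n<1+n d))
... | u , u∈ , u∉R with Facets.opposite facts F₀∈ u∈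
... | inj₂ (G , G∈ , s , _) = G , G∈ , λ z → s (F⊆F₀ (R⊆F (X⊆R z))) λ { refl → u∉R (X⊆R z) }
... | inj₁ (F′ , F′∈ , s , u∉) = ⊥-elim (u∉ (proj₂ (only F′ (gen F′∈) (proj₂ (Facets.pureB facts F′∈) , proj₁ (Facets.pureB facts F′∈))
        λ z → s (F⊆F₀ (R⊆F z)) λ { refl → u∉R z }) u∈F))
  where
  u∈F : u ∈ F
  u∈F = ⊆-antisym uniqF (trans lenF (sym (proj₁ (Facets.pureB facts F₀∈)))) F⊆F₀ u∈

boundary⇐ : ∀ {k m d B S₀} → Facets k m d B S₀ → ∀ {X} → Face S₀ X → BoundaryFace d B X
boundary⇐ {d = d} {B} facts {X} (G , G∈ , s) with cover G∈
  where open Facets facts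
... | F , F∈ , t = G , s , cover G∈ , (proj₂ (pureS₀ G∈) , proj₁ (pureS₀ G∈)) ,
    F , gen F∈ , (proj₂ (pureB F∈) , proj₁ (pureB F∈)) , t , only
  where
  open Facets facts
  only : ∀ F′ → Face B F′ → HasCard F′ (suc d) → G ⊆ F′ → F′ ≈ˢ F
  only F′ (F₁ , F₁∈ , q) (uniq′ , len′) G⊆F′ = (λ z → unique G∈ F₁∈ F∈ (q ∘ G⊆F′) t (q z)) ,
    (λ z → ⊆-antisym uniq′ (trans len′ (sym (proj₁ (pureB F₁∈)))) q (unique G∈ F∈ F₁∈ t (q ∘ G⊆F′) z))

Inner-face : ∀ j {X} → Face (Inner (suc j)) X → Face (Ball (suc (suc j))) X × (∀ {z} → z ∈ X → n (suc j) ≤ half z)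
Inner-face j (_ , F∈ , s) with ∈-map⁻ (above (n (suc j))) F∈
... | F , F∈′ , refl = (F , F∈′ , λ z → proj₁ (∈-above⁻ {X = F} (s z))) , λ z → proj₂ (∈-above⁻ {X = F} (s z))

Inner-face⁺ : ∀ j {X} → Face (Ball (suc (suc j))) X → (∀ {z} → z ∈ X → n (suc j) ≤ half z) → Face (Inner (suc j)) X
Inner-face⁺ j (F , F∈ , s) g = _ , ∈-map⁺ (above (n (suc j))) F∈ , λ z → ∈-filter⁺ (λ u → n (suc j) ≤? half u) (s z) (g z)

pStep : ∀ i → PStep σ (suc i) (Sph (suc i)) (Sph (suc (suc i))) (Ball (suc (suc i))) (Inner (suc i)) (e (n (suc i)))
pStep i = Ball-isPLBall (suc i) , (λ X → Face-++ˡ) , ∼⇒PL (v , v∈D) (Inner-∼ i) , (λ X f → Face-++ˡ (proj₁ (Inner-face i f))) , v∈D ,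
  (λ X → (λ f → [ inj₁ , inj₂ ∘ σFace⇐ ]′ (Face-++⁻ ball f)) , [ Face-++ˡ , Face-++ʳ ball ∘ σFace⇒ ]′) ,
  (λ X → (λ (f , g) → boundary⇐ (facets (suc i)) (meet f (σFace⇒ g))) ,
         (λ b → let f = boundary⇒ (facets (suc i)) b in Sph⊑Ball (suc i) X f , σFace⇐ (σ-cover f))) ,
  (λ X → boundary⇒ (facets (suc i)) , boundary⇐ (facets (suc i))) ,
  (λ X → minus⇒ X , minus⇐ X) ,
  (λ x f g → D∩σD f (σFace⇒ g)) ,
  λ w f → star-cover (sphere-vertex f)
  where
  open Lev i
  m = n (suc i)
  v∈ball : Face ball (v ∷ v ∷ [])
  v∈ball = v-adjacent (Positive-e m) (Low-e m<m′)
  v∈D : v ∈V Inner (suc i)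
  v∈D = Inner-face⁺ i (Face-⊆ there v∈ball) λ { (here refl) → subst (m ≤_) (sym (half-e m)) ≤-refl }
  σ-cover : ∀ {X} → Face (Sph (suc i)) X → Face (ren σ ball) X
  σ-cover {X} (G , G∈ , s) = subst (Face (ren σ ball)) (map-σσ X)
    (Face-σ (Sph⊑Ball (suc i) (map σ X) (map σ G , S-sym G∈ , Sub.map⁺ σ s)))
  vertex : ∀ {X z} → Face ball X → z ∈ X → BallV m m′ z
  vertex (F , F∈ , s) z = ball⊆ F∈ (s z)
  σvertex : ∀ {X z} → Face (ren σ ball) X → z ∈ X → BallV m m′ (σ z)
  σvertex f z = vertex (Face-σ⁻ f) (∈-map⁺ σ z)
  low-both : ∀ {z} → BallV m m′ z → BallV m m′ (σ z) → half z < m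
  low-both (inj₁ l) _ = l
  low-both {z} _ (inj₁ l) = subst (_< m) (half-σ z) l
  low-both (inj₂ (p , _)) (inj₂ (q , _)) = ⊥-elim (Positive⇒¬σ p q)
  meet : ∀ {X} → Face ball X → Face (ren σ ball) X → Face (Sph (suc i)) X
  meet f g = ball-full f λ z → low-both (vertex f z) (σvertex g z)
  not-low : ∀ {X} → (∀ x → x ∈ X → ¬ (x ∈V Sph (suc i))) → ∀ {z} → z ∈ X → m ≤ half z
  not-low h z = ≮⇒≥ λ l → h _ z (S-vertices l)
  minus⇒ : ∀ X → MinusFace (Sph (suc (suc i))) (Sph (suc i)) X → Face (Inner (suc i)) X ⊎ σFace σ (Inner (suc i)) X
  minus⇒ X (f , h) with Face-++⁻ ball f
  ... | inj₁ g = inj₁ (Inner-face⁺ i g (not-low h))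
  ... | inj₂ g = inj₂ (map σ X , Inner-face⁺ i (Face-σ⁻ g) g′ , subst (X ⊆_) (sym (map-σσ X)) id , subst (_⊆ X) (sym (map-σσ X)) id)
    where
    g′ : ∀ {z} → z ∈ map σ X → m ≤ half z
    g′ z with ∈-map⁻ σ z
    ... | w , w∈ , refl = subst (m ≤_) (sym (half-σ w)) (not-low h w∈)
  high⇒∉ : ∀ {x} → m ≤ half x → ¬ (x ∈V Sph (suc i))
  high⇒∉ g (F , F∈ , s) = <⇒≱ (Sph⊆ (suc i) F∈ (s (here refl))) g
  minus⇐ : ∀ X → Face (Inner (suc i)) X ⊎ σFace σ (Inner (suc i)) X → MinusFace (Sph (suc (suc i))) (Sph (suc i)) X
  minus⇐ X (inj₁ f) = let (g , h) = Inner-face i f in Face-++ˡ g , λ x z → high⇒∉ (h z)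
  minus⇐ X (inj₂ (Y , f , s , _)) = let (g , h) = Inner-face i f in
    Face-++ʳ ball (Face-⊆ s (Face-σ g)) , λ x z → high⇒∉ (hσ h (s z))
    where
    hσ : (∀ {z} → z ∈ Y → m ≤ half z) → ∀ {x} → x ∈ map σ Y → m ≤ half x
    hσ h z with ∈-map⁻ σ z
    ... | w , w∈ , refl = subst (m ≤_) (sym (half-σ w)) (h w∈)
  D∩σD : ∀ {x} → x ∈V Inner (suc i) → Face (ren σ (Inner (suc i))) (x ∷ []) → ⊥
  D∩σD {x} f g = let (f′ , h) = Inner-face i f ; (g′ , _) = Inner-face i (Face-σ⁻ g) in
    <⇒≱ (low-both (vertex f′ (here refl)) (vertex g′ (here refl))) (h (here refl))
  sphere-vertex : ∀ {w} → w ∈V Sph (suc (suc i)) → half w < m′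
  sphere-vertex (F , F∈ , s) = Sph⊆ (suc (suc i)) F∈ (s (here refl))
  star-cover : ∀ {w} → half w < m′ → Face (Sph (suc (suc i))) (v ∷ w ∷ []) ⊎ Face (Sph (suc (suc i))) (σ v ∷ w ∷ [])
  star-cover {w} l with view w
  ... | inj₁ p = inj₁ (Face-++ˡ (v-adjacent p l))
  ... | inj₂ p = inj₂ (Face-++ʳ ball (subst (λ u → Face (ren σ ball) (σ v ∷ u ∷ [])) (σ-inv w)
          (Face-σ (v-adjacent (Negative⇒σ p) (Low-σ {m′} {w} l)))))

theorem4p4 : Σ (ℕ → ℕ) λ σ → Σ (ℕ → Complex) λ S →
    Σ (ℕ → Complex) λ B → Σ (ℕ → Complex) λ D → Σ (ℕ → ℕ) λ v →
    (∀ i → IsPLSphere i (S i) × IsCS σ (S i) × ¬ HasInducedCS4Cycle σ (S i)) ×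
    (∀ i → S i ⊑ S (suc i)) ×
    (v zero ∈V S zero) × (∀ X → Face (D zero) X ⇔ₚ Face ((v zero ∷ []) ∷ []) X) ×
    (∀ i → PStep σ (suc i) (S i) (S (suc i)) (B (suc i)) (D (suc i)) (v (suc i))) ×
    (∀ i → f₀ (S (suc (suc i))) ≡ f₀ (S (suc i)) + f₀ (S i) + 4)
theorem4p4 = σ , (λ i → Sph (suc i)) , (λ i → Ball (suc i)) , Inner , apex ,
  (λ i → Sph-isPLSphere i , Sph-isCS (suc i) , free⇒no4Cycle (Sph-free (suc i))) ,
  (λ i X f → Face-++ˡ (Sph⊑Ball (suc i) X f)) ,
  gen (here refl) , (λ X → id , id) ,
  -- The index is shifted because the family starts at `Sph 1`, one step after the sphere with only
  -- the empty face.
  pStep , λ i → f₀-recursion (suc i)
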